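{- Let $n\ge 1$ and $d\ge 3$ be integers and put $s=d-3$. Then the chamber-to-class map $$\Psi_{d,n}\colon \operatorname{Ch}\bigl(\mathcal H_n^{(d)}\bigr)\longrightarrow \{\mathtt a,\mathtt b\}^n/{\approx_s},\qquad C\longmapsto \bigl[\,W(\lambda_{\Delta(C)})\,\bigr]_s,$$ is a bijection.
   Context: **Arrangement.** For $i\in\{1,\dots,n\}$ let $H_i^{(d)}=\{x\in\mathbb R^d: 1+i x_1+i^2x_2+\cdots+i^dx_d=0\}$ and $\mathcal H_n^{(d)}=\{H_1^{(d)},\dots,H_n^{(d)}\}$. A chamber is a connected component of $\mathbb R^d\setminus\bigcup_i H_i^{(d)}$; $\operatorname{Ch}(\mathcal H_n^{(d)})$ is the set of chambers. For $x\in\mathbb R^d$ put $P_x(t)=1+x_1t+\cdots+x_dt^d$. The sign word of a chamber $C$ is $\sigma(C)=\sigma_1\cdots\sigma_n\in\{+,-\}^n$ with $\sigma_i=\operatorname{sgn}P_x(i)$ for any $x\in C$ (independent of the choice of $x$). The address of $C$ is $\Delta(C)\subseteq\{1,\dots,n\}$, the set of sign-change positions of the augmented word $+\sigma(C)$: with $\sigma_0:=+$, $\Delta(C)=\{i\in\{1,\dots,n\}:\sigma_{i-1}\ne\sigma_i\}$. It always satisfies $\#\Delta(C)\le d=s+3$. **Words.** For words $w,v$, $\binom{w}{v}$ is the number of occurrences of $v$ as a scattered subword of $w$ (number of index subsequences of $w$ spelling $v$); $|w|_{\mathtt a}$ is the number of letters $\mathtt a$ in $w$. For $u,w\in\{\mathtt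 a,\mathtt b\}^n$: $u\sim_2 w$ iff $|u|_{\mathtt a}=|w|_{\mathtt a}$ and $\binom{u}{\mathtt{ab}}=\binom{w}{\mathtt{ab}}$. For $w\in\{\mathtt a,\mathtt b\}^n$ let $\lambda(w)=(r_1,\dots,r_{|w|_{\mathtt a}})$ where $r_i$ is the number of $\mathtt b$'s to the right of the $i$-th $\mathtt a$ (so $r_1\ge r_2\ge\cdots\ge0$). For $s\ge0$ let $\ell=\min(s,|w|_{\mathtt a})$; the $s$-tail of $w$ is $\mathcal T_s(w)=(r_{|w|_{\mathtt a}},r_{|w|_{\mathtt a}-1},\dots,r_{|w|_{\mathtt a}-\ell+1})$ (empty if $\ell=0$). Define $u\approx_s w$ iff $u\sim_2 w$ and $\mathcal T_s(u)=\mathcal T_s(w)$; $[w]_s$ denotes the $\approx_s$-class of $w$ in $\{\mathtt a,\mathtt b\}^n$. **Words from partitions.** For $0\le j\le n$ and a weakly decreasing sequence $\lambda=(r_1,\dots,r_j)$ of integers in $[0,n-j]$ (exactly $j$ parts, zeros allowed), $W(\lambda)=\mathtt b^{(n-j)-r_1}\mathtt a\,\mathtt b^{r_1-r_2}\mathtt a\cdots \mathtt b^{r_{j-1}-r_j}\mathtt a\,\mathtt b^{r_j}$, and $W(\varnothing)=\mathtt b^n$. **The partition $\lambda_\Delta$.** Let $\Delta=\{c_1<\cdots<c_r\}\subseteq\{1,\dots,n\}$ with $r\le s+3$. Exponents denote repetition of a part; exponent $0$ means the part is absent. - Case I, $r\le s$: $\lambda_\Delta=(c_r-r,\,c_{r-1}-(r-1),\dots,c_1-1)$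 (empty if $r=0$). - Case II, $r=s+1$: if $s\ge1$, $\lambda_\Delta=\bigl((c_s-s)^{\,n-c_{s+1}+2},\,c_{s-1}-(s-1),\dots,c_1-1\bigr)$; if $s=0$, $\lambda_\Delta=(0^{\,n-c_1+1})$. - Case III, $r\in\{s+2,s+3\}$: if $r=s+2$ adjoin $c_{s+3}:=n+1$, so that in either case we have $c_1<\cdots<c_{s+3}$. If $s\ge1$, $\lambda_\Delta=\bigl((c_{s+2}-s-1)^{\,c_{s+3}-c_{s+2}-1},\,c_{s+1}-s,\,(c_s-s)^{\,n-c_{s+3}+2},\,c_{s-1}-(s-1),\dots,c_1-1\bigr)$; if $s=0$, $\lambda_\Delta=\bigl((c_2-1)^{\,c_3-c_2-1},\,c_1,\,0^{\,n-c_3+1}\bigr)$. (When $s=1$ the final list $c_{s-1}-(s-1),\dots,c_1-1$ is empty.) In every case $\lambda_\Delta$ is weakly decreasing with $j$ parts in $[0,n-j]$ for some $j\le n$, so $W(\lambda_\Delta)\in\{\mathtt a,\mathtt b\}^n$ is defined. -}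

module Defs where

open import Level using (0ℓ)
open import Data.Nat.Base as ℕ using (ℕ; zero; suc; _∸_; z≤n; s≤s)
import Data.Nat.Properties as ℕₚ
import Data.Nat.Solver as ℕSolver
import Data.Rational.Solver as ℚSolver
open import Data.Integer.Base using (+_)
open import Data.Rational.Base as ℚ using (ℚ; 0ℚ; 1ℚ; ½; 1/_; ∣_∣)
import Data.Rational.Properties as ℚₚ
open import Data.Fin.Base as Fin using (Fin; toℕ; inject₁)
import Data.Fin.Properties as Finₚ
open import Data.List.Base using (List; []; _∷_; _∷ʳ_; _++_; length; map; filter; replicate; reverse; take; allFin)
import Data.List.Properties as Listₚ
open import Data.List.Relation.Unary.All as All using (All; []; _∷_)
import Data.List.Relation.Unary.All.Properties as Allₚ
open import Data.List.Relation.Unary.AllPairs using (AllPairs; []; _∷_)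
import Data.List.Relation.Unary.AllPairs.Properties as AllPairsₚ
open import Data.List.Relation.Unary.Linked using (Linked; []; [-]; _∷_)
import Data.List.Relation.Unary.Linked.Properties as Linkedₚ
open import Data.Sign.Base as Sign using (Sign)
import Data.Sign.Properties as Signₚ
open import Data.Vec.Base using (Vec; lookup; tabulate; toList; fromList; cast) renaming (_∷_ to _∷ᵛ_)
open import Data.Vec.Functional using (Vector; foldr)
open import Data.Product.Base using (∃-syntax; _×_; _,_; proj₁; proj₂)
open import Data.Sum.Base using (_⊎_; inj₁; inj₂)
open import Function.Base using (id)
open import Relation.Nullary using (¬_; yes; no; ¬?)
open import Relation.Unary using (Pred; _∈_; _⊆_; _∪_; _∩_; _≐_; Satisfiable; Empty)
open import Relation.Binary.Definitions using (DecidableEquality)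
open import Relation.Binary.PropositionalEquality using (_≡_; _≢_; refl; sym; trans; cong; cong₂; subst; module ≡-Reasoning)

-- A real number is a Cauchy sequence of rationals, up to _≈ᵣ_.
record ℝ : Set where
  constructor mkℝ
  field
    seq    : ℕ → ℚ
    cauchy : ∀ ε → 0ℚ ℚ.< ε →
             ∃[ N ] ∀ m n → N ℕ.≤ m → N ℕ.≤ n → ∣ seq m ℚ.- seq n ∣ ℚ.< ε
open ℝ public

infix 4 _≈ᵣ_ _<ᵣ_ _#_

_≈ᵣ_ : ℝ → ℝ → Set
x ≈ᵣ y = ∀ ε → 0ℚ ℚ.< ε → ∃[ N ] ∀ n → N ℕ.≤ n → ∣ seq x n ℚ.- seq y n ∣ ℚ.< ε

_<ᵣ_ : ℝ → ℝ → Set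
x <ᵣ y = ∃[ ε ] 0ℚ ℚ.< ε × ∃[ N ] ∀ n → N ℕ.≤ n → seq x n ℚ.+ ε ℚ.≤ seq y n

-- Apartness, the constructive reading of "x ≠ y" for real numbers.
_#_ : ℝ → ℝ → Set
x # y = x <ᵣ y ⊎ y <ᵣ x

fromℚ : ℚ → ℝ
fromℚ q = mkℝ (λ _ → q) λ ε 0<ε → 0 , λ _ _ _ _ →
  subst (ℚ._< ε) (sym (cong ∣_∣ (ℚₚ.+-inverseʳ q))) 0<ε

fromℕ : ℕ → ℝ
fromℕ k = fromℚ (+ k ℚ./ 1)

private
  half-sum : ∀ ε → ½ ℚ.* ε ℚ.+ ½ ℚ.* ε ≡ ε
  half-sum ε = trans (sym (ℚₚ.*-distribʳ-+ ε ½ ½)) (ℚₚ.*-identityˡ ε)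

  *-pos : ∀ {p q} → 0ℚ ℚ.< p → 0ℚ ℚ.< q → 0ℚ ℚ.< p ℚ.* q
  *-pos {p} {q} 0<p 0<q =
    subst (ℚ._< p ℚ.* q) (ℚₚ.*-zeroʳ p) (ℚₚ.*-monoʳ-<-pos p {{ℚ.positive 0<p}} 0<q)

  half-pos : ∀ {ε} → 0ℚ ℚ.< ε → 0ℚ ℚ.< ½ ℚ.* ε
  half-pos = *-pos (ℚₚ.positive⁻¹ ½)

  -- For B, ε > 0, the number δ = ε / B.
  divide : ∀ B ε → 0ℚ ℚ.< B → 0ℚ ℚ.< ε → ∃[ δ ] 0ℚ ℚ.< δ × B ℚ.* δ ≡ ε
  divide B ε 0<B 0<ε = (1/ B) ℚ.* ε , *-pos (ℚₚ.positive⁻¹ (1/ B) {{ℚₚ.1/pos⇒pos B}}) 0<ε ,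
    trans (sym (ℚₚ.*-assoc B (1/ B) ε))
      (trans (cong (ℚ._* ε) (ℚₚ.*-inverseʳ B)) (ℚₚ.*-identityˡ ε))
    where instance
      B-pos : ℚ.Positive B
      B-pos = ℚ.positive 0<B
      B-nonZero : ℚ.NonZero B
      B-nonZero = ℚₚ.pos⇒nonZero B

  eventually-bounded : (x : ℝ) → ∃[ B ] 0ℚ ℚ.< B × ∃[ N ] ∀ n → N ℕ.≤ n → ∣ seq x n ∣ ℚ.≤ B
  eventually-bounded x = B , 0<B , N , bound
    where
    open ℚₚ.≤-Reasoning
    N = proj₁ (cauchy x 1ℚ (ℚₚ.positive⁻¹ 1ℚ))
    near = proj₂ (cauchy x 1ℚ (ℚₚ.positive⁻¹ 1ℚ))
    B = ∣ seq x N ∣ ℚ.+ 1ℚ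
    0<B : 0ℚ ℚ.< B
    0<B = ℚₚ.+-mono-≤-< (ℚₚ.0≤∣p∣ (seq x N)) (ℚₚ.positive⁻¹ 1ℚ)
    split : ∀ p q → p ≡ q ℚ.+ (p ℚ.- q)
    split p q = sym (trans (cong (q ℚ.+_) (ℚₚ.+-comm p (ℚ.- q)))
      (trans (sym (ℚₚ.+-assoc q (ℚ.- q) p))
        (trans (cong (ℚ._+ p) (ℚₚ.+-inverseʳ q)) (ℚₚ.+-identityˡ p))))
    bound : ∀ n → N ℕ.≤ n → ∣ seq x n ∣ ℚ.≤ B
    bound n N≤n = begin
      ∣ seq x n ∣                                  ≡⟨ cong ∣_∣ (split (seq x n) (seq x N)) ⟩
      ∣ seq x N ℚ.+ (seq x n ℚ.- seq x N) ∣        ≤⟨ ℚₚ.∣p+q∣≤∣p∣+∣q∣ (seq x N) (seq x n ℚ.- seq x N) ⟩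
      ∣ seq x N ∣ ℚ.+ ∣ seq x n ℚ.- seq x N ∣      ≤⟨ ℚₚ.+-monoʳ-≤ ∣ seq x N ∣ (ℚₚ.<⇒≤ (near n N N≤n ℕₚ.≤-refl)) ⟩
      B                                            ∎

  +-diff : ∀ a b c d → (a ℚ.+ b) ℚ.- (c ℚ.+ d) ≡ (a ℚ.- c) ℚ.+ (b ℚ.- d)
  +-diff = solve 4 (λ a b c d → (a :+ b) :- (c :+ d) := (a :- c) :+ (b :- d)) refl
    where open ℚSolver.+-*-Solver

  *-diff : ∀ a b c d → (a ℚ.* b) ℚ.- (c ℚ.* d) ≡ a ℚ.* (b ℚ.- d) ℚ.+ d ℚ.* (a ℚ.- c)
  *-diff = solve 4 (λ a b c d → (a :* b) :- (c :* d) := a :* (b :- d) :+ d :* (a :- c)) refl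
    where open ℚSolver.+-*-Solver

infixl 6 _+ᵣ_
infixl 7 _*ᵣ_
infixr 8 _^ᵣ_

_+ᵣ_ : ℝ → ℝ → ℝ
seq (x +ᵣ y) n = seq x n ℚ.+ seq y n
cauchy (x +ᵣ y) ε 0<ε with cauchy x (½ ℚ.* ε) (half-pos 0<ε) | cauchy y (½ ℚ.* ε) (half-pos 0<ε)
... | N₁ , near₁ | N₂ , near₂ = N₁ ℕ.⊔ N₂ , near
  where
  open ℚₚ.≤-Reasoning
  near : ∀ m n → N₁ ℕ.⊔ N₂ ℕ.≤ m → N₁ ℕ.⊔ N₂ ℕ.≤ n →
         ∣ (seq x m ℚ.+ seq y m) ℚ.- (seq x n ℚ.+ seq y n) ∣ ℚ.< ε
  near m n N≤m N≤n = begin-strict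
    ∣ (seq x m ℚ.+ seq y m) ℚ.- (seq x n ℚ.+ seq y n) ∣
      ≡⟨ cong ∣_∣ (+-diff (seq x m) (seq y m) (seq x n) (seq y n)) ⟩
    ∣ (seq x m ℚ.- seq x n) ℚ.+ (seq y m ℚ.- seq y n) ∣
      ≤⟨ ℚₚ.∣p+q∣≤∣p∣+∣q∣ (seq x m ℚ.- seq x n) (seq y m ℚ.- seq y n) ⟩
    ∣ seq x m ℚ.- seq x n ∣ ℚ.+ ∣ seq y m ℚ.- seq y n ∣
      <⟨ ℚₚ.+-mono-< (near₁ m n (ℕₚ.m⊔n≤o⇒m≤o N₁ N₂ N≤m) (ℕₚ.m⊔n≤o⇒m≤o N₁ N₂ N≤n))
                     (near₂ m n (ℕₚ.m⊔n≤o⇒n≤o N₁ N₂ N≤m) (ℕₚ.m⊔n≤o⇒n≤o N₁ N₂ N≤n)) ⟩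
    ½ ℚ.* ε ℚ.+ ½ ℚ.* ε
      ≡⟨ half-sum ε ⟩
    ε ∎

_*ᵣ_ : ℝ → ℝ → ℝ
seq (x *ᵣ y) n = seq x n ℚ.* seq y n
cauchy (x *ᵣ y) ε 0<ε with eventually-bounded x | eventually-bounded y
... | B , 0<B , M₁ , bound₁ | C , 0<C , M₂ , bound₂
  with divide B (½ ℚ.* ε) 0<B (half-pos 0<ε) | divide C (½ ℚ.* ε) 0<C (half-pos 0<ε)
... | δ , 0<δ , Bδ≡ε/2 | η , 0<η , Cη≡ε/2
  with cauchy y δ 0<δ | cauchy x η 0<η
... | N₁ , near₁ | N₂ , near₂ = (M₁ ℕ.⊔ M₂) ℕ.⊔ (N₁ ℕ.⊔ N₂) , near
  where
  open ℚₚ.≤-Reasoning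
  scaled : ∀ {K θ} p q → 0ℚ ℚ.< K → ∣ p ∣ ℚ.≤ K → ∣ q ∣ ℚ.< θ → ∣ p ℚ.* q ∣ ℚ.< K ℚ.* θ
  scaled {K} {θ} p q 0<K p≤K q<θ = begin-strict
    ∣ p ℚ.* q ∣       ≡⟨ ℚₚ.∣p*q∣≡∣p∣*∣q∣ p q ⟩
    ∣ p ∣ ℚ.* ∣ q ∣   ≤⟨ ℚₚ.*-monoʳ-≤-nonNeg ∣ q ∣ {{ℚ.nonNegative (ℚₚ.0≤∣p∣ q)}} p≤K ⟩
    K ℚ.* ∣ q ∣       <⟨ ℚₚ.*-monoʳ-<-pos K {{ℚ.positive 0<K}} q<θ ⟩
    K ℚ.* θ           ∎
  near : ∀ m n → (M₁ ℕ.⊔ M₂) ℕ.⊔ (N₁ ℕ.⊔ N₂) ℕ.≤ m → (M₁ ℕ.⊔ M₂) ℕ.⊔ (N₁ ℕ.⊔ N₂) ℕ.≤ n →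
         ∣ seq x m ℚ.* seq y m ℚ.- seq x n ℚ.* seq y n ∣ ℚ.< ε
  near m n ≤m ≤n = begin-strict
    ∣ seq x m ℚ.* seq y m ℚ.- seq x n ℚ.* seq y n ∣
      ≡⟨ cong ∣_∣ (*-diff (seq x m) (seq y m) (seq x n) (seq y n)) ⟩
    ∣ seq x m ℚ.* (seq y m ℚ.- seq y n) ℚ.+ seq y n ℚ.* (seq x m ℚ.- seq x n) ∣
      ≤⟨ ℚₚ.∣p+q∣≤∣p∣+∣q∣ (seq x m ℚ.* (seq y m ℚ.- seq y n)) (seq y n ℚ.* (seq x m ℚ.- seq x n)) ⟩
    ∣ seq x m ℚ.* (seq y m ℚ.- seq y n) ∣ ℚ.+ ∣ seq y n ℚ.* (seq x m ℚ.- seq x n) ∣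
      <⟨ ℚₚ.+-mono-<
           (scaled (seq x m) (seq y m ℚ.- seq y n) 0<B
             (bound₁ m (ℕₚ.m⊔n≤o⇒m≤o M₁ M₂ (M≤ ≤m)))
             (near₁ m n (ℕₚ.m⊔n≤o⇒m≤o N₁ N₂ (N≤ ≤m)) (ℕₚ.m⊔n≤o⇒m≤o N₁ N₂ (N≤ ≤n))))
           (scaled (seq y n) (seq x m ℚ.- seq x n) 0<C
             (bound₂ n (ℕₚ.m⊔n≤o⇒n≤o M₁ M₂ (M≤ ≤n)))
             (near₂ m n (ℕₚ.m⊔n≤o⇒n≤o N₁ N₂ (N≤ ≤m)) (ℕₚ.m⊔n≤o⇒n≤o N₁ N₂ (N≤ ≤n)))) ⟩
    B ℚ.* δ ℚ.+ C ℚ.* η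
      ≡⟨ cong₂ ℚ._+_ Bδ≡ε/2 Cη≡ε/2 ⟩
    ½ ℚ.* ε ℚ.+ ½ ℚ.* ε
      ≡⟨ half-sum ε ⟩
    ε ∎
    where
    M≤ : ∀ {k} → (M₁ ℕ.⊔ M₂) ℕ.⊔ (N₁ ℕ.⊔ N₂) ℕ.≤ k → M₁ ℕ.⊔ M₂ ℕ.≤ k
    M≤ = ℕₚ.m⊔n≤o⇒m≤o (M₁ ℕ.⊔ M₂) (N₁ ℕ.⊔ N₂)
    N≤ : ∀ {k} → (M₁ ℕ.⊔ M₂) ℕ.⊔ (N₁ ℕ.⊔ N₂) ℕ.≤ k → N₁ ℕ.⊔ N₂ ℕ.≤ k
    N≤ = ℕₚ.m⊔n≤o⇒n≤o (M₁ ℕ.⊔ M₂) (N₁ ℕ.⊔ N₂)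

0ᵣ 1ᵣ : ℝ
0ᵣ = fromℚ 0ℚ
1ᵣ = fromℚ 1ℚ

_^ᵣ_ : ℝ → ℕ → ℝ
x ^ᵣ zero  = 1ᵣ
x ^ᵣ suc k = x *ᵣ (x ^ᵣ k)

Point : ℕ → Set
Point d = Vector ℝ d

-- y lies in the open sup-norm ball of radius ε around x.
Near : ∀ {d} → ℚ → Point d → Point d → Set
Near ε x y = ∀ k → x k <ᵣ y k +ᵣ fromℚ ε × y k <ᵣ x k +ᵣ fromℚ ε

Open : ∀ {d} → Pred (Point d) 0ℓ → Set
Open U = ∀ x → x ∈ U → ∃[ ε ] 0ℚ ℚ.< ε × (∀ y → Near ε x y → y ∈ U)

Connected : ∀ {d} → Pred (Point d) 0ℓ → Set₁
Connected S = ∀ U V → Open U → Open V → S ⊆ U ∪ V →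
              Satisfiable (S ∩ U) → Satisfiable (S ∩ V) → ¬ Empty (S ∩ (U ∩ V))

-- P x t = 1 + x₁ t + ⋯ + x_d tᵈ; the coordinate x_{k+1} is  x k.
P : ∀ {d} → Point d → ℝ → ℝ
P x t = 1ᵣ +ᵣ foldr _+ᵣ_ 0ᵣ (λ k → x k *ᵣ (t ^ᵣ suc (toℕ k)))

-- An index i ∈ {1,…,n} is represented by j : Fin n with i = j + 1.
node : ∀ {n} → Fin n → ℕ
node j = suc (toℕ j)

-- Points lying on no hyperplane {x ∣ P x i ≈ᵣ 0ᵣ}, i = 1, …, n.
Complement : ∀ d n → Pred (Point d) 0ℓ
Complement d n x = (j : Fin n) → P x (fromℕ (node j)) # 0ᵣ

-- A connected component of the complement: a nonempty connected subset that
-- is maximal among connected subsets.  Subsets need not respect _≈ᵣ_, but open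
-- sets do by definition and regions do by maximality.
record Chamber (d n : ℕ) : Set₁ where
  field
    region     : Pred (Point d) 0ℓ
    avoids     : region ⊆ Complement d n
    nonempty   : Satisfiable region
    connected  : Connected region
    maximal    : ∀ (D : Pred (Point d) 0ℓ) → D ⊆ Complement d n → Connected D →
                 region ⊆ D → D ⊆ region

infix 4 _≈ᶜ_

-- Chambers are equal when they are the same subset of ℝᵈ.
_≈ᶜ_ : ∀ {d n} → Chamber d n → Chamber d n → Set
C ≈ᶜ D = Chamber.region C ≐ Chamber.region D

sgn : (x : ℝ) → x # 0ᵣ → Sign
sgn x (inj₁ x<0) = Sign.-
sgn x (inj₂ 0<x) = Sign.+

σ : ∀ {d n} → Chamber d n → Vec Sign n
σ C = let x , x∈C = Chamber.nonempty C in
  tabulate (λ j → sgn (P x (fromℕ (node j))) (Chamber.avoids C x∈C j))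

-- Sign-change positions i ∈ {1,…,n} of the augmented word +σ₁⋯σₙ, in increasing order.
changes : ∀ {n} → Vec Sign n → List ℕ
changes {n} w = map node
  (filter (λ j → ¬? (lookup (Sign.+ ∷ᵛ w) (inject₁ j) Signₚ.≟ lookup (Sign.+ ∷ᵛ w) (Fin.suc j)))
          (allFin n))

Δ : ∀ {d n} → Chamber d n → List ℕ
Δ C = changes (σ C)

data Letter : Set where
  𝚊 𝚋 : Letter

_≟ₗ_ : DecidableEquality Letter
𝚊 ≟ₗ 𝚊 = yes refl
𝚊 ≟ₗ 𝚋 = no λ ()
𝚋 ≟ₗ 𝚊 = no λ ()
𝚋 ≟ₗ 𝚋 = yes refl

Word : ℕ → Set
Word n = Vec Letter n

∣_∣[_] : List Letter → Letter → ℕ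
∣ w ∣[ l ] = length (filter (_≟ₗ l) w)

-- One entry for each set of positions of the word.
subsequences : List Letter → List (List Letter)
subsequences []      = [] ∷ []
subsequences (l ∷ w) = map (l ∷_) (subsequences w) ++ subsequences w

binom : List Letter → List Letter → ℕ
binom w v = length (filter (λ u → Listₚ.≡-dec _≟ₗ_ u v) (subsequences w))

-- (r₁ , … , r_{|w|ₐ})
λ-of : List Letter → List ℕ
λ-of []      = []
λ-of (𝚊 ∷ w) = ∣ w ∣[ 𝚋 ] ∷ λ-of w
λ-of (𝚋 ∷ w) = λ-of w

-- take s  keeps min(s, |w|ₐ) entries.
s-tail : ℕ → List Letter → List ℕ
s-tail s w = take s (reverse (λ-of w))

infix 4 _∼₂_ _≈[_]_

_∼₂_ : ∀ {n} → Word n → Word n → Set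
u ∼₂ w = ∣ toList u ∣[ 𝚊 ] ≡ ∣ toList w ∣[ 𝚊 ]
       × binom (toList u) (𝚊 ∷ 𝚋 ∷ []) ≡ binom (toList w) (𝚊 ∷ 𝚋 ∷ [])

_≈[_]_ : ∀ {n} → Word n → ℕ → Word n → Set
u ≈[ s ] w = u ∼₂ w × s-tail s (toList u) ≡ s-tail s (toList w)

-- b^(m-r₁) a b^(r₁-r₂) a ⋯ a b^(r_j)
staircase : ℕ → List ℕ → List Letter
staircase m []       = replicate m 𝚋
staircase m (r ∷ rs) = replicate (m ∸ r) 𝚋 ++ 𝚊 ∷ staircase r rs

W : ℕ → List ℕ → List Letter
W n rs = staircase (n ∸ length rs) rs

-- In the definitions leading to  partition,  c k  stands for c_k.

-- (c_k - k , … , c₁ - 1)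
descend : (ℕ → ℕ) → ℕ → List ℕ
descend c zero    = []
descend c (suc k) = (c (suc k) ∸ suc k) ∷ descend c k

caseI : ℕ → (ℕ → ℕ) → List ℕ
caseI r c = descend c r

caseII : (n s : ℕ) → (ℕ → ℕ) → List ℕ
caseII n zero        c = replicate (1 ℕ.+ n ∸ c 1) 0
caseII n s@(suc s-1) c = replicate (2 ℕ.+ n ∸ c (1 ℕ.+ s)) (c s ∸ s) ++ descend c s-1

caseIII : (n s : ℕ) → (ℕ → ℕ) → List ℕ
caseIII n zero        c =
  replicate (c 3 ∸ c 2 ∸ 1) (c 2 ∸ 1) ++ c 1 ∷ replicate (1 ℕ.+ n ∸ c 3) 0
caseIII n s@(suc s-1) c =
  replicate (c (3 ℕ.+ s) ∸ c (2 ℕ.+ s) ∸ 1) (c (2 ℕ.+ s) ∸ s ∸ 1) ++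
  (c (1 ℕ.+ s) ∸ s) ∷
  replicate (2 ℕ.+ n ∸ c (3 ℕ.+ s)) (c s ∸ s) ++ descend c s-1

nth : List ℕ → ℕ → ℕ
nth []       _       = 0
nth (x ∷ xs) zero    = x
nth (x ∷ xs) (suc k) = nth xs k

-- With cs = c₁ < ⋯ < c_r: position k of the list 0, c₁, …, c_r, n+1.
-- The entry c_{r+1} = n+1 is the one adjoined when r = s+2.
index : ℕ → List ℕ → ℕ → ℕ
index n cs = nth (0 ∷ cs ∷ʳ suc n)

-- The last argument of  byCase  is r - s, truncated at 0.
byCase : (n s r : ℕ) → (ℕ → ℕ) → ℕ → List ℕ
byCase n s r c 0 = caseI r c
byCase n s r c 1 = caseII n s c
byCase n s r c 2 = caseIII n s c
byCase n s r c 3 = caseIII n s c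
byCase n s r c _ = []              -- r > s+3, which no chamber attains

partition : (n s : ℕ) → List ℕ → List ℕ
partition n s cs = byCase n s (length cs) (index n cs) (length cs ∸ s)

-- rs is weakly decreasing with parts at most m, where m = n - length rs.
Fits : ℕ → List ℕ → Set
Fits n rs = ∃[ m ] m ℕ.+ length rs ≡ n × Linked ℕ._≥_ (m ∷ rs)

private
  length-staircase : ∀ {m rs} → Linked ℕ._≥_ (m ∷ rs) → length (staircase m rs) ≡ m ℕ.+ length rs
  length-staircase {m} [-] = trans (Listₚ.length-replicate m) (sym (ℕₚ.+-identityʳ m))
  length-staircase {m} {r ∷ rs} (m≥r ∷ rest) = begin
    length (replicate (m ∸ r) 𝚋 ++ 𝚊 ∷ staircase r rs)
      ≡⟨ Listₚ.length-++ (replicate (m ∸ r) 𝚋) ⟩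
    length (replicate (m ∸ r) 𝚋) ℕ.+ suc (length (staircase r rs))
      ≡⟨ cong₂ (λ p q → p ℕ.+ suc q) (Listₚ.length-replicate (m ∸ r)) (length-staircase rest) ⟩
    (m ∸ r) ℕ.+ suc (r ℕ.+ length rs)
      ≡⟨ cong ((m ∸ r) ℕ.+_) (sym (ℕₚ.+-suc r (length rs))) ⟩
    (m ∸ r) ℕ.+ (r ℕ.+ suc (length rs))
      ≡⟨ sym (ℕₚ.+-assoc (m ∸ r) r (suc (length rs))) ⟩
    ((m ∸ r) ℕ.+ r) ℕ.+ suc (length rs)
      ≡⟨ cong (ℕ._+ suc (length rs)) (ℕₚ.m∸n+n≡m m≥r) ⟩
    m ℕ.+ suc (length rs) ∎
    where open ≡-Reasoning

length-W : ∀ {n rs} → Fits n rs → length (W n rs) ≡ n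
length-W {rs = rs} (m , refl , dec) = trans
  (cong (λ k → length (staircase k rs)) (ℕₚ.m+n∸n≡m m (length rs))) (length-staircase dec)

length-descend : ∀ c k → length (descend c k) ≡ k
length-descend c zero    = refl
length-descend c (suc k) = cong suc (length-descend c k)

nth-mono : ∀ {x xs} → Linked ℕ._<_ (x ∷ xs) → ∀ k → k ℕ.< length xs →
           nth (x ∷ xs) k ℕ.< nth (x ∷ xs) (suc k)
nth-mono (x<y ∷ _)  zero    _         = x<y
nth-mono (_ ∷ rest) (suc k) (s≤s k<l) = nth-mono rest k k<l

nth-last : ∀ xs {z} → nth (xs ∷ʳ z) (length xs) ≡ z
nth-last []       = refl
nth-last (x ∷ xs) = nth-last xs

linked-replicate : ∀ {m v rs} j → v ℕ.≤ m → Linked ℕ._≥_ (v ∷ rs) →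
                   Linked ℕ._≥_ (m ∷ replicate j v ++ rs)
linked-replicate zero    v≤m [-]          = [-]
linked-replicate zero    v≤m (r≤v ∷ rest) = ℕₚ.≤-trans r≤v v≤m ∷ rest
linked-replicate (suc j) v≤m rest         = v≤m ∷ linked-replicate j ℕₚ.≤-refl rest

private
  module _ (n r : ℕ) (c : ℕ → ℕ)
           (c-mono : ∀ k → k ℕ.≤ r → c k ℕ.< c (suc k))
           (c-last : c (suc r) ≡ suc n) where

    k≤c : ∀ k → k ℕ.≤ suc r → k ℕ.≤ c k
    k≤c zero    _         = z≤n
    k≤c (suc k) (s≤s k≤r) = ℕₚ.≤-<-trans (k≤c k (ℕₚ.m≤n⇒m≤1+n k≤r)) (c-mono k k≤r)

    gap : ∀ k → k ℕ.≤ r → c k ∸ k ℕ.≤ c (suc k) ∸ suc k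
    gap k k≤r = ℕₚ.∸-monoˡ-≤ (suc k) (c-mono k k≤r)

    c≤ : ∀ k → k ℕ.≤ r → c (suc k) ℕ.≤ suc n
    c≤ k k≤r with ℕₚ.m≤n⇒m<n∨m≡n k≤r
    ... | inj₂ refl = ℕₚ.≤-reflexive c-last
    ... | inj₁ k<r  = climb (r ∸ suc k) (ℕₚ.m+[n∸m]≡n k<r)
      where
      up : ∀ j i → j ℕ.+ i ≡ suc r → c i ℕ.≤ c (suc r)
      up zero    i refl = ℕₚ.≤-refl
      up (suc j) i eq   = ℕₚ.≤-trans (ℕₚ.<⇒≤ (c-mono i i≤r)) (up j (suc i) (trans (ℕₚ.+-suc j i) eq))
        where
        i≤r : i ℕ.≤ r
        i≤r = subst (i ℕ.≤_) (ℕₚ.suc-injective eq) (ℕₚ.m≤n+m i j)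
      climb : ∀ j → suc k ℕ.+ j ≡ r → c (suc k) ℕ.≤ suc n
      climb j eq = subst (c (suc k) ℕ.≤_) c-last
        (up (suc j) (suc k) (cong suc (trans (ℕₚ.+-comm j (suc k)) eq)))

    linked-descend : ∀ k {m} → k ℕ.≤ r → c k ∸ k ℕ.≤ m → Linked ℕ._≥_ (m ∷ descend c k)
    linked-descend zero    _   _  = [-]
    linked-descend (suc k) k<r le = le ∷ linked-descend k (ℕₚ.<⇒≤ k<r) (gap k (ℕₚ.<⇒≤ k<r))

    fitsI : Fits n (caseI r c)
    fitsI = n ∸ r
          , trans (cong ((n ∸ r) ℕ.+_) (length-descend c r)) (ℕₚ.m∸n+n≡m r≤n)
          , linked-descend r ℕₚ.≤-refl
              (subst (λ z → c r ∸ r ℕ.≤ z ∸ suc r) c-last (gap r ℕₚ.≤-refl))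
      where
      r≤n : r ℕ.≤ n
      r≤n = ℕₚ.≤-pred (subst (suc r ℕ.≤_) c-last (k≤c (suc r) ℕₚ.≤-refl))

    excess : ∀ s {e} → r ∸ s ≡ suc e → r ≡ suc e ℕ.+ s
    excess s eq = trans (sym (ℕₚ.m∸n+n≡m {r} {s} (ℕₚ.<⇒≤ (ℕₚ.m∸n≢0⇒n<m {r} {s} r∸s≢0)))) (cong (ℕ._+ s) eq)
      where
      r∸s≢0 : r ∸ s ≢ 0
      r∸s≢0 eq′ = ℕₚ.0≢1+n (trans (sym eq′) eq)

    split : ∀ {i j} → i ℕ.≤ j → i ℕ.+ (j ∸ i) ≡ j
    split = ℕₚ.m+[n∸m]≡n

    linked-zeros : ∀ {m} j → Linked ℕ._≥_ (m ∷ replicate j 0)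
    linked-zeros zero    = [-]
    linked-zeros (suc j) = z≤n ∷ linked-zeros j

    fitsII : ∀ s → suc s ≡ r → Fits n (caseII n s c)
    fitsII zero refl = c 1 ∸ 1 , total , linked-zeros (1 ℕ.+ n ∸ c 1)
      where
      1≤c : 1 ℕ.≤ c 1
      1≤c = k≤c 1 (s≤s z≤n)
      total : (c 1 ∸ 1) ℕ.+ length (replicate (1 ℕ.+ n ∸ c 1) 0) ≡ n
      total = trans (cong ((c 1 ∸ 1) ℕ.+_) (Listₚ.length-replicate (1 ℕ.+ n ∸ c 1)))
        (ℕₚ.suc-injective (trans (cong (ℕ._+ (1 ℕ.+ n ∸ c 1)) (split 1≤c))
                                 (split (c≤ 0 z≤n))))
    fitsII (suc t) refl = m , total
      , linked-replicate h (gap (suc t) (ℕₚ.n≤1+n _))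
          (linked-descend t (ℕₚ.≤-trans (ℕₚ.n≤1+n _) (ℕₚ.n≤1+n _)) (gap t (ℕₚ.≤-trans (ℕₚ.n≤1+n _) (ℕₚ.n≤1+n _))))
      where
      open ≡-Reasoning
      m = c (2 ℕ.+ t) ∸ (2 ℕ.+ t)
      h = 2 ℕ.+ n ∸ c (2 ℕ.+ t)
      v = c (1 ℕ.+ t) ∸ (1 ℕ.+ t)
      c≡ : (2 ℕ.+ t) ℕ.+ m ≡ c (2 ℕ.+ t)
      c≡ = split (k≤c (2 ℕ.+ t) (ℕₚ.n≤1+n _))
      n≡ : c (2 ℕ.+ t) ℕ.+ h ≡ 2 ℕ.+ n
      n≡ = split (ℕₚ.m≤n⇒m≤1+n (c≤ (1 ℕ.+ t) (ℕₚ.n≤1+n _)))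
      total : m ℕ.+ length (replicate h v ++ descend c t) ≡ n
      total = ℕₚ.+-cancelˡ-≡ 2 _ _ (begin
        2 ℕ.+ (m ℕ.+ length (replicate h v ++ descend c t))
          ≡⟨ cong (λ z → 2 ℕ.+ (m ℕ.+ z)) (trans (Listₚ.length-++ (replicate h v))
               (cong₂ ℕ._+_ (Listₚ.length-replicate h) (length-descend c t))) ⟩
        2 ℕ.+ (m ℕ.+ (h ℕ.+ t))
          ≡⟨ shuffle m h t ⟩
        ((2 ℕ.+ t) ℕ.+ m) ℕ.+ h
          ≡⟨ cong (ℕ._+ h) c≡ ⟩
        c (2 ℕ.+ t) ℕ.+ h
          ≡⟨ n≡ ⟩
        2 ℕ.+ n ∎)
        where
        shuffle : ∀ m h t → 2 ℕ.+ (m ℕ.+ (h ℕ.+ t)) ≡ ((2 ℕ.+ t) ℕ.+ m) ℕ.+ h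
        shuffle = solve 3 (λ m h t → con 2 :+ (m :+ (h :+ t)) := ((con 2 :+ t) :+ m) :+ h) refl
          where open ℕSolver.+-*-Solver

    fitsIII : ∀ s → 2 ℕ.+ s ℕ.≤ r → Fits n (caseIII n s c)
    fitsIII zero 2≤r = m , total
      , linked-replicate g ℕₚ.≤-refl
          (ℕₚ.∸-monoˡ-≤ 1 (c-mono 1 1≤r) ∷ linked-zeros h)
      where
      open ≡-Reasoning
      1≤r = ℕₚ.≤-trans (ℕₚ.n≤1+n 1) 2≤r
      m = c 2 ∸ 1
      g = c 3 ∸ c 2 ∸ 1
      h = 1 ℕ.+ n ∸ c 3
      g≡ : suc (c 2) ℕ.+ g ≡ c 3
      g≡ = trans (cong (suc (c 2) ℕ.+_)
             (trans (ℕₚ.∸-+-assoc (c 3) (c 2) 1) (cong (c 3 ∸_) (ℕₚ.+-comm (c 2) 1))))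
             (split (c-mono 2 2≤r))
      total : m ℕ.+ length (replicate g m ++ c 1 ∷ replicate h 0) ≡ n
      total = ℕₚ.+-cancelˡ-≡ 1 _ _ (begin
        1 ℕ.+ (m ℕ.+ length (replicate g m ++ c 1 ∷ replicate h 0))
          ≡⟨ cong (λ z → 1 ℕ.+ (m ℕ.+ z)) (trans (Listₚ.length-++ (replicate g m))
               (cong₂ (λ p q → p ℕ.+ suc q) (Listₚ.length-replicate g) (Listₚ.length-replicate h))) ⟩
        1 ℕ.+ (m ℕ.+ (g ℕ.+ suc h))
          ≡⟨ shuffle m g h ⟩
        (suc (1 ℕ.+ m) ℕ.+ g) ℕ.+ h
          ≡⟨ cong (λ z → (suc z ℕ.+ g) ℕ.+ h) (split (ℕₚ.≤-trans (ℕₚ.n≤1+n 1) (k≤c 2 (ℕₚ.m≤n⇒m≤1+n 2≤r)))) ⟩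
        (suc (c 2) ℕ.+ g) ℕ.+ h
          ≡⟨ cong (ℕ._+ h) g≡ ⟩
        c 3 ℕ.+ h
          ≡⟨ split (c≤ 2 2≤r) ⟩
        1 ℕ.+ n ∎)
        where
        shuffle : ∀ m g h → 1 ℕ.+ (m ℕ.+ (g ℕ.+ suc h)) ≡ (suc (1 ℕ.+ m) ℕ.+ g) ℕ.+ h
        shuffle = solve 3 (λ m g h → con 1 :+ (m :+ (g :+ (con 1 :+ h))) := ((con 1 :+ (con 1 :+ m)) :+ g) :+ h) refl
          where open ℕSolver.+-*-Solver
    fitsIII s@(suc t) 2+s≤r = m , total
      , linked-replicate g ℕₚ.≤-refl
          (p≤m ∷ linked-replicate h v≤p (linked-descend t t≤r (gap t t≤r)))
      where
      open ≡-Reasoning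
      1+s≤r = ℕₚ.≤-trans (ℕₚ.n≤1+n _) 2+s≤r
      s≤r = ℕₚ.≤-trans (ℕₚ.n≤1+n _) 1+s≤r
      t≤r = ℕₚ.≤-trans (ℕₚ.n≤1+n _) s≤r
      m = c (2 ℕ.+ s) ∸ s ∸ 1
      g = c (3 ℕ.+ s) ∸ c (2 ℕ.+ s) ∸ 1
      h = 2 ℕ.+ n ∸ c (3 ℕ.+ s)
      p = c (1 ℕ.+ s) ∸ s
      v = c s ∸ s
      one-more : ∀ x y → x ∸ y ∸ 1 ≡ x ∸ suc y
      one-more x y = trans (ℕₚ.∸-+-assoc x y 1) (cong (x ∸_) (ℕₚ.+-comm y 1))
      p≤m : p ℕ.≤ m
      p≤m = subst (p ℕ.≤_) (sym (one-more (c (2 ℕ.+ s)) s)) (ℕₚ.∸-monoˡ-≤ (suc s) (c-mono (1 ℕ.+ s) 1+s≤r))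
      v≤p : v ℕ.≤ p
      v≤p = ℕₚ.∸-monoˡ-≤ s (ℕₚ.<⇒≤ (c-mono s s≤r))
      c≡ : suc s ℕ.+ m ≡ c (2 ℕ.+ s)
      c≡ = trans (cong (suc s ℕ.+_) (one-more (c (2 ℕ.+ s)) s))
             (split (ℕₚ.≤-trans (ℕₚ.n≤1+n _) (k≤c (2 ℕ.+ s) (ℕₚ.m≤n⇒m≤1+n 2+s≤r))))
      g≡ : suc (c (2 ℕ.+ s)) ℕ.+ g ≡ c (3 ℕ.+ s)
      g≡ = trans (cong (suc (c (2 ℕ.+ s)) ℕ.+_) (one-more (c (3 ℕ.+ s)) (c (2 ℕ.+ s))))
             (split (c-mono (2 ℕ.+ s) 2+s≤r))
      total : m ℕ.+ length (replicate g m ++ p ∷ replicate h v ++ descend c t) ≡ n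
      total = ℕₚ.+-cancelˡ-≡ 2 _ _ (begin
        2 ℕ.+ (m ℕ.+ length (replicate g m ++ p ∷ replicate h v ++ descend c t))
          ≡⟨ cong (λ z → 2 ℕ.+ (m ℕ.+ z)) (trans (Listₚ.length-++ (replicate g m))
               (cong₂ (λ i j → i ℕ.+ suc j) (Listₚ.length-replicate g)
                 (trans (Listₚ.length-++ (replicate h v))
                   (cong₂ ℕ._+_ (Listₚ.length-replicate h) (length-descend c t))))) ⟩
        2 ℕ.+ (m ℕ.+ (g ℕ.+ suc (h ℕ.+ t)))
          ≡⟨ shuffle m g h t ⟩
        (suc (suc s ℕ.+ m) ℕ.+ g) ℕ.+ h
          ≡⟨ cong (λ z → (suc z ℕ.+ g) ℕ.+ h) c≡ ⟩
        (suc (c (2 ℕ.+ s)) ℕ.+ g) ℕ.+ h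
          ≡⟨ cong (ℕ._+ h) g≡ ⟩
        c (3 ℕ.+ s) ℕ.+ h
          ≡⟨ split (ℕₚ.m≤n⇒m≤1+n (c≤ (2 ℕ.+ s) 2+s≤r)) ⟩
        2 ℕ.+ n ∎)
        where
        shuffle : ∀ m g h t → 2 ℕ.+ (m ℕ.+ (g ℕ.+ suc (h ℕ.+ t))) ≡ (suc (suc (suc t) ℕ.+ m) ℕ.+ g) ℕ.+ h
        shuffle = solve 4 (λ m g h t → con 2 :+ (m :+ (g :+ (con 1 :+ (h :+ t))))
                    := ((con 1 :+ ((con 2 :+ t) :+ m)) :+ g) :+ h) refl
          where open ℕSolver.+-*-Solver

    fits-byCase : ∀ s e → r ∸ s ≡ e → Fits n (byCase n s r c e)
    fits-byCase s 0 _  = fitsI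
    fits-byCase s 1 eq = fitsII s (sym (excess s eq))
    fits-byCase s 2 eq = fitsIII s (ℕₚ.≤-reflexive (sym (excess s eq)))
    fits-byCase s 3 eq = fitsIII s (ℕₚ.≤-trans (ℕₚ.n≤1+n _) (ℕₚ.≤-reflexive (sym (excess s eq))))
    fits-byCase s (suc (suc (suc (suc _)))) _ = n , ℕₚ.+-identityʳ n , [-]

changes-increasing : ∀ {n} (w : Vec Sign n) → Linked ℕ._<_ (0 ∷ changes w ∷ʳ suc n)
changes-increasing {n} w = Linkedₚ.AllPairs⇒Linked (positive ∷ sorted)
  where
  differ = λ j → ¬? (lookup (Sign.+ ∷ᵛ w) (inject₁ j) Signₚ.≟ lookup (Sign.+ ∷ᵛ w) (Fin.suc j))
  positive : All (0 ℕ.<_) (changes w ∷ʳ suc n)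
  positive = Allₚ.++⁺ (Allₚ.map⁺ (All.universal (λ _ → s≤s z≤n) _)) (s≤s z≤n ∷ [])
  sorted : AllPairs ℕ._<_ (changes w ∷ʳ suc n)
  sorted = AllPairsₚ.++⁺
    (AllPairsₚ.map⁺ (AllPairsₚ.filter⁺ differ (AllPairsₚ.tabulate⁺-< {f = id} s≤s)))
    ([] ∷ [])
    (Allₚ.map⁺ (All.universal (λ j → s≤s (Finₚ.toℕ<n j) ∷ []) _))

fits-partition : ∀ {n} s (w : Vec Sign n) → Fits n (partition n s (changes w))
fits-partition {n} s w = fits-byCase n r (index n cs)
  (λ k k≤r → nth-mono (changes-increasing w) k
     (subst (k ℕ.<_) (sym (trans (Listₚ.length-++ cs) (ℕₚ.+-comm r 1))) (s≤s k≤r)))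
  (nth-last cs) s (r ∸ s) refl
  where
  cs = changes w
  r  = length cs

Ψ : ∀ d n → Chamber d n → Word n
Ψ d n C = cast (length-W (fits-partition s (σ C))) (fromList (W n (partition n s (Δ C))))
  where s = d ∸ 3

-- An address c₁ < ⋯ < c_r is determined by the class of its word.  The s smallest parts
-- of the partition give c₁, …, c_s.  The k parts above them lie between v = c_s - s and
-- M = n - j; the number j of parts gives M, hence c_{s+1} or c_{s+2}.  The sum of these k
-- parts is k v in Case II, and in Case III
--   sum = g M + p + (k - 1 - g) v  with  v < p ≤ M,
-- so that Euclidean division of  sum - k v - 1  by  M - v  recovers the two remaining
-- elements of the address, and every class arises from exactly one address.
--
-- A chamber is the convex cell of its sign word: a cell is connected by bisection along
-- segments, and signs are constant on connected sets since P x i ≠ 0 splits into two open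
-- conditions.  A sign word occurs iff it has at most d changes.  Necessity is discrete
-- Rolle: passing to differences loses at most one sign alternation, and the (d+1)-st
-- difference of a polynomial of degree ≤ d vanishes; strict signs allow the coefficients
-- to be replaced by rational approximations.  Conversely the product of the factors
-- 1 - t / (c - ½) over the changes c realises the word.

module Submission where

open import Level using (0ℓ)
open import Data.Nat.Base using (ℕ; zero; suc; _+_; _*_; _∸_; _⊔_; _≤_; _<_; _≥_; z≤n; s≤s; _≤′_; ≤′-reflexive; ≤′-step)
import Data.Nat.Properties as ℕₚ
import Data.Nat.Solver as ℕSolver
open import Data.Nat.ListAction using (sum)
open import Data.Nat.ListAction.Properties using (sum-++)
open import Data.Integer.Base as ℤ using ()
import Data.Integer.Properties as ℤₚ
open import Data.Rational.Base as ℚ using (ℚ; 0ℚ; 1ℚ; ½; 1/_; ∣_∣)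
import Data.Rational.Properties as ℚₚ
import Data.Rational.Unnormalised.Base as ℚᵘ
import Data.Rational.Unnormalised.Properties as ℚᵘₚ
import Data.Rational.Solver as ℚSolver
open import Data.Sign.Base as Sign using (Sign; opposite)
import Data.Sign.Properties as Signₚ
open import Data.Fin.Base as Fin using (Fin; toℕ; inject₁)
open import Data.List.Base using (List; []; _∷_; _∷ʳ_; _++_; length; map; filter; replicate; reverse; take; drop; applyDownFrom; applyUpTo; allFin) renaming (tabulate to tabulateₗ)
import Data.List.Properties as Listₚ
open import Data.List.Relation.Unary.All as All using (All; []; _∷_)
open import Data.List.Relation.Unary.Linked as Linked using (Linked; []; [-]; _∷_)
open import Data.Vec.Base using (Vec; []; _∷_; lookup; tabulate; toList; fromList; cast)
import Data.Vec.Properties as Vecₚ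
open import Data.Vec.Functional as Functional using (Vector; foldr)
open import Data.Product.Base using (∃-syntax; _×_; _,_; proj₁; proj₂)
open import Data.Sum.Base using (_⊎_; inj₁; inj₂)
open import Function.Base using (_∘_; id)
open import Function.Structures using (IsBijection)
open import Relation.Nullary using (¬_; yes; no; ¬?; contradiction)
open import Relation.Unary using (Pred; Decidable; _∈_; _⊆_; _∪_; _∩_; Satisfiable)
open import Relation.Binary.Definitions using (tri<; tri≈; tri>)
open import Relation.Binary.PropositionalEquality using (_≡_; _≢_; refl; sym; trans; cong; cong₂; subst; subst₂; module ≡-Reasoning)
open import Defs

-- A class remembers of a word only the length, the sum and the last s parts of `λ-of`. If k parts
-- are confined to [v , M], the excess of their sum over k v runs through 0, ..., k (M - v). Excess
-- 0 is left to Case II, and the k (M - v) positive values match the pairs (g , p) with g < k and v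
-- < p ≤ M: this count is why Case III has exactly these two further parameters. Its two sizes r =
-- s+2 and r = s+3 share one formula, because the adjoined entry n+1 stands for the missing change
-- and makes the last block of the k parts empty. The obstacle on the geometric side is that real
-- numbers are Cauchy sequences without a decidable order. Apartness in `Complement` and the
-- covering in `Connected` deliver their alternatives as data, and the arguments about points branch
-- on those. Strict inequalities are carried as a rational margin valid from some index on, so that
-- the algebra takes place in ℚ, term by term in the representing sequences.

filter-map : ∀ {a b p} {A : Set a} {B : Set b} {P : Pred B p} (P? : Decidable P) (f : A → B) (xs : List A) →
             filter P? (map f xs) ≡ map f (filter (P? ∘ f) xs)
filter-map P? f []       = refl
filter-map P? f (x ∷ xs) with P? (f x)
... | yes _ = cong (f x ∷_) (filter-map P? f xs)
... | no _  = filter-map P? f xs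

-- Words

binom-[] : ∀ w → binom w [] ≡ 1
binom-[] []      = refl
binom-[] (l ∷ w) = trans
  (cong length (Listₚ.filter-++ (λ u → Listₚ.≡-dec _≟ₗ_ u []) (map (l ∷_) (subsequences w)) (subsequences w)))
  (trans (cong (λ us → length (us ++ _)) (trans (filter-map (λ u → Listₚ.≡-dec _≟ₗ_ u []) (l ∷_) (subsequences w))
            (cong (map (l ∷_)) (Listₚ.filter-none (λ u → Listₚ.≡-dec _≟ₗ_ (l ∷ u) []) (All.universal (λ _ ()) (subsequences w))))))
    (binom-[] w))

binom-∷ : ∀ l w m v → binom (l ∷ w) (m ∷ v) ≡
          length (filter (λ u → Listₚ.≡-dec _≟ₗ_ (l ∷ u) (m ∷ v)) (subsequences w)) + binom w (m ∷ v)
binom-∷ l w m v = begin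
  binom (l ∷ w) (m ∷ v)
    ≡⟨ cong length (Listₚ.filter-++ eq? (map (l ∷_) (subsequences w)) (subsequences w)) ⟩
  length (filter eq? (map (l ∷_) (subsequences w)) ++ filter eq? (subsequences w))
    ≡⟨ Listₚ.length-++ (filter eq? (map (l ∷_) (subsequences w))) ⟩
  length (filter eq? (map (l ∷_) (subsequences w))) + binom w (m ∷ v)
    ≡⟨ cong (λ us → length us + binom w (m ∷ v)) (filter-map eq? (l ∷_) (subsequences w)) ⟩
  length (map (l ∷_) (filter (eq? ∘ (l ∷_)) (subsequences w))) + binom w (m ∷ v)
    ≡⟨ cong (_+ binom w (m ∷ v)) (Listₚ.length-map (l ∷_) (filter (eq? ∘ (l ∷_)) (subsequences w))) ⟩
  length (filter (eq? ∘ (l ∷_)) (subsequences w)) + binom w (m ∷ v) ∎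
  where
  open ≡-Reasoning
  eq? = λ u → Listₚ.≡-dec _≟ₗ_ u (m ∷ v)

binom-∷-≡ : ∀ l w v → binom (l ∷ w) (l ∷ v) ≡ binom w v + binom w (l ∷ v)
binom-∷-≡ l w v = trans (binom-∷ l w l v) (cong (λ us → length us + binom w (l ∷ v))
  (Listₚ.filter-≐ (λ u → Listₚ.≡-dec _≟ₗ_ (l ∷ u) (l ∷ v)) (λ u → Listₚ.≡-dec _≟ₗ_ u v)
    (Listₚ.∷-injectiveʳ , cong (l ∷_)) (subsequences w)))

binom-∷-≢ : ∀ {l m} w v → l ≢ m → binom (l ∷ w) (m ∷ v) ≡ binom w (m ∷ v)
binom-∷-≢ {l} {m} w v l≢m = trans (binom-∷ l w m v) (cong (λ us → length us + binom w (m ∷ v))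
  (Listₚ.filter-none (λ u → Listₚ.≡-dec _≟ₗ_ (l ∷ u) (m ∷ v))
    (All.universal (λ _ → l≢m ∘ Listₚ.∷-injectiveˡ) (subsequences w))))

binom-𝚋 : ∀ w → binom w (𝚋 ∷ []) ≡ ∣ w ∣[ 𝚋 ]
binom-𝚋 []      = refl
binom-𝚋 (𝚊 ∷ w) = trans (binom-∷-≢ w [] λ ()) (binom-𝚋 w)
binom-𝚋 (𝚋 ∷ w) = trans (binom-∷-≡ 𝚋 w []) (cong₂ _+_ (binom-[] w) (binom-𝚋 w))

-- An occurrence of `ab` is an `a` together with a `b` to its right, so each `a` contributes its own
-- entry of `λ-of`.
binom-𝚊𝚋 : ∀ w → binom w (𝚊 ∷ 𝚋 ∷ []) ≡ sum (λ-of w)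
binom-𝚊𝚋 []      = refl
binom-𝚊𝚋 (𝚊 ∷ w) = trans (binom-∷-≡ 𝚊 w (𝚋 ∷ [])) (cong₂ _+_ (binom-𝚋 w) (binom-𝚊𝚋 w))
binom-𝚊𝚋 (𝚋 ∷ w) = trans (binom-∷-≢ w (𝚋 ∷ []) λ ()) (binom-𝚊𝚋 w)

count-𝚊 : ∀ w → ∣ w ∣[ 𝚊 ] ≡ length (λ-of w)
count-𝚊 []      = refl
count-𝚊 (𝚊 ∷ w) = cong suc (count-𝚊 w)
count-𝚊 (𝚋 ∷ w) = count-𝚊 w

linked-weaken : ∀ {m m′ rs} → m ≤ m′ → Linked _≥_ (m ∷ rs) → Linked _≥_ (m′ ∷ rs)
linked-weaken m≤m′ [-]          = [-]
linked-weaken m≤m′ (r≤m ∷ rest) = ℕₚ.≤-trans r≤m m≤m′ ∷ rest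

λ-of-fits : ∀ w → Fits (length w) (λ-of w)
λ-of-fits w = ∣ w ∣[ 𝚋 ] , total w , decreasing w
  where
  total : ∀ w → ∣ w ∣[ 𝚋 ] + length (λ-of w) ≡ length w
  total []      = refl
  total (𝚊 ∷ w) = trans (ℕₚ.+-suc _ _) (cong suc (total w))
  total (𝚋 ∷ w) = cong suc (total w)
  decreasing : ∀ w → Linked _≥_ (∣ w ∣[ 𝚋 ] ∷ λ-of w)
  decreasing []      = [-]
  decreasing (𝚊 ∷ w) = ℕₚ.≤-refl ∷ decreasing w
  decreasing (𝚋 ∷ w) = linked-weaken (ℕₚ.n≤1+n _) (decreasing w)

count-replicate-𝚋 : ∀ k w → ∣ replicate k 𝚋 ++ w ∣[ 𝚋 ] ≡ k + ∣ w ∣[ 𝚋 ]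
count-replicate-𝚋 zero    w = refl
count-replicate-𝚋 (suc k) w = cong suc (count-replicate-𝚋 k w)

λ-of-replicate-𝚋 : ∀ k w → λ-of (replicate k 𝚋 ++ w) ≡ λ-of w
λ-of-replicate-𝚋 zero    w = refl
λ-of-replicate-𝚋 (suc k) w = λ-of-replicate-𝚋 k w

count-staircase : ∀ {m rs} → Linked _≥_ (m ∷ rs) → ∣ staircase m rs ∣[ 𝚋 ] ≡ m
count-staircase {m} [-] = trans (cong ∣_∣[ 𝚋 ] (sym (Listₚ.++-identityʳ (replicate m 𝚋))))
  (trans (count-replicate-𝚋 m []) (ℕₚ.+-identityʳ m))
count-staircase {m} {r ∷ rs} (r≤m ∷ rest) = trans (count-replicate-𝚋 (m ∸ r) _)
  (trans (cong ((m ∸ r) +_) (count-staircase rest)) (ℕₚ.m∸n+n≡m r≤m))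

λ-of-staircase : ∀ {m rs} → Linked _≥_ (m ∷ rs) → λ-of (staircase m rs) ≡ rs
λ-of-staircase {m} [-] = trans (cong λ-of (sym (Listₚ.++-identityʳ (replicate m 𝚋)))) (λ-of-replicate-𝚋 m [])
λ-of-staircase {m} {r ∷ rs} (r≤m ∷ rest) = trans (λ-of-replicate-𝚋 (m ∸ r) _)
  (cong₂ _∷_ (count-staircase rest) (λ-of-staircase rest))

-- The block before each `a` uses up the difference of two neighbouring parts, so exactly the next
-- part is left as the number of `b`'s still to come. Through this, `Ψ` can be studied on partitions
-- alone.
λ-of-W : ∀ {n rs} → Fits n rs → λ-of (W n rs) ≡ rs
λ-of-W {rs = rs} (m , refl , dec) =
  trans (cong (λ k → λ-of (staircase k rs)) (ℕₚ.m+n∸n≡m m (length rs))) (λ-of-staircase dec)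

-- Two words are ≈[ s ]-related exactly when their partitions are.
infix 4 _∼[_]_

record _∼[_]_ (rs : List ℕ) (s : ℕ) (qs : List ℕ) : Set where
  constructor same
  field
    lengths : length rs ≡ length qs
    sums    : sum rs ≡ sum qs
    tails   : take s (reverse rs) ≡ take s (reverse qs)

∼-sym : ∀ {s rs qs} → rs ∼[ s ] qs → qs ∼[ s ] rs
∼-sym (same p q r) = same (sym p) (sym q) (sym r)

≈⇒∼ : ∀ {n s} (u w : Word n) → u ≈[ s ] w →
      λ-of (toList u) ∼[ s ] λ-of (toList w)
≈⇒∼ u w ((as , abs) , tails) =
  same (trans (sym (count-𝚊 (toList u))) (trans as (count-𝚊 (toList w))))
       (trans (sym (binom-𝚊𝚋 (toList u))) (trans abs (binom-𝚊𝚋 (toList w))))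
       tails

∼⇒≈ : ∀ {n s} (u w : Word n) → λ-of (toList u) ∼[ s ] λ-of (toList w) →
      u ≈[ s ] w
∼⇒≈ u w (same as abs tails) =
    ( trans (count-𝚊 (toList u)) (trans as (sym (count-𝚊 (toList w))))
    , trans (binom-𝚊𝚋 (toList u)) (trans abs (sym (binom-𝚊𝚋 (toList w)))))
  , tails

-- Partitions


take-reverse : ∀ us (ts : List ℕ) → take (length ts) (reverse (us ++ ts)) ≡ reverse ts
take-reverse us ts = begin
  take (length ts) (reverse (us ++ ts))
    ≡⟨ cong₂ take (sym (Listₚ.length-reverse ts)) (Listₚ.reverse-++ us ts) ⟩
  take (length (reverse ts)) (reverse ts ++ reverse us)
    ≡⟨ take-length (reverse ts) ⟩
  reverse ts ∎
  where
  open ≡-Reasoning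
  take-length : ∀ (xs {ys} : List ℕ) → take (length xs) (xs ++ ys) ≡ xs
  take-length []       = refl
  take-length (x ∷ xs) = cong (x ∷_) (take-length xs)

∼-++⁺ : ∀ {s us us′} ts → length ts ≡ s → length us ≡ length us′ → sum us ≡ sum us′ →
        us ++ ts ∼[ s ] us′ ++ ts
∼-++⁺ {us = us} {us′} ts refl lengths sums =
  same (trans (Listₚ.length-++ us) (trans (cong (_+ length ts) lengths) (sym (Listₚ.length-++ us′))))
       (trans (sum-++ us ts) (trans (cong (_+ sum ts) sums) (sym (sum-++ us′ ts))))
       (trans (take-reverse us ts) (sym (take-reverse us′ ts)))

-- Once the last `s` parts are read off from the tails, their share of length and sum cancels, and
-- what remains known of the parts above them is their number and their sum.
∼-++⁻ : ∀ {s us us′ ts ts′} → length ts ≡ s → length ts′ ≡ s → us ++ ts ∼[ s ] us′ ++ ts′ →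
        length us ≡ length us′ × sum us ≡ sum us′ × ts ≡ ts′
∼-++⁻ {us = us} {us′} {ts} {ts′} refl len (same lengths sums tails)
  with tails-≡
  where
  tails-≡ : ts ≡ ts′
  tails-≡ = Listₚ.reverse-injective (trans (sym (take-reverse us ts))
    (trans tails (trans (cong (λ k → take k _) (sym len)) (take-reverse us′ ts′))))
... | refl =
    ℕₚ.+-cancelʳ-≡ (length ts) _ _
      (trans (sym (Listₚ.length-++ us)) (trans lengths (Listₚ.length-++ us′)))
  , ℕₚ.+-cancelʳ-≡ (sum ts) _ _ (trans (sym (sum-++ us ts)) (trans sums (sum-++ us′ ts)))
  , refl

sum-replicate : ∀ k v → sum (replicate k v) ≡ k * v
sum-replicate zero    v = refl
sum-replicate (suc k) v = cong (v +_) (sum-replicate k v)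

-- The parts above the last s, in the cases r = s+1 and r > s+1.

topII : (n s : ℕ) → (ℕ → ℕ) → List ℕ
topII n s c = replicate (1 + n ∸ c (1 + s)) (c s ∸ s)

topIII : (n s : ℕ) → (ℕ → ℕ) → List ℕ
topIII n s c =
  replicate (c (3 + s) ∸ suc (c (2 + s))) (c (2 + s) ∸ suc s) ++
  (c (1 + s) ∸ s) ∷
  replicate (1 + n ∸ c (3 + s)) (c s ∸ s)

replicate-snoc : ∀ k (v : ℕ) ts → replicate k v ++ v ∷ ts ≡ replicate (suc k) v ++ ts
replicate-snoc zero    v ts = refl
replicate-snoc (suc k) v ts = cong (v ∷_) (replicate-snoc k v ts)

-- In the exponents `n - c + 2` of the definition, the last copy of the repeated part already
-- belongs to the `s` smallest parts. Moving it there gives `s = 0` and `s ≥ 1` the same shape.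
replicate-descend : ∀ {n} c s k → k ≤ suc n →
  replicate (1 + n ∸ k) (c (suc s) ∸ suc s) ++ descend c (suc s) ≡
  replicate (2 + n ∸ k) (c (suc s) ∸ suc s) ++ descend c s
replicate-descend {n} c s k k≤1+n = trans (replicate-snoc (1 + n ∸ k) _ (descend c s))
  (cong (λ j → replicate j (c (suc s) ∸ suc s) ++ descend c s) (sym (ℕₚ.+-∸-assoc 1 k≤1+n)))

∸-∸-suc : ∀ x y → x ∸ y ∸ 1 ≡ x ∸ suc y
∸-∸-suc x y = trans (ℕₚ.∸-+-assoc x y 1) (cong (x ∸_) (ℕₚ.+-comm y 1))

caseII-++ : ∀ n s c → c 0 ≡ 0 → c (1 + s) ≤ 1 + n → caseII n s c ≡ topII n s c ++ descend c s
caseII-++ n zero    c c0 _ =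
  trans (cong (replicate (1 + n ∸ c 1)) (sym c0)) (sym (Listₚ.++-identityʳ _))
caseII-++ n (suc s) c _ c≤ = sym (replicate-descend c s (c (2 + s)) c≤)

caseIII-++ : ∀ n s c → c 0 ≡ 0 → c (3 + s) ≤ 1 + n → caseIII n s c ≡ topIII n s c ++ descend c s
caseIII-++ n zero c c0 _ = trans
  (cong₂ (λ k v → replicate k (c 2 ∸ 1) ++ c 1 ∷ replicate (1 + n ∸ c 3) v)
    (∸-∸-suc (c 3) (c 2)) (sym c0))
  (sym (Listₚ.++-identityʳ _))
caseIII-++ n s@(suc t) c _ c≤ = trans
  (cong₂ (λ k v → replicate k v ++ (c (1 + s) ∸ s) ∷ replicate (2 + n ∸ c (3 + s)) (c s ∸ s) ++ descend c t)
    (∸-∸-suc (c (3 + s)) (c (2 + s))) (∸-∸-suc (c (2 + s)) s))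
  (trans
    (cong (λ us → replicate _ _ ++ (c (1 + s) ∸ s) ∷ us) (sym (replicate-descend c t (c (3 + s)) c≤)))
    (sym (Listₚ.++-assoc (replicate (c (3 + s) ∸ suc (c (2 + s))) (c (2 + s) ∸ suc s)) _ _)))

-- Addresses and the parameters of their partitions

linked-last : ∀ xs {z} → Linked _<_ (xs ∷ʳ z) → ∀ k → k ≤ length xs → nth (xs ∷ʳ z) k ≤ z
linked-last []           _           zero    _         = ℕₚ.≤-refl
linked-last (x ∷ [])     (x<z ∷ _)   zero    _         = ℕₚ.<⇒≤ x<z
linked-last (x ∷ y ∷ xs) (x<y ∷ inc) zero    _         = ℕₚ.≤-trans (ℕₚ.<⇒≤ x<y) (linked-last (y ∷ xs) inc 0 z≤n)
linked-last (x ∷ xs)     inc         (suc k) (s≤s k≤l) = linked-last xs (Linked.tail inc) k k≤l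

data Size (s : ℕ) : ℕ → Set where
  small  : ∀ {r} → r ≤ s → Size s r
  middle : Size s (1 + s)
  large  : ∀ {r} → 2 + s ≤ r → r ≤ 3 + s → Size s r

size : ∀ s r → r ≤ 3 + s → Size s r
size s r r≤3+s with ℕₚ.<-cmp r (1 + s)
... | tri< r<1+s _ _ = small (ℕₚ.≤-pred r<1+s)
... | tri≈ _ refl _  = middle
... | tri> _ _ 1+s<r = large 1+s<r r≤3+s

module Increasing {n : ℕ} (cs : List ℕ) (increasing : Linked _<_ (0 ∷ cs ∷ʳ suc n)) where

  -- Two sentinels are included: `c 0 = 0`, which makes `c s ∸ s` vanish for `s = 0`, and
  -- `c (suc r) = suc n`, which serves as the third entry `c (3 + s)` when `r = 2 + s`. The bounds
  -- below therefore run up to `suc r`.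
  c : ℕ → ℕ
  c = index n cs

  r : ℕ
  r = length cs

  c-mono : ∀ k → k ≤ r → c k < c (suc k)
  c-mono k k≤r = nth-mono increasing k
    (subst (k <_) (sym (trans (Listₚ.length-++ cs) (ℕₚ.+-comm r 1))) (s≤s k≤r))

  k≤c : ∀ k → k ≤ suc r → k ≤ c k
  k≤c zero    _         = z≤n
  k≤c (suc k) (s≤s k≤r) = ℕₚ.≤-<-trans (k≤c k (ℕₚ.m≤n⇒m≤1+n k≤r)) (c-mono k k≤r)

  c≤1+n : ∀ k → k ≤ suc r → c k ≤ suc n
  c≤1+n = linked-last (0 ∷ cs) increasing

  partition-small : ∀ {s} → r ≤ s → partition n s cs ≡ descend c r
  partition-small {s} r≤s = cong (byCase n s r c) (ℕₚ.m≤n⇒m∸n≡0 r≤s)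

  partition-middle : ∀ {s} → r ≡ 1 + s → partition n s cs ≡ topII n s c ++ descend c s
  partition-middle {s} r≡1+s = trans
    (cong (byCase n s r c) (trans (cong (_∸ s) r≡1+s) (ℕₚ.m+n∸n≡m 1 s)))
    (caseII-++ n s c refl (c≤1+n (1 + s) (ℕₚ.≤-trans (ℕₚ.≤-reflexive (sym r≡1+s)) (ℕₚ.n≤1+n r))))

  partition-large : ∀ {s} → 2 + s ≤ r → r ≤ 3 + s → partition n s cs ≡ topIII n s c ++ descend c s
  partition-large {s} 2+s≤r r≤3+s = trans caseIII-≡ (caseIII-++ n s c refl (c≤1+n (3 + s) (s≤s 2+s≤r)))
    where
    caseIII-≡ : partition n s cs ≡ caseIII n s c
    caseIII-≡ with ℕₚ.m≤n⇒m<n∨m≡n 2+s≤r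
    ... | inj₂ 2+s≡r = cong (byCase n s r c) (trans (cong (_∸ s) (sym 2+s≡r)) (ℕₚ.m+n∸n≡m 2 s))
    ... | inj₁ 2+s<r = cong (byCase n s r c)
      (trans (cong (_∸ s) (ℕₚ.≤-antisym r≤3+s 2+s<r)) (ℕₚ.m+n∸n≡m 3 s))

  length-topII : ∀ {s} → length (topII n s c) ≡ suc n ∸ c (1 + s)
  length-topII {s} = Listₚ.length-replicate (suc n ∸ c (1 + s))

  sum-topII : ∀ {s} → sum (topII n s c) ≡ length (topII n s c) * (c s ∸ s)
  sum-topII {s} = trans (sum-replicate (suc n ∸ c (1 + s)) (c s ∸ s))
    (cong (_* (c s ∸ s)) (sym (length-topII {s})))

  0<topII : ∀ {s} → r ≡ 1 + s → 0 < length (topII n s c)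
  0<topII {s} e = subst (0 <_) (sym (length-topII {s}))
    (ℕₚ.m<n⇒0<n∸m (ℕₚ.<-≤-trans (c-mono (1 + s) (ℕₚ.≤-reflexive (sym e))) (c≤1+n (2 + s) (s≤s (ℕₚ.≤-reflexive (sym e))))))

  module Large {s} (2+s≤r : 2 + s ≤ r) where

    g M p v h : ℕ
    g = c (3 + s) ∸ suc (c (2 + s))
    M = c (2 + s) ∸ suc s
    p = c (1 + s) ∸ s
    v = c s ∸ s
    h = 1 + n ∸ c (3 + s)

    1+s≤r : 1 + s ≤ r
    1+s≤r = ℕₚ.≤-trans (ℕₚ.n≤1+n _) 2+s≤r

    s≤r : s ≤ r
    s≤r = ℕₚ.≤-trans (ℕₚ.n≤1+n _) 1+s≤r

    v<p : v < p
    v<p = ℕₚ.∸-monoˡ-< (c-mono s s≤r) (k≤c s (ℕₚ.m≤n⇒m≤1+n s≤r))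

    p≤M : p ≤ M
    p≤M = ℕₚ.∸-monoˡ-≤ (suc s) (c-mono (1 + s) 1+s≤r)

    c₃ : suc (c (2 + s)) + g ≡ c (3 + s)
    c₃ = ℕₚ.m+[n∸m]≡n (c-mono (2 + s) 2+s≤r)

    length-topIII : length (topIII n s c) ≡ g + suc h
    length-topIII = trans (Listₚ.length-++ (replicate g M))
      (cong₂ (λ i j → i + suc j) (Listₚ.length-replicate g) (Listₚ.length-replicate h))

    0<topIII : 0 < length (topIII n s c)
    0<topIII = subst (0 <_) (sym length-topIII) (ℕₚ.<-≤-trans (s≤s z≤n) (ℕₚ.m≤n+m (suc h) g))

    -- The `g` copies of `M` account for the positions strictly between `c (2 + s)` and `c (3 + s)`,
    -- the part `p` and the `h` copies of `v` for the rest. So the number of upper parts determines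
    -- `c (2 + s)` independently of how they are divided.
    c₂ : c (2 + s) + length (topIII n s c) ≡ suc n
    c₂ = begin
      c (2 + s) + length (topIII n s c)  ≡⟨ cong (c (2 + s) +_) length-topIII ⟩
      c (2 + s) + (g + suc h)            ≡⟨ sym (ℕₚ.+-assoc (c (2 + s)) g (suc h)) ⟩
      c (2 + s) + g + suc h              ≡⟨ ℕₚ.+-suc (c (2 + s) + g) h ⟩
      suc (c (2 + s)) + g + h            ≡⟨ cong (_+ h) c₃ ⟩
      c (3 + s) + h                      ≡⟨ ℕₚ.m+[n∸m]≡n (c≤1+n (3 + s) (s≤s 2+s≤r)) ⟩
      suc n                              ∎
      where open ≡-Reasoning

    sum-topIII : sum (topIII n s c) ≡ g * M + (p + h * v)
    sum-topIII = trans (sum-++ (replicate g M) (p ∷ replicate h v))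
      (cong₂ (λ i j → i + (p + j)) (sum-replicate g M) (sum-replicate h v))

-- Different addresses give different classes

descend-injective : ∀ {c c′} k → descend c k ≡ descend c′ k → ∀ i → i < k → c (suc i) ∸ suc i ≡ c′ (suc i) ∸ suc i
descend-injective (suc k) eq i i<1+k with ℕₚ.m≤n⇒m<n∨m≡n (ℕₚ.≤-pred i<1+k)
... | inj₂ refl = Listₚ.∷-injectiveˡ eq
... | inj₁ i<k  = descend-injective k (Listₚ.∷-injectiveʳ eq) i i<k

head<last : ∀ {y z} ys → Linked _<_ (y ∷ ys ∷ʳ z) → y < z
head<last []       (y<z ∷ _)   = y<z
head<last (_ ∷ ys) (y<x ∷ inc) = ℕₚ.<-trans y<x (head<last ys inc)

-- The common last entry `z` detects different lengths: the shorter list shows `z` at a position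
-- where the longer one still has an entry below `z`. This separates `r = 2 + s` from `r = 3 + s`
-- without a case distinction.
∷ʳ-injective-nth : ∀ {z} xs ys K → Linked _<_ (xs ∷ʳ z) → Linked _<_ (ys ∷ʳ z) →
                   length xs ≤ K → length ys ≤ K →
                   (∀ k → k < K → nth (xs ∷ʳ z) k ≡ nth (ys ∷ʳ z) k) → xs ≡ ys
∷ʳ-injective-nth []       []       K       _   _   _        _        _     = refl
∷ʳ-injective-nth []       (y ∷ ys) (suc K) _   inc _        _        agree =
  contradiction (agree 0 (s≤s z≤n)) (λ z≡y → ℕₚ.<-irrefl (sym z≡y) (head<last ys inc))
∷ʳ-injective-nth (x ∷ xs) []       (suc K) inc _   _        _        agree =
  contradiction (agree 0 (s≤s z≤n)) (λ x≡z → ℕₚ.<-irrefl x≡z (head<last xs inc))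
∷ʳ-injective-nth (x ∷ xs) (y ∷ ys) (suc K) inc inc′ (s≤s l) (s≤s l′) agree = cong₂ _∷_ (agree 0 (s≤s z≤n))
  (∷ʳ-injective-nth xs ys K (Linked.tail inc) (Linked.tail inc′) l l′ (λ k k<K → agree (suc k) (s≤s k<K)))

-- In k parts of sum  g M + p + h v  with  v < p ≤ M, the numbers g and p - v - 1 are
-- quotient and remainder of  sum - k v - 1  by  M - v.

remainder-< : ∀ {v p M p′} x h → v ≤ M → v < p′ → p ≤ M → p + (suc x + h) * v < suc x * M + (p′ + h * v)
remainder-< {v} {p} {M} {p′} x h v≤M v<p′ p≤M = begin-strict
  p + (suc x + h) * v            ≡⟨ cong (p +_) (ℕₚ.*-distribʳ-+ v (suc x) h) ⟩
  p + (v + x * v + h * v)        ≡⟨ shuffle p v (x * v) (h * v) ⟩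
  v + (p + x * v + h * v)        <⟨ ℕₚ.+-mono-<-≤ v<p′ (ℕₚ.+-monoˡ-≤ (h * v) (ℕₚ.+-mono-≤ p≤M
                                     (ℕₚ.*-monoʳ-≤ x v≤M))) ⟩
  p′ + (M + x * M + h * v)       ≡⟨ swap p′ (M + x * M) (h * v) ⟩
  suc x * M + (p′ + h * v)       ∎
  where
  open ℕₚ.≤-Reasoning
  shuffle : ∀ a b c d → a + (b + c + d) ≡ b + (a + c + d)
  shuffle = solve 4 (λ a b c d → a :+ (b :+ c :+ d) := b :+ (a :+ c :+ d)) refl
    where open ℕSolver.+-*-Solver
  swap : ∀ a b c → a + (b + c) ≡ b + (a + c)
  swap = solve 3 (λ a b c → a :+ (b :+ c) := b :+ (a :+ c)) refl
    where open ℕSolver.+-*-Solver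

-- A larger `g` gives a larger sum whatever `p` and `p′` are: of the additional copies of `M`, one
-- makes up for `p` and each other one for a `v`, while `p′` strictly exceeds the `v` that it
-- replaces.
quotient-≮ : ∀ {v M g h p g′ h′ p′} → v ≤ M → p ≤ M → v < p′ → g + suc h ≡ g′ + suc h′ →
             g * M + (p + h * v) ≡ g′ * M + (p′ + h′ * v) → ¬ g < g′
quotient-≮ {v} {M} {g} {h} {p} {g′} {h′} {p′} v≤M p≤M v<p′ parts sums g<g′ =
  ℕₚ.<-irrefl sums (subst₂ _<_ (cong (λ i → g * M + (p + i * v)) (sym h≡)) g′-split
    (ℕₚ.+-monoʳ-< (g * M) (remainder-< {p = p} x h′ v≤M v<p′ p≤M)))
  where
  open ≡-Reasoning
  x = g′ ∸ suc g
  g′≡ : suc g + x ≡ g′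
  g′≡ = ℕₚ.m+[n∸m]≡n g<g′
  h≡ : h ≡ suc x + h′
  h≡ = ℕₚ.+-cancelˡ-≡ (suc g) _ _ (begin
    suc g + h              ≡⟨ sym (ℕₚ.+-suc g h) ⟩
    g + suc h              ≡⟨ parts ⟩
    g′ + suc h′            ≡⟨ cong (_+ suc h′) (sym g′≡) ⟩
    suc g + x + suc h′     ≡⟨ ℕₚ.+-assoc (suc g) x (suc h′) ⟩
    suc g + (x + suc h′)   ≡⟨ cong (suc g +_) (ℕₚ.+-suc x h′) ⟩
    suc g + (suc x + h′)   ∎)
  g′-split : g * M + (suc x * M + (p′ + h′ * v)) ≡ g′ * M + (p′ + h′ * v)
  g′-split = begin
    g * M + (suc x * M + (p′ + h′ * v))  ≡⟨ sym (ℕₚ.+-assoc (g * M) (suc x * M) _) ⟩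
    g * M + suc x * M + (p′ + h′ * v)    ≡⟨ cong (_+ (p′ + h′ * v)) (sym (ℕₚ.*-distribʳ-+ M g (suc x))) ⟩
    (g + suc x) * M + (p′ + h′ * v)      ≡⟨ cong (λ i → i * M + (p′ + h′ * v)) (trans (ℕₚ.+-suc g x) g′≡) ⟩
    g′ * M + (p′ + h′ * v)               ∎

quotient-remainder-unique : ∀ {v M g h p g′ h′ p′} → v < p → p ≤ M → v < p′ → p′ ≤ M → g + suc h ≡ g′ + suc h′ →
  g * M + (p + h * v) ≡ g′ * M + (p′ + h′ * v) → g ≡ g′ × p ≡ p′
quotient-remainder-unique {v} {M} {g} {h} {p} {g′} {h′} {p′} v<p p≤M v<p′ p′≤M parts sums
  with ℕₚ.<-cmp g g′
... | tri< g<g′ _ _ = contradiction g<g′ (quotient-≮ {h = h} (ℕₚ.≤-trans (ℕₚ.<⇒≤ v<p) p≤M) p≤M v<p′ parts sums)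
... | tri> _ _ g′<g = contradiction g′<g (quotient-≮ {h = h′} (ℕₚ.≤-trans (ℕₚ.<⇒≤ v<p) p≤M) p′≤M v<p (sym parts) (sym sums))
... | tri≈ _ refl _ with ℕₚ.suc-injective (ℕₚ.+-cancelˡ-≡ g (suc h) (suc h′) parts)
...   | refl = refl , ℕₚ.+-cancelʳ-≡ (h * v) p p′ (ℕₚ.+-cancelˡ-≡ (g * M) _ _ sums)

-- Separates Case III from Case II, whose upper parts all equal `v`: here the part `p` is strictly
-- above `v`.
minimal-< : ∀ {v M g h p} → v < p → p ≤ M → (g + suc h) * v < g * M + (p + h * v)
minimal-< {v} {M} {g} {h} {p} v<p p≤M = begin-strict
  (g + suc h) * v        ≡⟨ ℕₚ.*-distribʳ-+ v g (suc h) ⟩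
  g * v + (v + h * v)    <⟨ ℕₚ.+-mono-≤-< (ℕₚ.*-monoʳ-≤ g (ℕₚ.≤-trans (ℕₚ.<⇒≤ v<p) p≤M)) (ℕₚ.+-monoˡ-< (h * v) v<p) ⟩
  g * M + (p + h * v)    ∎
  where open ℕₚ.≤-Reasoning

module _ {n s : ℕ} (cs cs′ : List ℕ) (inc : Linked _<_ (0 ∷ cs ∷ʳ suc n)) (inc′ : Linked _<_ (0 ∷ cs′ ∷ʳ suc n)) where

  private
    module I  = Increasing cs inc
    module I′ = Increasing cs′ inc′
    open I using (c; r)
    open I′ using () renaming (c to c′; r to r′)

  agree⇒≡ : ∀ K → r ≤ K → r′ ≤ K → (∀ k → k < K → c (suc k) ≡ c′ (suc k)) → cs ≡ cs′
  agree⇒≡ K = ∷ʳ-injective-nth cs cs′ K (Linked.tail inc) (Linked.tail inc′)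

  descend⇒agree : ∀ k → k ≤ r → k ≤ r′ → descend c k ≡ descend c′ k → ∀ i → i < k → c (suc i) ≡ c′ (suc i)
  descend⇒agree k k≤r k≤r′ eq i i<k = ℕₚ.∸-cancelʳ-≡
    (I.k≤c (suc i) (ℕₚ.m≤n⇒m≤1+n (ℕₚ.≤-trans i<k k≤r)))
    (I′.k≤c (suc i) (ℕₚ.m≤n⇒m≤1+n (ℕₚ.≤-trans i<k k≤r′)))
    (descend-injective k eq i i<k)

  -- For `s = 0` the lists are empty and carry no information, but then both sides are 0 by the
  -- sentinel `c 0`.
  descend⇒v : descend c s ≡ descend c′ s → c s ∸ s ≡ c′ s ∸ s
  descend⇒v = top s
    where
    top : ∀ s → descend c s ≡ descend c′ s → c s ∸ s ≡ c′ s ∸ s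
    top zero    _  = refl
    top (suc s) eq = Listₚ.∷-injectiveˡ eq

  injective-small : r ≤ s → r′ ≤ s → descend c r ∼[ s ] descend c′ r′ → cs ≡ cs′
  injective-small r≤s r′≤s (same lengths _ tails) =
    agree⇒≡ r ℕₚ.≤-refl (ℕₚ.≤-reflexive (sym r≡r′))
      (descend⇒agree r ℕₚ.≤-refl (ℕₚ.≤-reflexive r≡r′) (trans descends (cong (descend c′) (sym r≡r′))))
    where
    r≡r′ : r ≡ r′
    r≡r′ = trans (sym (length-descend c r)) (trans lengths (length-descend c′ r′))
    take-whole : ∀ c {r} → r ≤ s → take s (reverse (descend c r)) ≡ reverse (descend c r)
    take-whole c {r} r≤s = Listₚ.take-all s _
      (subst (_≤ s) (sym (trans (Listₚ.length-reverse (descend c r)) (length-descend c r))) r≤s)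
    descends : descend c r ≡ descend c′ r′
    descends = Listₚ.reverse-injective (trans (sym (take-whole c r≤s)) (trans tails (take-whole c′ r′≤s)))

  -- Told apart by the number of parts: at most `s` on one side, `s` and a nonempty block on the
  -- other.
  small≁ : ∀ us → 0 < length us → r ≤ s → ¬ descend c r ∼[ s ] us ++ descend c′ s
  small≁ us 0<us r≤s (same lengths _ _) = ℕₚ.<-irrefl
    (trans (sym (length-descend c r)) (trans lengths
      (trans (Listₚ.length-++ us) (cong (length us +_) (length-descend c′ s)))))
    (ℕₚ.≤-<-trans r≤s (ℕₚ.m<n+m s 0<us))

  injective-middle : r ≡ 1 + s → r′ ≡ 1 + s → topII n s c ++ descend c s ∼[ s ] topII n s c′ ++ descend c′ s → cs ≡ cs′
  injective-middle r≡ r′≡ eqv with ∼-++⁻ (length-descend c s) (length-descend c′ s) eqv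
  ... | lengths , _ , descends = agree⇒≡ (1 + s) (ℕₚ.≤-reflexive r≡) (ℕₚ.≤-reflexive r′≡) agree
    where
    agree : ∀ i → i < 1 + s → c (suc i) ≡ c′ (suc i)
    agree i i<1+s with ℕₚ.m≤n⇒m<n∨m≡n (ℕₚ.≤-pred i<1+s)
    ... | inj₁ i<s  = descend⇒agree s (s≤ r≡) (s≤ r′≡) descends i i<s
      where
      s≤ : ∀ {r} → r ≡ 1 + s → s ≤ r
      s≤ refl = ℕₚ.n≤1+n s
    ... | inj₂ refl = ℕₚ.∸-cancelˡ-≡
      (I.c≤1+n (1 + s) (ℕₚ.m≤n⇒m≤1+n (ℕₚ.≤-reflexive (sym r≡))))
      (I′.c≤1+n (1 + s) (ℕₚ.m≤n⇒m≤1+n (ℕₚ.≤-reflexive (sym r′≡))))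
      (trans (sym I.length-topII) (trans lengths I′.length-topII))

  middle≁large : (2+s≤r′ : 2 + s ≤ r′) → ¬ topII n s c ++ descend c s ∼[ s ] topIII n s c′ ++ descend c′ s
  middle≁large 2+s≤r′ eqv with ∼-++⁻ (length-descend c s) (length-descend c′ s) eqv
  ... | lengths , sums , descends = ℕₚ.<-irrefl
    (begin
      (L.g + suc L.h) * L.v                ≡⟨ cong₂ _*_ (sym (trans lengths L.length-topIII)) (sym (descend⇒v descends)) ⟩
      length (topII n s c) * (c s ∸ s)     ≡⟨ sym (I.sum-topII {s}) ⟩
      sum (topII n s c)                    ≡⟨ sums ⟩
      sum (topIII n s c′)                  ≡⟨ L.sum-topIII ⟩
      L.g * L.M + (L.p + L.h * L.v)        ∎)
    (minimal-< {g = L.g} {h = L.h} L.v<p L.p≤M)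
    where
    open ≡-Reasoning
    module L = I′.Large 2+s≤r′

  injective-large : 2 + s ≤ r → r ≤ 3 + s → 2 + s ≤ r′ → r′ ≤ 3 + s →
                    topIII n s c ++ descend c s ∼[ s ] topIII n s c′ ++ descend c′ s → cs ≡ cs′
  injective-large 2+s≤r r≤3+s 2+s≤r′ r′≤3+s eqv with ∼-++⁻ (length-descend c s) (length-descend c′ s) eqv
  ... | lengths , sums , descends = agree⇒≡ (3 + s) r≤3+s r′≤3+s agree
    where
    open ≡-Reasoning
    module L = I.Large 2+s≤r
    module L′ = I′.Large 2+s≤r′
    c₂≡ : c (2 + s) ≡ c′ (2 + s)
    c₂≡ = ℕₚ.+-cancelʳ-≡ (length (topIII n s c)) _ _
      (trans L.c₂ (trans (sym L′.c₂) (cong (c′ (2 + s) +_) (sym lengths))))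
    M≡ : L.M ≡ L′.M
    M≡ = cong (_∸ suc s) c₂≡
    v≡ : L.v ≡ L′.v
    v≡ = descend⇒v descends
    unique : L.g ≡ L′.g × L.p ≡ L′.p
    unique = quotient-remainder-unique {h = L.h} {h′ = L′.h} L.v<p L.p≤M
      (subst (_< L′.p) (sym v≡) L′.v<p) (subst (L′.p ≤_) (sym M≡) L′.p≤M)
      (trans (sym L.length-topIII) (trans lengths L′.length-topIII))
      (begin
        L.g * L.M + (L.p + L.h * L.v)         ≡⟨ sym L.sum-topIII ⟩
        sum (topIII n s c)                    ≡⟨ sums ⟩
        sum (topIII n s c′)                   ≡⟨ L′.sum-topIII ⟩
        L′.g * L′.M + (L′.p + L′.h * L′.v)    ≡⟨ cong₂ (λ M v → L′.g * M + (L′.p + L′.h * v)) (sym M≡) (sym v≡) ⟩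
        L′.g * L.M + (L′.p + L′.h * L.v)      ∎)
    agree : ∀ i → i < 3 + s → c (suc i) ≡ c′ (suc i)
    -- The indices `2 + s`, `1 + s` and `s` stand for three entries of the address: `c (3 + s)`,
    -- given by `g`; `c (2 + s)`, given by the number of parts; and `c (1 + s)`, given by `p`.
    agree i i<3+s with ℕₚ.m≤n⇒m<n∨m≡n (ℕₚ.≤-pred i<3+s)
    ... | inj₂ refl = trans (sym L.c₃) (trans (cong₂ (λ x g → suc x + g) c₂≡ (proj₁ unique)) L′.c₃)
    ... | inj₁ i<2+s with ℕₚ.m≤n⇒m<n∨m≡n (ℕₚ.≤-pred i<2+s)
    ...   | inj₂ refl = c₂≡
    ...   | inj₁ i<1+s with ℕₚ.m≤n⇒m<n∨m≡n (ℕₚ.≤-pred i<1+s)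
    ...     | inj₁ i<s  = descend⇒agree s L.s≤r L′.s≤r descends i i<s
    ...     | inj₂ refl = ℕₚ.∸-cancelʳ-≡ (s≤c I.k≤c L.1+s≤r) (s≤c I′.k≤c L′.1+s≤r) (proj₂ unique)
      where
      s≤c : ∀ {c : ℕ → ℕ} {r} → (∀ k → k ≤ suc r → k ≤ c k) → 1 + s ≤ r → s ≤ c (1 + s)
      s≤c k≤c 1+s≤r = ℕₚ.≤-trans (ℕₚ.n≤1+n s) (k≤c (1 + s) (ℕₚ.m≤n⇒m≤1+n 1+s≤r))

partition-injective : ∀ {n s} cs cs′ → Linked _<_ (0 ∷ cs ∷ʳ suc n) → Linked _<_ (0 ∷ cs′ ∷ʳ suc n) →
  length cs ≤ 3 + s → length cs′ ≤ 3 + s → partition n s cs ∼[ s ] partition n s cs′ → cs ≡ cs′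
partition-injective {n} {s} cs cs′ inc inc′ r≤ r′≤ eqv = go (size s _ r≤) (size s _ r′≤) refl refl
  where
  module I  = Increasing cs inc
  module I′ = Increasing cs′ inc′
  via : ∀ {rs qs} → partition n s cs ≡ rs → partition n s cs′ ≡ qs → rs ∼[ s ] qs
  via e e′ = subst₂ _∼[ s ]_ e e′ eqv
  -- The lengths are generalised to variables with equations, since matching on `middle` cannot
  -- unify `length cs` with `1 + s`.
  go : ∀ {r r′} → Size s r → Size s r′ → I.r ≡ r → I′.r ≡ r′ → cs ≡ cs′
  go (small r≤) (small r′≤) refl refl = injective-small cs cs′ inc inc′ r≤ r′≤
    (via (I.partition-small r≤) (I′.partition-small r′≤))
  go (small r≤) middle refl e′ = contradiction (via (I.partition-small r≤) (I′.partition-middle e′))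
    (small≁ cs cs′ inc inc′ _ (I′.0<topII e′) r≤)
  go (small r≤) (large l u) refl refl = contradiction (via (I.partition-small r≤) (I′.partition-large l u))
    (small≁ cs cs′ inc inc′ _ (I′.Large.0<topIII l) r≤)
  go middle (small r′≤) e refl = contradiction (∼-sym (via (I.partition-middle e) (I′.partition-small r′≤)))
    (small≁ cs′ cs inc′ inc _ (I.0<topII e) r′≤)
  go middle middle e e′ = injective-middle cs cs′ inc inc′ e e′
    (via (I.partition-middle e) (I′.partition-middle e′))
  go middle (large l u) e refl = contradiction (via (I.partition-middle e) (I′.partition-large l u))
    (middle≁large cs cs′ inc inc′ l)
  go (large l u) (small r′≤) refl refl = contradiction (∼-sym (via (I.partition-large l u) (I′.partition-small r′≤)))
    (small≁ cs′ cs inc′ inc _ (I.Large.0<topIII l) r′≤)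
  go (large l u) middle refl e′ = contradiction (∼-sym (via (I.partition-large l u) (I′.partition-middle e′)))
    (middle≁large cs′ cs inc′ inc l)
  go (large l u) (large l′ u′) refl refl = injective-large cs cs′ inc inc′ l u l′ u′
    (via (I.partition-large l u) (I′.partition-large l′ u′))

-- Every class comes from an address

linked-∷ʳ : ∀ {x y : ℕ} xs → Linked _≤_ (xs ∷ʳ x) → x ≤ y → Linked _≤_ (xs ∷ʳ x ∷ʳ y)
linked-∷ʳ []           _          x≤y = x≤y ∷ [-]
linked-∷ʳ (_ ∷ [])     (r ∷ _)    x≤y = r ∷ x≤y ∷ [-]
linked-∷ʳ (_ ∷ z ∷ xs) (r ∷ inc)  x≤y = r ∷ linked-∷ʳ (z ∷ xs) inc x≤y

linked-reverse : ∀ {xs} → Linked _≥_ xs → Linked _≤_ (reverse xs)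
linked-reverse []  = []
linked-reverse [-] = [-]
linked-reverse {x ∷ y ∷ xs} (y≤x ∷ dec) = subst (Linked _≤_)
  (sym (trans (Listₚ.unfold-reverse x (y ∷ xs)) (cong (_∷ʳ x) (Listₚ.unfold-reverse y xs))))
  (linked-∷ʳ (reverse xs) (subst (Linked _≤_) (Listₚ.unfold-reverse y xs) (linked-reverse dec)) y≤x)

-- The inverse of  c₁, c₂, …  ↦  c₁ - 1, c₂ - 2, …, started at position i.
climb : ℕ → List ℕ → List ℕ
climb i []       = []
climb i (e ∷ es) = (e + suc i) ∷ climb (suc i) es

climb-∷ʳ : ∀ i es z → climb i (es ∷ʳ z) ≡ climb i es ∷ʳ (z + suc (i + length es))
climb-∷ʳ i []       z = cong (λ j → z + suc j ∷ []) (sym (ℕₚ.+-identityʳ i))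
climb-∷ʳ i (e ∷ es) z = cong ((e + suc i) ∷_) (trans (climb-∷ʳ (suc i) es z)
  (cong (λ j → climb (suc i) es ∷ʳ (z + suc j)) (sym (ℕₚ.+-suc i (length es)))))

length-climb : ∀ i es → length (climb i es) ≡ length es
length-climb i []       = refl
length-climb i (e ∷ es) = cong suc (length-climb (suc i) es)

climb-increasing : ∀ i {e} es → Linked _≤_ (e ∷ es) → Linked _<_ (e + i ∷ climb i es)
climb-increasing i     []        _           = [-]
climb-increasing i {e} (e′ ∷ es) (e≤e′ ∷ inc) =
  subst (e + i <_) (sym (ℕₚ.+-suc e′ i)) (s≤s (ℕₚ.+-monoˡ-≤ i e≤e′)) ∷ climb-increasing (suc i) es inc

nth-climb : ∀ i es k → k < length es → nth (climb i es) k ∸ suc (i + k) ≡ nth es k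
nth-climb i (e ∷ es) zero    _         = trans (cong (λ j → e + suc i ∸ suc j) (ℕₚ.+-identityʳ i)) (ℕₚ.m+n∸n≡m e (suc i))
nth-climb i (e ∷ es) (suc k) (s≤s k<l) =
  trans (cong (λ j → nth (climb (suc i) es) k ∸ suc j) (ℕₚ.+-suc i k)) (nth-climb (suc i) es k k<l)

descend-climb : ∀ es → descend (nth (0 ∷ climb 0 es)) (length es) ≡ reverse es
descend-climb es = begin
  descend (nth (0 ∷ climb 0 es)) (length es)  ≡⟨ pointwise (length es) ℕₚ.≤-refl ⟩
  applyDownFrom (nth es) (length es)          ≡⟨ sym (Listₚ.reverse-applyUpTo (nth es) (length es)) ⟩
  reverse (applyUpTo (nth es) (length es))    ≡⟨ cong reverse (applyUpTo-nth es) ⟩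
  reverse es                                  ∎
  where
  open ≡-Reasoning
  pointwise : ∀ k → k ≤ length es → descend (nth (0 ∷ climb 0 es)) k ≡ applyDownFrom (nth es) k
  pointwise zero    _   = refl
  pointwise (suc k) k<l = cong₂ _∷_ (nth-climb 0 es k k<l) (pointwise k (ℕₚ.<⇒≤ k<l))
  applyUpTo-nth : ∀ es → applyUpTo (nth es) (length es) ≡ es
  applyUpTo-nth []       = refl
  applyUpTo-nth (e ∷ es) = cong (e ∷_) (applyUpTo-nth es)

-- The entries of `ds` become the address. The entry `z` on top of them becomes the sentinel: it is
-- moved up by `length ds + 1`, and `total` makes the result `suc n`. That `z` bounds `ds` is what
-- keeps the address within 1, ..., n.
module Built {n : ℕ} (z : ℕ) (ds : List ℕ) (decreasing : Linked _≥_ (z ∷ ds)) (total : z + length ds ≡ n) where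

  cs : List ℕ
  cs = climb 0 (reverse ds)

  cs∷ʳ : climb 0 (reverse (z ∷ ds)) ≡ cs ∷ʳ suc n
  cs∷ʳ = begin
    climb 0 (reverse (z ∷ ds))                     ≡⟨ cong (climb 0) (Listₚ.unfold-reverse z ds) ⟩
    climb 0 (reverse ds ∷ʳ z)                      ≡⟨ climb-∷ʳ 0 (reverse ds) z ⟩
    cs ∷ʳ (z + suc (length (reverse ds)))          ≡⟨ cong (λ l → cs ∷ʳ (z + suc l)) (Listₚ.length-reverse ds) ⟩
    cs ∷ʳ (z + suc (length ds))                    ≡⟨ cong (cs ∷ʳ_) (trans (ℕₚ.+-suc z _) (cong suc total)) ⟩
    cs ∷ʳ suc n                                    ∎
    where open ≡-Reasoning

  increasing : Linked _<_ (0 ∷ cs ∷ʳ suc n)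
  increasing = subst (λ xs → Linked _<_ (0 ∷ xs)) cs∷ʳ
    (climb-increasing 0 (reverse (z ∷ ds)) (0∷ (linked-reverse decreasing)))
    where
    0∷ : ∀ {xs} → Linked _≤_ xs → Linked _≤_ (0 ∷ xs)
    0∷ []        = [-]
    0∷ [-]       = z≤n ∷ [-]
    0∷ (r ∷ inc) = z≤n ∷ r ∷ inc

  length-cs : length cs ≡ length ds
  length-cs = trans (length-climb 0 (reverse ds)) (Listₚ.length-reverse ds)

  descend-cs : descend (index n cs) (suc (length ds)) ≡ z ∷ ds
  descend-cs = begin
    descend (index n cs) (suc (length ds))
      ≡⟨ cong₂ (λ xs k → descend (nth (0 ∷ xs)) k) (sym cs∷ʳ) (sym (Listₚ.length-reverse (z ∷ ds))) ⟩
    descend (nth (0 ∷ climb 0 (reverse (z ∷ ds)))) (length (reverse (z ∷ ds)))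
      ≡⟨ descend-climb (reverse (z ∷ ds)) ⟩
    reverse (reverse (z ∷ ds))
      ≡⟨ Listₚ.reverse-involutive (z ∷ ds) ⟩
    z ∷ ds ∎
    where open ≡-Reasoning

-- Division by repeated subtraction of `M`. With `g = 0` a sum of `suc k` parts reaches at most
-- `M + k * v`; a larger `N` stays above `k * v` after one `M` is removed, so the recursive call
-- cannot return the minimal alternative. The witness `p` is one less than the part it describes,
-- which is the form needed for the entry `c (1 + s) ∸ (1 + s)`.
divide-sum : ∀ {v M} k N → k * v ≤ N → N ≤ k * M → N ≡ k * v ⊎
  (∃[ g ] ∃[ h ] ∃[ p ] v ≤ p × p < M × g + suc h ≡ k × N ≡ g * M + (suc p + h * v))
divide-sum zero    N _ N≤ = inj₁ (ℕₚ.n≤0⇒n≡0 N≤)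
divide-sum {v} {M} (suc k) N ≤N N≤ with N ℕₚ.≤? M + k * v
... | yes N≤M+kv with ℕₚ.m≤n⇒m<n∨m≡n ≤N
...   | inj₂ eq   = inj₁ (sym eq)
...   | inj₁ v+kv<N = inj₂ (0 , k , N ∸ suc (k * v) , v≤p , p<M , refl , sym N≡)
  where
  N≡ : suc (N ∸ suc (k * v)) + k * v ≡ N
  N≡ = trans (sym (ℕₚ.+-suc _ (k * v))) (ℕₚ.m∸n+n≡m (ℕₚ.≤-trans (s≤s (ℕₚ.m≤n+m (k * v) v)) v+kv<N))
  v≤p : v ≤ N ∸ suc (k * v)
  v≤p = ℕₚ.+-cancelʳ-≤ (k * v) _ _ (ℕₚ.≤-pred (ℕₚ.≤-trans v+kv<N (ℕₚ.≤-reflexive (sym N≡))))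
  p<M : N ∸ suc (k * v) < M
  p<M = ℕₚ.+-cancelʳ-≤ (k * v) _ _ (ℕₚ.≤-trans (ℕₚ.≤-reflexive N≡) N≤M+kv)
divide-sum {v} {M} (suc k) N ≤N N≤ | no N≰ = case-M (divide-sum k (N ∸ M) (ℕₚ.<⇒≤ kv<) N∸M≤)
  where
  M+kv<N : M + k * v < N
  M+kv<N = ℕₚ.≰⇒> N≰
  N≡ : M + (N ∸ M) ≡ N
  N≡ = ℕₚ.m+[n∸m]≡n (ℕₚ.≤-trans (ℕₚ.m≤m+n M (k * v)) (ℕₚ.<⇒≤ M+kv<N))
  kv< : k * v < N ∸ M
  kv< = ℕₚ.+-cancelˡ-< M _ _ (subst (M + k * v <_) (sym N≡) M+kv<N)
  N∸M≤ : N ∸ M ≤ k * M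
  N∸M≤ = ℕₚ.+-cancelˡ-≤ M _ _ (subst (_≤ suc k * M) (sym N≡) N≤)
  case-M : _ → _
  case-M (inj₁ eq) = contradiction kv< (ℕₚ.<-irrefl (sym eq))
  case-M (inj₂ (g , h , p , v≤p , p<M , parts , eq)) = inj₂ (suc g , h , p , v≤p , p<M , cong suc parts ,
    trans (sym N≡) (trans (cong (M +_) eq) (sym (ℕₚ.+-assoc M (g * M) _))))

-- Here `nth ts 0` is the largest tail part `v`. Its default 0 on an empty tail agrees with the
-- value of `c s ∸ s` for `s = 0`. The two bounds on the sum are exactly what `divide-sum` asks for.
record Split (m : ℕ) (us ts : List ℕ) : Set where
  field
    top≤m      : nth ts 0 ≤ m
    lower      : length us * nth ts 0 ≤ sum us
    upper      : sum us ≤ length us * m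
    decreasing : Linked _≥_ ts

split : ∀ {m} us ts → Linked _≥_ (m ∷ us ++ ts) → Split m us ts
split [] []       _           = record { top≤m = z≤n ; lower = z≤n ; upper = z≤n ; decreasing = [] }
split [] (t ∷ ts) (t≤m ∷ dec) = record { top≤m = t≤m ; lower = z≤n ; upper = z≤n ; decreasing = dec }
split {m} (u ∷ us) ts (u≤m ∷ dec) = record
  { top≤m      = ℕₚ.≤-trans top≤m u≤m
  ; lower      = ℕₚ.+-mono-≤ top≤m lower
  ; upper      = ℕₚ.+-mono-≤ u≤m (ℕₚ.≤-trans upper (ℕₚ.*-monoʳ-≤ (length us) u≤m))
  ; decreasing = decreasing
  }
  where open Split (split us ts dec)

linked-∷ : ∀ {m ts} → nth ts 0 ≤ m → Linked _≥_ ts → Linked _≥_ (m ∷ ts)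
linked-∷ {ts = []}    _   _   = [-]
linked-∷ {ts = _ ∷ _} t≤m dec = t≤m ∷ dec

module _ {n s : ℕ} {cs : List ℕ} (inc : Linked _<_ (0 ∷ cs ∷ʳ suc n)) where

  open Increasing cs inc

  top-descend : ∀ s → nth (descend c s) 0 ≡ c s ∸ s
  top-descend zero    = refl
  top-descend (suc s) = refl

  shifted : ∀ {k e} → k ≤ suc r → c k ∸ k ≡ e → c k ≡ k + e
  shifted {k} k≤1+r refl = sym (ℕₚ.m+[n∸m]≡n (k≤c k k≤1+r))

  partition-middle-∼ : ∀ {m us ts} → length ts ≡ s → m + (length us + s) ≡ n → sum us ≡ length us * nth ts 0 →
    r ≡ 1 + s → descend c (1 + s) ≡ m ∷ ts → partition n s cs ∼[ s ] us ++ ts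
  partition-middle-∼ {m} {us} {ts} len total sum-us r≡ desc = subst (_∼[ s ] us ++ ts)
    (sym (trans (partition-middle r≡) (cong (topII n s c ++_) desc-s)))
    (∼-++⁺ ts len length-top (begin
      sum (topII n s c)                        ≡⟨ sum-topII {s} ⟩
      length (topII n s c) * (c s ∸ s)         ≡⟨ cong₂ _*_ length-top (trans (sym (top-descend s)) (cong (λ xs → nth xs 0) desc-s)) ⟩
      length us * nth ts 0                     ≡⟨ sym sum-us ⟩
      sum us                                   ∎))
    where
    open ≡-Reasoning
    desc-s = Listₚ.∷-injectiveʳ desc
    c₁ : c (1 + s) ≡ 1 + s + m
    c₁ = shifted (ℕₚ.m≤n⇒m≤1+n (ℕₚ.≤-reflexive (sym r≡))) (Listₚ.∷-injectiveˡ desc)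
    length-top : length (topII n s c) ≡ length us
    length-top = begin
      length (topII n s c)                       ≡⟨ length-topII {s} ⟩
      suc n ∸ c (1 + s)                          ≡⟨ cong₂ (λ x y → suc x ∸ y) (sym total) c₁ ⟩
      m + (length us + s) ∸ (s + m)              ≡⟨ cong (_∸ (s + m)) (shuffle m (length us) s) ⟩
      s + m + length us ∸ (s + m)                ≡⟨ ℕₚ.m+n∸m≡n (s + m) (length us) ⟩
      length us                                  ∎
      where
      shuffle : ∀ a b c → a + (b + c) ≡ c + a + b
      shuffle = solve 3 (λ a b c → a :+ (b :+ c) := c :+ a :+ b) refl
        where open ℕSolver.+-*-Solver

  -- The parts are `c (2 + s) ∸ (1 + s)` and `c (1 + s) ∸ s`, each one larger than the corresponding
  -- entry `M` or `p` of `descend`; this is the origin of `suc M` and `suc p`.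
  partition-large-∼ : ∀ {M p g h us ts} → length ts ≡ s → suc M + (length us + s) ≡ n → g + suc h ≡ length us →
    sum us ≡ g * suc M + (suc p + h * nth ts 0) → 2 + s ≤ r → r ≤ 3 + s →
    descend c (3 + s) ≡ M + g ∷ M ∷ p ∷ ts → partition n s cs ∼[ s ] us ++ ts
  partition-large-∼ {M} {p} {g} {h} {us} {ts} len total parts sum-us 2+s≤r r≤3+s desc = subst (_∼[ s ] us ++ ts)
    (sym (trans (partition-large 2+s≤r r≤3+s) (cong (topIII n s c ++_) desc-s)))
    (∼-++⁺ ts len
      (trans L.length-topIII (trans (cong₂ (λ g h → g + suc h) g≡ h≡) parts))
      (begin
        sum (topIII n s c)                      ≡⟨ L.sum-topIII ⟩
        L.g * L.M + (L.p + L.h * L.v)           ≡⟨ cong₂ _+_ (cong₂ _*_ g≡ M≡) (cong₂ _+_ p≡ (cong₂ _*_ h≡ v≡)) ⟩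
        g * suc M + (suc p + h * nth ts 0)      ≡⟨ sym sum-us ⟩
        sum us                                  ∎))
    where
    open ≡-Reasoning
    module L = Large 2+s≤r
    desc-2 = Listₚ.∷-injectiveʳ desc
    desc-1 = Listₚ.∷-injectiveʳ desc-2
    desc-s = Listₚ.∷-injectiveʳ desc-1
    c₁ : c (1 + s) ≡ 1 + s + p
    c₁ = shifted (ℕₚ.m≤n⇒m≤1+n L.1+s≤r) (Listₚ.∷-injectiveˡ desc-1)
    c₂ : c (2 + s) ≡ 2 + s + M
    c₂ = shifted (ℕₚ.m≤n⇒m≤1+n 2+s≤r) (Listₚ.∷-injectiveˡ desc-2)
    c₃ : c (3 + s) ≡ 3 + s + (M + g)
    c₃ = shifted (s≤s 2+s≤r) (Listₚ.∷-injectiveˡ desc)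
    v≡ : L.v ≡ nth ts 0
    v≡ = trans (sym (top-descend s)) (cong (λ xs → nth xs 0) desc-s)
    p≡ : L.p ≡ suc p
    p≡ = trans (cong (_∸ s) (trans c₁ (sym (ℕₚ.+-suc s p)))) (ℕₚ.m+n∸m≡n s (suc p))
    M≡ : L.M ≡ suc M
    M≡ = trans (cong (_∸ suc s) (trans c₂ (sym (ℕₚ.+-suc (suc s) M)))) (ℕₚ.m+n∸m≡n (suc s) (suc M))
    g≡ : L.g ≡ g
    g≡ = trans (cong₂ (λ x y → x ∸ suc y) (trans c₃ (sym (ℕₚ.+-assoc (3 + s) M g))) c₂) (ℕₚ.m+n∸m≡n (3 + s + M) g)
    h≡ : L.h ≡ h
    h≡ = begin
      suc n ∸ c (3 + s)                                         ≡⟨ cong₂ (λ x y → suc x ∸ y) (sym (trans (cong (λ k → suc M + (k + s)) parts) total)) c₃ ⟩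
      suc (suc M + (g + suc h + s)) ∸ (3 + s + (M + g))         ≡⟨ cong (_∸ (3 + s + (M + g))) (shuffle M g h s) ⟩
      3 + s + (M + g) + h ∸ (3 + s + (M + g))                   ≡⟨ ℕₚ.m+n∸m≡n (3 + s + (M + g)) h ⟩
      h                                                         ∎
      where
      shuffle : ∀ M g h s → suc (suc M + (g + suc h + s)) ≡ 3 + s + (M + g) + h
      shuffle = solve 4 (λ M g h s → con 2 :+ M :+ (g :+ (con 1 :+ h) :+ s) := con 3 :+ s :+ (M :+ g) :+ h) refl
        where open ℕSolver.+-*-Solver

Preimage : ℕ → ℕ → List ℕ → Set
Preimage n s rs = ∃[ cs ] Linked _<_ (0 ∷ cs ∷ʳ suc n) × length cs ≤ 3 + s × partition n s cs ∼[ s ] rs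

preimage-small : ∀ {n s} rs → Fits n rs → length rs ≤ s → Preimage n s rs
preimage-small {n} {s} rs (m , total , dec) short =
  B.cs , B.increasing , ℕₚ.≤-trans r≤s (ℕₚ.m≤n+m s 3) , subst (_∼[ s ] rs) (sym partition≡) (same refl refl refl)
  where
  module B = Built m rs dec total
  r≤s = subst (_≤ s) (sym B.length-cs) short
  partition≡ : partition n s B.cs ≡ rs
  partition≡ = trans (Increasing.partition-small B.cs B.increasing r≤s)
    (trans (cong (descend (index n B.cs)) B.length-cs) (Listₚ.∷-injectiveʳ B.descend-cs))

preimage-++ : ∀ {n m} k us ts → length us ≡ suc k → m + (suc k + length ts) ≡ n → Linked _≥_ (m ∷ us ++ ts) →
              Preimage n (length ts) (us ++ ts)
preimage-++ {n} {m} k us ts lu total dec with divide-sum {nth ts 0} {m} (length us) (sum us) lower upper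
  where open Split (split us ts dec)
-- All upper parts equal `v`: an address with `s + 1` elements, whose largest is the bound `m`
-- shifted by its position. The sentinel entry `m + k` is forced by the total `n`.
... | inj₁ minimal =
  B.cs , B.increasing , ℕₚ.≤-trans (ℕₚ.≤-reflexive B.length-cs) (ℕₚ.m≤n+m _ 2) ,
  partition-middle-∼ B.increasing refl (trans (cong (λ k → m + (k + length ts)) lu) total) minimal B.length-cs
    (Listₚ.∷-injectiveʳ B.descend-cs)
  where
  open Split (split us ts dec)
  module B = Built (m + k) (m ∷ ts) (ℕₚ.m≤m+n m k ∷ linked-∷ top≤m decreasing)
    (trans (ℕₚ.+-assoc m k _) (trans (cong (m +_) (ℕₚ.+-suc k (length ts))) total))
-- With `h = 0` the entry `M + g` that encodes `c (3 + s)` is already the sentinel, so the address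
-- has `s + 2` elements.
... | inj₂ (g , zero , p , v≤p , s≤s {n = M} p≤M , parts , sum-us) =
  B.cs , B.increasing , ℕₚ.≤-trans (ℕₚ.≤-reflexive B.length-cs) (ℕₚ.n≤1+n _) ,
  partition-large-∼ B.increasing refl (trans (cong (λ k → m + (k + length ts)) lu) total) parts sum-us
    (ℕₚ.≤-reflexive (sym B.length-cs)) (ℕₚ.≤-trans (ℕₚ.≤-reflexive B.length-cs) (ℕₚ.n≤1+n _)) B.descend-cs
  where
  open Split (split us ts dec)
  shuffle : ∀ M g l → M + g + (2 + l) ≡ suc M + (g + 1 + l)
  shuffle = solve 3 (λ M g l → M :+ g :+ (con 2 :+ l) := con 1 :+ M :+ (g :+ con 1 :+ l)) refl
    where open ℕSolver.+-*-Solver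
  module B = Built (M + g) (M ∷ p ∷ ts) (ℕₚ.m≤m+n M g ∷ p≤M ∷ linked-∷ v≤p decreasing)
    (trans (shuffle M g (length ts)) (trans (cong (λ k → suc M + (k + length ts)) (trans parts lu)) total))
-- With a positive number of copies of `v` left, `M + g` lies below the sentinel and is a genuine
-- element, the last of `s + 3`.
... | inj₂ (g , suc h , p , v≤p , s≤s {n = M} p≤M , parts , sum-us) =
  B.cs , B.increasing , ℕₚ.≤-reflexive B.length-cs ,
  partition-large-∼ B.increasing refl (trans (cong (λ k → m + (k + length ts)) lu) total) parts sum-us
    (ℕₚ.≤-trans (ℕₚ.n≤1+n _) (ℕₚ.≤-reflexive (sym B.length-cs))) (ℕₚ.≤-reflexive B.length-cs)
    (Listₚ.∷-injectiveʳ B.descend-cs)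
  where
  open Split (split us ts dec)
  shuffle : ∀ M g h l → M + g + h + (3 + l) ≡ suc M + (g + (2 + h) + l)
  shuffle = solve 4 (λ M g h l → M :+ g :+ h :+ (con 3 :+ l) := con 1 :+ M :+ (g :+ (con 2 :+ h) :+ l)) refl
    where open ℕSolver.+-*-Solver
  module B = Built (M + g + h) (M + g ∷ M ∷ p ∷ ts)
    (ℕₚ.m≤m+n (M + g) h ∷ ℕₚ.m≤m+n M g ∷ p≤M ∷ linked-∷ v≤p decreasing)
    (trans (shuffle M g h (length ts)) (trans (cong (λ k → suc M + (k + length ts)) (trans parts lu)) total))

partition-surjective : ∀ {n} s rs → Fits n rs → Preimage n s rs
partition-surjective {n} s rs fits@(m , total , dec) with length rs ℕₚ.≤? s
... | yes short = preimage-small rs fits short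
... | no long = subst₂ (Preimage n) length-ts split-≡
  (preimage-++ (length rs ∸ suc s) us ts length-us
    (trans (cong (m +_) (trans (cong₂ _+_ (sym length-us) refl) (trans (sym (Listₚ.length-++ us)) (cong length split-≡)))) total)
    (subst (λ xs → Linked _≥_ (m ∷ xs)) (sym split-≡) dec))
  where
  s<l = ℕₚ.≰⇒> long
  us = take (length rs ∸ s) rs
  ts = drop (length rs ∸ s) rs
  split-≡ : us ++ ts ≡ rs
  split-≡ = Listₚ.take++drop≡id (length rs ∸ s) rs
  length-ts : length ts ≡ s
  length-ts = trans (Listₚ.length-drop (length rs ∸ s) rs) (ℕₚ.m∸[m∸n]≡n (ℕₚ.<⇒≤ s<l))
  length-us : length us ≡ suc (length rs ∸ suc s)
  length-us = trans (Listₚ.length-take (length rs ∸ s) rs)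
    (trans (ℕₚ.m≤n⇒m⊓n≡m (ℕₚ.m∸n≤m (length rs) s)) (sym (trans (sym (ℕₚ.+-∸-assoc 1 s<l)) refl)))

-- Sign words

-- A recursive form of `changes`, with the position of the first letter and the letter before it as
-- parameters, so that induction can pass to the rest of a word.
changesFrom : ∀ {n} → ℕ → Sign → Vec Sign n → List ℕ
changesFrom i s []      = []
changesFrom i s (t ∷ w) with s Signₚ.≟ t
... | yes _ = changesFrom (suc i) t w
... | no _  = i ∷ changesFrom (suc i) t w

changes≡changesFrom : ∀ {n} (w : Vec Sign n) → changes w ≡ changesFrom 1 Sign.+ w
changes≡changesFrom {n} w = trans (Listₚ.map-cong (λ j → refl) (positions (Sign.+ ∷ w))) (go 1 Sign.+ w)
  where
  differ? : ∀ {n} (v : Vec Sign (suc n)) (j : Fin n) → _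
  differ? v j = ¬? (lookup v (inject₁ j) Signₚ.≟ lookup v (Fin.suc j))
  positions : ∀ {n} → Vec Sign (suc n) → List (Fin n)
  positions {n} v = filter (differ? v) (allFin n)
  positions-suc : ∀ {n} s t (w : Vec Sign n) →
    filter (differ? (s ∷ t ∷ w)) (tabulateₗ Fin.suc) ≡ map Fin.suc (positions (t ∷ w))
  positions-suc s t w = trans (cong (filter (differ? (s ∷ t ∷ w))) (sym (Listₚ.map-tabulate id Fin.suc)))
    (filter-map (differ? (s ∷ t ∷ w)) Fin.suc (allFin _))
  go : ∀ {n} i s (w : Vec Sign n) → map (λ j → i + toℕ j) (positions (s ∷ w)) ≡ changesFrom i s w
  tail : ∀ {n} i s t (w : Vec Sign n) →
    map (λ j → i + toℕ j) (filter (differ? (s ∷ t ∷ w)) (tabulateₗ Fin.suc)) ≡ changesFrom (suc i) t w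
  tail i s t w = begin
    map (λ j → i + toℕ j) (filter (differ? (s ∷ t ∷ w)) (tabulateₗ Fin.suc))
      ≡⟨ cong (map (λ j → i + toℕ j)) (positions-suc s t w) ⟩
    map (λ j → i + toℕ j) (map Fin.suc (positions (t ∷ w)))
      ≡⟨ sym (Listₚ.map-∘ (positions (t ∷ w))) ⟩
    map (λ j → i + suc (toℕ j)) (positions (t ∷ w))
      ≡⟨ Listₚ.map-cong (λ j → ℕₚ.+-suc i (toℕ j)) (positions (t ∷ w)) ⟩
    map (λ j → suc i + toℕ j) (positions (t ∷ w))
      ≡⟨ go (suc i) t w ⟩
    changesFrom (suc i) t w ∎
    where open ≡-Reasoning
  go i s []      = refl
  go i s (t ∷ w) with s Signₚ.≟ t
  ... | yes _ = tail i s t w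
  ... | no _  = cong₂ _∷_ (ℕₚ.+-identityʳ i) (tail i s t w)

changesFrom-≥ : ∀ {n} i s (w : Vec Sign n) → All (i ≤_) (changesFrom i s w)
changesFrom-≥ i s []      = []
changesFrom-≥ i s (t ∷ w) with s Signₚ.≟ t
... | yes _ = All.map (ℕₚ.≤-trans (ℕₚ.n≤1+n i)) (changesFrom-≥ (suc i) t w)
... | no _  = ℕₚ.≤-refl ∷ All.map (ℕₚ.≤-trans (ℕₚ.n≤1+n i)) (changesFrom-≥ (suc i) t w)

≢⇒opposite : ∀ {s t} → s ≢ t → opposite s ≡ t
≢⇒opposite {Sign.+} {Sign.+} s≢t = contradiction refl s≢t
≢⇒opposite {Sign.+} {Sign.-} _   = refl
≢⇒opposite {Sign.-} {Sign.+} _   = refl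
≢⇒opposite {Sign.-} {Sign.-} s≢t = contradiction refl s≢t

-- The letter at `i` is determined by `s` and by whether the list starts with `i`; without a change
-- at `i` all entries are larger.
changesFrom-injective : ∀ {n} i s (w w′ : Vec Sign n) → changesFrom i s w ≡ changesFrom i s w′ → w ≡ w′
changesFrom-injective i s []      []        _  = refl
changesFrom-injective i s (t ∷ w) (t′ ∷ w′) eq with s Signₚ.≟ t | s Signₚ.≟ t′
... | yes refl | yes refl = cong (t ∷_) (changesFrom-injective (suc i) t w w′ eq)
... | no s≢t   | no s≢t′ with trans (sym (≢⇒opposite s≢t)) (≢⇒opposite s≢t′)
...   | refl = cong (t ∷_) (changesFrom-injective (suc i) t w w′ (Listₚ.∷-injectiveʳ eq))
changesFrom-injective i s (t ∷ w) (t′ ∷ w′) eq | yes _ | no _ =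
  contradiction (All.head (subst (All (suc i ≤_)) eq (changesFrom-≥ (suc i) t w))) (ℕₚ.<-irrefl refl)
changesFrom-injective i s (t ∷ w) (t′ ∷ w′) eq | no _ | yes _ =
  contradiction (All.head (subst (All (suc i ≤_)) (sym eq) (changesFrom-≥ (suc i) t′ w′))) (ℕₚ.<-irrefl refl)

changes-injective : ∀ {n} {w w′ : Vec Sign n} → changes w ≡ changes w′ → w ≡ w′
changes-injective {w = w} {w′} eq = changesFrom-injective 1 Sign.+ w w′
  (trans (sym (changes≡changesFrom w)) (trans eq (changes≡changesFrom w′)))

changesFrom-surjective : ∀ n i s cs → Linked _<_ (i ∷ cs ∷ʳ (suc i + n)) → ∃[ w ] changesFrom {n} (suc i) s w ≡ cs
changesFrom-surjective zero    i s []       _ = [] , refl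
changesFrom-surjective zero    i s (c ∷ cs) (i<c ∷ inc) =
  contradiction i<c (ℕₚ.≤⇒≯ (ℕₚ.≤-pred (subst (c <_) (cong suc (ℕₚ.+-identityʳ i)) (head<last cs inc))))
changesFrom-surjective (suc n) i s [] _ with changesFrom-surjective n (suc i) s [] (s≤s (s≤s (ℕₚ.m≤m+n i n)) ∷ [-])
... | w , eq = s ∷ w , keep
  where
  keep : changesFrom (suc i) s (s ∷ w) ≡ []
  keep with s Signₚ.≟ s
  ... | yes _  = eq
  ... | no s≢s = contradiction refl s≢s
changesFrom-surjective (suc n) i s (c ∷ cs) (i<c ∷ inc) with ℕₚ.m≤n⇒m<n∨m≡n i<c
... | inj₂ refl with changesFrom-surjective n c (opposite s) cs (subst (λ k → Linked _<_ (c ∷ cs ∷ʳ k)) (cong suc (ℕₚ.+-suc i n)) inc)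
...   | w , eq = opposite s ∷ w , flip
  where
  flip : changesFrom (suc i) s (opposite s ∷ w) ≡ c ∷ cs
  flip with s Signₚ.≟ opposite s
  ... | yes s≡ = contradiction s≡ (Signₚ.s≢opposite[s] s)
  ... | no _   = cong (c ∷_) eq
changesFrom-surjective (suc n) i s (c ∷ cs) (i<c ∷ inc) | inj₁ 1+i<c
  with changesFrom-surjective n (suc i) s (c ∷ cs) (1+i<c ∷ subst (λ k → Linked _<_ (c ∷ cs ∷ʳ k)) (cong suc (ℕₚ.+-suc i n)) inc)
... | w , eq = s ∷ w , keep
  where
  keep : changesFrom (suc i) s (s ∷ w) ≡ c ∷ cs
  keep with s Signₚ.≟ s
  ... | yes _  = eq
  ... | no s≢s = contradiction refl s≢s

changes-surjective : ∀ {n} cs → Linked _<_ (0 ∷ cs ∷ʳ suc n) → ∃[ w ] changes {n} w ≡ cs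
changes-surjective {n} cs inc with changesFrom-surjective n 0 Sign.+ cs inc
... | w , eq = w , trans (changes≡changesFrom w) eq

-- Polynomials over ℚ

-- Opaque, since normalising ℚ arithmetic on open terms is prohibitively expensive.
opaque

  ⟦_⟧ : ℕ → ℚ
  ⟦ k ⟧ = ℤ.+ k ℚ./ 1

  ⟦suc⟧ : ∀ k → ⟦ suc k ⟧ ≡ ⟦ k ⟧ ℚ.+ 1ℚ
  ⟦suc⟧ k = ℚₚ.toℚᵘ-injective (begin
    ℚ.toℚᵘ ⟦ suc k ⟧                          ≈⟨ ℚₚ.toℚᵘ-fromℚᵘ (ℚᵘ.mkℚᵘ (ℤ.+ suc k) 0) ⟩
    ℚᵘ.mkℚᵘ (ℤ.+ suc k) 0                       ≈⟨ ℚᵘ.*≡* (cong (ℤ._* ℤ.+ 1) (sym (trans (cong₂ ℤ._+_ (ℤₚ.*-identityʳ (ℤ.+ k)) refl) (cong ℤ.+_ (ℕₚ.+-comm k 1))))) ⟩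
    ℚᵘ.mkℚᵘ (ℤ.+ k) 0 ℚᵘ.+ ℚᵘ.1ℚᵘ               ≈⟨ ℚᵘₚ.+-congˡ ℚᵘ.1ℚᵘ (ℚᵘₚ.≃-sym (ℚₚ.toℚᵘ-fromℚᵘ (ℚᵘ.mkℚᵘ (ℤ.+ k) 0))) ⟩
    ℚ.toℚᵘ ⟦ k ⟧ ℚᵘ.+ ℚᵘ.1ℚᵘ                  ≈⟨ ℚᵘₚ.≃-sym (ℚₚ.toℚᵘ-homo-+ ⟦ k ⟧ 1ℚ) ⟩
    ℚ.toℚᵘ (⟦ k ⟧ ℚ.+ 1ℚ)                     ∎)
    where open ℚᵘₚ.≃-Reasoning

  ⟦0⟧ : ⟦ 0 ⟧ ≡ 0ℚ
  ⟦0⟧ = refl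

  ⟦1⟧ : ⟦ 1 ⟧ ≡ 1ℚ
  ⟦1⟧ = refl

  ⟦⟧-/1 : ∀ k → ⟦ k ⟧ ≡ ℤ.+ k ℚ./ 1
  ⟦⟧-/1 k = refl

⟦n⟧<⟦1+n⟧ : ∀ n → ⟦ n ⟧ ℚ.< ⟦ suc n ⟧
⟦n⟧<⟦1+n⟧ n = subst₂ ℚ._<_ (ℚₚ.+-identityʳ ⟦ n ⟧) (sym (⟦suc⟧ n)) (ℚₚ.+-monoʳ-< ⟦ n ⟧ (ℚₚ.positive⁻¹ 1ℚ))

⟦⟧-mono-< : ∀ {k m} → k < m → ⟦ k ⟧ ℚ.< ⟦ m ⟧
⟦⟧-mono-< {k} {suc m} (s≤s k≤m) with ℕₚ.m≤n⇒m<n∨m≡n k≤m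
... | inj₁ k<m  = ℚₚ.<-trans (⟦⟧-mono-< k<m) (⟦n⟧<⟦1+n⟧ m)
... | inj₂ refl = ⟦n⟧<⟦1+n⟧ k

⟦⟧-mono-≤ : ∀ {k m} → k ≤ m → ⟦ k ⟧ ℚ.≤ ⟦ m ⟧
⟦⟧-mono-≤ k≤m with ℕₚ.m≤n⇒m<n∨m≡n k≤m
... | inj₁ k<m  = ℚₚ.<⇒≤ (⟦⟧-mono-< k<m)
... | inj₂ refl = ℚₚ.≤-refl

0≤⟦⟧ : ∀ k → 0ℚ ℚ.≤ ⟦ k ⟧
0≤⟦⟧ k = subst (ℚ._≤ ⟦ k ⟧) ⟦0⟧ (⟦⟧-mono-≤ z≤n)

horner : ∀ {d} → Vector ℚ d → ℚ → ℚ
horner {zero}  x t = 0ℚ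
horner {suc d} x t = x Fin.zero ℚ.+ t ℚ.* horner (x ∘ Fin.suc) t

opaque

  eval : ∀ {d} → Vector ℚ d → ℚ → ℚ
  eval x t = 1ℚ ℚ.+ t ℚ.* horner x t

  eval-def : ∀ {d} (x : Vector ℚ d) t → eval x t ≡ 1ℚ ℚ.+ t ℚ.* horner x t
  eval-def x t = refl

eval-0 : ∀ {d} (x : Vector ℚ d) → eval x ⟦ 0 ⟧ ≡ 1ℚ
eval-0 x = trans (cong (eval x) ⟦0⟧) (trans (eval-def x 0ℚ)
  (trans (cong (1ℚ ℚ.+_) (ℚₚ.*-zeroˡ (horner x 0ℚ))) (ℚₚ.+-identityʳ 1ℚ)))

infixr 8 _^_

_^_ : ℚ → ℕ → ℚ
t ^ zero  = 1ℚ
t ^ suc k = t ℚ.* (t ^ k)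

foldr-horner : ∀ {d} (x : Vector ℚ d) t →
               foldr ℚ._+_ 0ℚ (λ k → x k ℚ.* (t ^ suc (toℕ k))) ≡ t ℚ.* horner x t
foldr-horner {zero}  x t = sym (ℚₚ.*-zeroʳ t)
foldr-horner {suc d} x t = begin
  x Fin.zero ℚ.* (t ℚ.* 1ℚ) ℚ.+ foldr ℚ._+_ 0ℚ (λ k → x (Fin.suc k) ℚ.* (t ℚ.* (t ^ suc (toℕ k))))
    ≡⟨ cong (x Fin.zero ℚ.* (t ℚ.* 1ℚ) ℚ.+_) (foldr-* _ _ λ k → swap (x (Fin.suc k)) t (t ^ suc (toℕ k))) ⟩
  x Fin.zero ℚ.* (t ℚ.* 1ℚ) ℚ.+ t ℚ.* foldr ℚ._+_ 0ℚ (λ k → x (Fin.suc k) ℚ.* (t ^ suc (toℕ k)))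
    ≡⟨ cong (λ y → x Fin.zero ℚ.* (t ℚ.* 1ℚ) ℚ.+ t ℚ.* y) (foldr-horner (x ∘ Fin.suc) t) ⟩
  x Fin.zero ℚ.* (t ℚ.* 1ℚ) ℚ.+ t ℚ.* (t ℚ.* horner (x ∘ Fin.suc) t)
    ≡⟨ collect (x Fin.zero) t (horner (x ∘ Fin.suc) t) ⟩
  t ℚ.* (x Fin.zero ℚ.+ t ℚ.* horner (x ∘ Fin.suc) t) ∎
  where
  open ≡-Reasoning
  foldr-* : ∀ {d} (y z : Vector ℚ d) → (∀ k → y k ≡ t ℚ.* z k) → foldr ℚ._+_ 0ℚ y ≡ t ℚ.* foldr ℚ._+_ 0ℚ z
  foldr-* {zero}  y z eq = sym (ℚₚ.*-zeroʳ t)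
  foldr-* {suc d} y z eq = trans (cong₂ ℚ._+_ (eq Fin.zero) (foldr-* (y ∘ Fin.suc) (z ∘ Fin.suc) (eq ∘ Fin.suc)))
    (sym (ℚₚ.*-distribˡ-+ t (z Fin.zero) _))
  swap : ∀ a b c → a ℚ.* (b ℚ.* c) ≡ b ℚ.* (a ℚ.* c)
  swap = solve 3 (λ a b c → a :* (b :* c) := b :* (a :* c)) refl
    where open ℚSolver.+-*-Solver
  collect : ∀ a t h → a ℚ.* (t ℚ.* 1ℚ) ℚ.+ t ℚ.* (t ℚ.* h) ≡ t ℚ.* (a ℚ.+ t ℚ.* h)
  collect = solve 3 (λ a t h → a :* (t :* con 1ℚ) :+ t :* (t :* h) := t :* (a :+ t :* h)) refl
    where open ℚSolver.+-*-Solver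

horner-cong : ∀ {d} {x y : Vector ℚ d} t → (∀ k → x k ≡ y k) → horner x t ≡ horner y t
horner-cong {zero}  t eq = refl
horner-cong {suc d} t eq = cong₂ (λ a h → a ℚ.+ t ℚ.* h) (eq Fin.zero) (horner-cong t (eq ∘ Fin.suc))

horner-linear : ∀ {d} a (x y : Vector ℚ d) t →
                horner (λ k → x k ℚ.+ a ℚ.* y k) t ≡ horner x t ℚ.+ a ℚ.* horner y t
horner-linear {zero}  a x y t = sym (trans (ℚₚ.+-identityˡ _) (ℚₚ.*-zeroʳ a))
horner-linear {suc d} a x y t = trans
  (cong (λ h → x Fin.zero ℚ.+ a ℚ.* y Fin.zero ℚ.+ t ℚ.* h) (horner-linear a (x ∘ Fin.suc) (y ∘ Fin.suc) t))
  (shuffle (x Fin.zero) a (y Fin.zero) t (horner (x ∘ Fin.suc) t) (horner (y ∘ Fin.suc) t))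
  where
  shuffle : ∀ x a y t h k → x ℚ.+ a ℚ.* y ℚ.+ t ℚ.* (h ℚ.+ a ℚ.* k) ≡ x ℚ.+ t ℚ.* h ℚ.+ a ℚ.* (y ℚ.+ t ℚ.* k)
  shuffle = solve 6 (λ x a y t h k → x :+ a :* y :+ t :* (h :+ a :* k) := x :+ t :* h :+ a :* (y :+ t :* k)) refl
    where open ℚSolver.+-*-Solver

horner-pad : ∀ {d e} → d ≤ e → (x : Vector ℚ d) → ∃[ y ] ∀ t → horner {e} y t ≡ horner x t
horner-pad {e = e} z≤n x = (λ _ → 0ℚ) , zeros e
  where
  zeros : ∀ e t → horner {e} (λ _ → 0ℚ) t ≡ 0ℚ
  zeros zero    t = refl
  zeros (suc e) t = trans (ℚₚ.+-identityˡ _) (trans (cong (t ℚ.*_) (zeros e t)) (ℚₚ.*-zeroʳ t))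
horner-pad {suc d} (s≤s d≤e) x with horner-pad d≤e (x ∘ Fin.suc)
... | y , eq = (x Fin.zero Functional.∷ y) , λ t → cong (λ h → x Fin.zero ℚ.+ t ℚ.* h) (eq t)

eval-pad : ∀ {d e} → d ≤ e → (x : Vector ℚ d) → ∃[ y ] ∀ t → eval {e} y t ≡ eval x t
eval-pad d≤e x = let y , eq = horner-pad d≤e x in
  y , λ t → trans (eval-def y t) (trans (cong (λ h → 1ℚ ℚ.+ t ℚ.* h) (eq t)) (sym (eval-def x t)))

-- The product (1 - a t) (1 + t h) equals 1 + t (h - a (1 + t h)), so the constant term stays 1. As
-- a Horner form, 1 + t h has the coefficients `1ℚ Functional.∷ x`; the coefficients of h are padded
-- with a zero to match.
eval-* : ∀ {d} a (x : Vector ℚ d) → ∃[ y ] ∀ t → eval {suc d} y t ≡ (1ℚ ℚ.- a ℚ.* t) ℚ.* eval x t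
eval-* {d} a x = let x′ , eq = horner-pad (ℕₚ.n≤1+n d) x in
  (λ k → x′ k ℚ.+ ℚ.- a ℚ.* (1ℚ Functional.∷ x) k) , λ t → begin
  eval (λ k → x′ k ℚ.+ ℚ.- a ℚ.* (1ℚ Functional.∷ x) k) t
    ≡⟨ eval-def _ t ⟩
  1ℚ ℚ.+ t ℚ.* horner (λ k → x′ k ℚ.+ ℚ.- a ℚ.* (1ℚ Functional.∷ x) k) t
    ≡⟨ cong (λ h → 1ℚ ℚ.+ t ℚ.* h) (horner-linear (ℚ.- a) x′ (1ℚ Functional.∷ x) t) ⟩
  1ℚ ℚ.+ t ℚ.* (horner x′ t ℚ.+ ℚ.- a ℚ.* (1ℚ ℚ.+ t ℚ.* horner x t))
    ≡⟨ cong (λ h → 1ℚ ℚ.+ t ℚ.* (h ℚ.+ ℚ.- a ℚ.* (1ℚ ℚ.+ t ℚ.* horner x t))) (eq t) ⟩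
  1ℚ ℚ.+ t ℚ.* (horner x t ℚ.+ ℚ.- a ℚ.* (1ℚ ℚ.+ t ℚ.* horner x t))
    ≡⟨ expand a t (horner x t) ⟩
  (1ℚ ℚ.- a ℚ.* t) ℚ.* (1ℚ ℚ.+ t ℚ.* horner x t)
    ≡⟨ cong ((1ℚ ℚ.- a ℚ.* t) ℚ.*_) (sym (eval-def x t)) ⟩
  (1ℚ ℚ.- a ℚ.* t) ℚ.* eval x t ∎
  where
  open ≡-Reasoning
  expand : ∀ a t h → 1ℚ ℚ.+ t ℚ.* (h ℚ.+ ℚ.- a ℚ.* (1ℚ ℚ.+ t ℚ.* h)) ≡ (1ℚ ℚ.- a ℚ.* t) ℚ.* (1ℚ ℚ.+ t ℚ.* h)
  expand = solve 3 (λ a t h → con 1ℚ :+ t :* (h :+ :- a :* (con 1ℚ :+ t :* h))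
    := (con 1ℚ :- a :* t) :* (con 1ℚ :+ t :* h)) refl
    where open ℚSolver.+-*-Solver

-- Finite differences

∂ : (ℕ → ℚ) → ℕ → ℚ
∂ f t = f (suc t) ℚ.- f t

-- The degree is bounded through differences: the `k`-th difference vanishes. In this form `rolle`
-- lowers the degree and the number of alternations together.
data Degree< : ℕ → (ℕ → ℚ) → Set where
  null : ∀ {f} → (∀ t → f t ≡ 0ℚ) → Degree< zero f
  diff : ∀ {k f} → Degree< k (∂ f) → Degree< (suc k) f

degree-cong : ∀ {k f g} → (∀ t → f t ≡ g t) → Degree< k f → Degree< k g
degree-cong eq (null f≡0) = null λ t → trans (sym (eq t)) (f≡0 t)
degree-cong eq (diff deg) = diff (degree-cong (λ t → cong₂ ℚ._-_ (eq (suc t)) (eq t)) deg)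

degree-weaken : ∀ {k f} → Degree< k f → Degree< (suc k) f
degree-weaken (null f≡0) = diff (null λ t → cong₂ ℚ._-_ (f≡0 (suc t)) (f≡0 t))
degree-weaken (diff deg) = diff (degree-weaken deg)

degree-+ : ∀ {k f g} → Degree< k f → Degree< k g → Degree< k (λ t → f t ℚ.+ g t)
degree-+ (null f≡0) (null g≡0) = null λ t → cong₂ ℚ._+_ (f≡0 t) (g≡0 t)
degree-+ {f = f} {g} (diff df) (diff dg) =
  diff (degree-cong (λ t → interchange (f (suc t)) (f t) (g (suc t)) (g t)) (degree-+ df dg))
  where
  interchange : ∀ a b c d → (a ℚ.- b) ℚ.+ (c ℚ.- d) ≡ (a ℚ.+ c) ℚ.- (b ℚ.+ d)
  interchange = solve 4 (λ a b c d → (a :- b) :+ (c :- d) := (a :+ c) :- (b :+ d)) refl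
    where open ℚSolver.+-*-Solver

degree-const : ∀ k a → Degree< (suc k) (λ _ → a)
degree-const zero    a = diff (null λ _ → ℚₚ.+-inverseʳ a)
degree-const (suc k) a = degree-weaken (degree-const k a)

-- By the product rule ∂ (t f) = t ∂ f + f + ∂ f; the first summand is the induction hypothesis for
-- `∂ f`.
degree-* : ∀ {k f} → Degree< k f → Degree< (suc k) (λ t → ⟦ t ⟧ ℚ.* f t)
degree-* (null f≡0) = degree-weaken (null λ t → trans (cong (⟦ t ⟧ ℚ.*_) (f≡0 t)) (ℚₚ.*-zeroʳ ⟦ t ⟧))
degree-* {f = f} (diff df) = diff (degree-cong leibniz (degree-+ (degree-* df) (degree-+ {f = f} (diff df) (degree-weaken df))))
  where
  expand : ∀ t a b → t ℚ.* (a ℚ.- b) ℚ.+ (b ℚ.+ (a ℚ.- b)) ≡ (t ℚ.+ 1ℚ) ℚ.* a ℚ.- t ℚ.* b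
  expand = solve 3 (λ t a b → t :* (a :- b) :+ (b :+ (a :- b)) := (t :+ con 1ℚ) :* a :- t :* b) refl
    where open ℚSolver.+-*-Solver
  leibniz : ∀ t → ⟦ t ⟧ ℚ.* ∂ f t ℚ.+ (f t ℚ.+ ∂ f t) ≡ ⟦ suc t ⟧ ℚ.* f (suc t) ℚ.- ⟦ t ⟧ ℚ.* f t
  leibniz t = trans (expand ⟦ t ⟧ (f (suc t)) (f t)) (cong (λ s → s ℚ.* f (suc t) ℚ.- ⟦ t ⟧ ℚ.* f t) (sym (⟦suc⟧ t)))

degree-horner : ∀ {d} (x : Vector ℚ d) → Degree< d (λ t → horner x ⟦ t ⟧)
degree-horner {zero}  x = null λ _ → refl
degree-horner {suc d} x = degree-+ (degree-const d (x Fin.zero)) (degree-* (degree-horner (x ∘ Fin.suc)))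

degree-eval : ∀ {d} (x : Vector ℚ d) → Degree< (suc d) (λ t → eval x ⟦ t ⟧)
degree-eval {d} x = degree-cong (λ t → sym (eval-def x ⟦ t ⟧)) (degree-+ (degree-const d 1ℚ) (degree-* (degree-horner x)))

-- Signs of values

HasSign : Sign → ℚ → Set
HasSign Sign.+ q = 0ℚ ℚ.< q
HasSign Sign.- q = q ℚ.< 0ℚ

¬HasSign-0 : ∀ s → ¬ HasSign s 0ℚ
¬HasSign-0 Sign.+ = ℚₚ.<-irrefl refl
¬HasSign-0 Sign.- = ℚₚ.<-irrefl refl

hasSign-+⁻ : ∀ s {a b} → HasSign s (a ℚ.+ b) → HasSign s a ⊎ HasSign s b
hasSign-+⁻ Sign.+ {a} {b} 0<a+b with 0ℚ ℚₚ.<? a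
... | yes 0<a = inj₁ 0<a
... | no 0≮a  = inj₂ (ℚₚ.<-≤-trans 0<a+b (subst (a ℚ.+ b ℚ.≤_) (ℚₚ.+-identityˡ b) (ℚₚ.+-monoˡ-≤ b (ℚₚ.≮⇒≥ 0≮a))))
hasSign-+⁻ Sign.- {a} {b} a+b<0 with a ℚₚ.<? 0ℚ
... | yes a<0 = inj₁ a<0
... | no a≮0  = inj₂ (ℚₚ.≤-<-trans (subst (ℚ._≤ a ℚ.+ b) (ℚₚ.+-identityˡ b) (ℚₚ.+-monoˡ-≤ b (ℚₚ.≮⇒≥ a≮0))) a+b<0)

hasSign-difference : ∀ s {a b} → HasSign s a → HasSign (opposite s) b → HasSign (opposite s) (b ℚ.- a)
hasSign-difference Sign.+ 0<a b<0 = ℚₚ.+-mono-< b<0 (ℚₚ.neg-antimono-< 0<a)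
hasSign-difference Sign.- a<0 0<b = ℚₚ.+-mono-< 0<b (ℚₚ.neg-antimono-< a<0)

hasSign-* : ∀ s t {a b} → HasSign s a → HasSign t b → HasSign (s Sign.* t) (a ℚ.* b)
hasSign-* Sign.+ Sign.+ {a} {b} 0<a 0<b = subst (ℚ._< a ℚ.* b) (ℚₚ.*-zeroʳ a) (ℚₚ.*-monoʳ-<-pos a {{ℚ.positive 0<a}} 0<b)
hasSign-* Sign.+ Sign.- {a} {b} 0<a b<0 = subst (a ℚ.* b ℚ.<_) (ℚₚ.*-zeroʳ a) (ℚₚ.*-monoʳ-<-pos a {{ℚ.positive 0<a}} b<0)
hasSign-* Sign.- Sign.+ {a} {b} a<0 0<b = subst (a ℚ.* b ℚ.<_) (ℚₚ.*-zeroʳ a) (ℚₚ.*-monoʳ-<-neg a {{ℚ.negative a<0}} 0<b)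
hasSign-* Sign.- Sign.- {a} {b} a<0 b<0 = subst (ℚ._< a ℚ.* b) (ℚₚ.*-zeroʳ a) (ℚₚ.*-monoʳ-<-neg a {{ℚ.negative a<0}} b<0)

data Alternates (f : ℕ → ℚ) : Sign → ℕ → ℕ → Set where
  done : ∀ {s lo} → Alternates f s lo 0
  step : ∀ {s lo r} i → lo ≤ i → HasSign s (f i) → Alternates f (opposite s) (suc i) r → Alternates f s lo (suc r)

alternates-weaken : ∀ {f s lo lo′ r} → lo′ ≤ lo → Alternates f s lo r → Alternates f s lo′ r
alternates-weaken lo′≤lo done                = done
alternates-weaken lo′≤lo (step i lo≤i hi rest) = step i (ℕₚ.≤-trans lo′≤lo lo≤i) hi rest

-- The total change telescopes into single differences, and a sum of sign `s` has a summand of sign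
-- `s`.
drift : ∀ f s i k → HasSign s (f (suc k + i) ℚ.- f i) → ∃[ j ] i ≤ j × j < suc k + i × HasSign s (∂ f j)
drift f s i zero    h = i , ℕₚ.≤-refl , ℕₚ.≤-refl , h
drift f s i (suc k) h with hasSign-+⁻ s (subst (HasSign s) (telescope (f (2 + k + i)) (f (suc k + i)) (f i)) h)
  where
  telescope : ∀ a b c → a ℚ.- c ≡ (a ℚ.- b) ℚ.+ (b ℚ.- c)
  telescope = solve 3 (λ a b c → a :- c := (a :- b) :+ (b :- c)) refl
    where open ℚSolver.+-*-Solver
... | inj₁ last = suc k + i , ℕₚ.m≤n+m i (suc k) , ℕₚ.≤-refl , last
... | inj₂ earlier with drift f s i k earlier
...   | j , i≤j , j< , hj = j , i≤j , ℕₚ.m≤n⇒m≤1+n j< , hj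

-- Discrete Rolle: between two consecutive arguments the difference takes the later sign.
rolle : ∀ {f s lo r} → Alternates f s lo (suc r) → Alternates (∂ f) (opposite s) lo r
rolle (step i lo≤i hi done) = done
rolle {f} {s} (step i lo≤i hi (step i′ i<i′ hi′ rest))
  with drift f (opposite s) i (i′ ∸ suc i) (subst (λ k → HasSign (opposite s) (f k ℚ.- f i)) (sym i′≡) (hasSign-difference s hi hi′))
  where
  i′≡ : suc (i′ ∸ suc i) + i ≡ i′
  i′≡ = trans (sym (ℕₚ.+-suc _ i)) (ℕₚ.m∸n+n≡m i<i′)
-- Since `j < i′` and the remaining differences are taken from `i′` on, the chosen arguments stay
-- strictly increasing.
... | j , i≤j , j< , hj = step j (ℕₚ.≤-trans lo≤i i≤j) hj
  (alternates-weaken (ℕₚ.≤-trans j< (ℕₚ.≤-reflexive (trans (sym (ℕₚ.+-suc _ i)) (ℕₚ.m∸n+n≡m i<i′))))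
    (rolle (step i′ ℕₚ.≤-refl hi′ rest)))

alternates-≤-degree : ∀ {k f s lo r} → Degree< k f → Alternates f s lo r → r ≤ k
alternates-≤-degree deg done = z≤n
alternates-≤-degree {s = s} (null f≡0) (step i _ hi _) = contradiction (subst (HasSign s) (f≡0 i) hi) (¬HasSign-0 s)
alternates-≤-degree (diff deg) alt@(step _ _ _ _) = s≤s (alternates-≤-degree deg (rolle alt))

-- Each constant block of the word is represented by its last position: a position followed by an
-- equal letter is dropped. So `r` changes give `r + 1` alternating values.
changes-alternate : ∀ {n f} i s (w : Vec Sign n) → HasSign s (f i) →
  (∀ j → HasSign (lookup w j) (f (suc i + toℕ j))) → Alternates f s i (suc (length (changesFrom (suc i) s w)))
changes-alternate i s [] hs _ = step i ℕₚ.≤-refl hs done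
changes-alternate {f = f} i s (t ∷ w) hs hw with s Signₚ.≟ t | changes-alternate {f = f} (suc i) t w
    (subst (HasSign t ∘ f ∘ suc) (ℕₚ.+-identityʳ i) (hw Fin.zero))
    (λ j → subst (HasSign (lookup w j) ∘ f ∘ suc) (ℕₚ.+-suc i (toℕ j)) (hw (Fin.suc j)))
... | yes refl | alt = alternates-weaken (ℕₚ.n≤1+n i) alt
... | no s≢t   | alt = step i ℕₚ.≤-refl hs (subst (λ s → Alternates f s (suc i) _) (sym (≢⇒opposite s≢t)) alt)

-- The augmenting letter `+` is the sign of the value 1 at `t = 0`. It supplies the additional
-- alternation that balances the `suc d` of `degree-eval`.
changes-≤-degree : ∀ {n d} (w : Vec Sign n) (x : Vector ℚ d) →
  (∀ j → HasSign (lookup w j) (eval x ⟦ node j ⟧)) → length (changes w) ≤ d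
changes-≤-degree {d = d} w x hw = subst (λ cs → length cs ≤ d) (sym (changes≡changesFrom w))
  (ℕₚ.≤-pred (alternates-≤-degree (degree-eval x)
    (changes-alternate {f = λ t → eval x ⟦ t ⟧} 0 Sign.+ w (subst (0ℚ ℚ.<_) (sym (eval-0 x)) (ℚₚ.positive⁻¹ 1ℚ)) hw)))

-- The root of 1 - a t lies halfway between i and i + 1.
linear-factor : ∀ i → ∃[ a ] (∀ m → m ≤ i → HasSign Sign.+ (1ℚ ℚ.- a ℚ.* ⟦ m ⟧)) ×
                             (∀ m → suc i ≤ m → HasSign Sign.- (1ℚ ℚ.- a ℚ.* ⟦ m ⟧))
linear-factor i = a , left , right
  where
  q = ⟦ i ⟧ ℚ.+ ½
  0<½ : 0ℚ ℚ.< ½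
  0<½ = ℚₚ.positive⁻¹ ½
  instance
    q-pos : ℚ.Positive q
    q-pos = ℚ.positive (ℚₚ.+-mono-≤-< (0≤⟦⟧ i) 0<½)
    q-nonZero : ℚ.NonZero q
    q-nonZero = ℚₚ.pos⇒nonZero q
    a-pos : ℚ.Positive (1/ q)
    a-pos = ℚₚ.1/pos⇒pos q
  a = 1/ q
  scaled : ∀ m → 1ℚ ℚ.- a ℚ.* ⟦ m ⟧ ≡ a ℚ.* (q ℚ.- ⟦ m ⟧)
  scaled m = trans (cong (ℚ._- a ℚ.* ⟦ m ⟧) (sym (ℚₚ.*-inverseˡ q))) (factor a q ⟦ m ⟧)
    where
    factor : ∀ a q m → a ℚ.* q ℚ.- a ℚ.* m ≡ a ℚ.* (q ℚ.- m)
    factor = solve 3 (λ a q m → a :* q :- a :* m := a :* (q :- m)) refl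
      where open ℚSolver.+-*-Solver
  left : ∀ m → m ≤ i → HasSign Sign.+ (1ℚ ℚ.- a ℚ.* ⟦ m ⟧)
  left m m≤i = subst (HasSign Sign.+) (sym (scaled m)) (hasSign-* Sign.+ Sign.+ (ℚₚ.positive⁻¹ a)
    (subst (ℚ._< q ℚ.- ⟦ m ⟧) (ℚₚ.+-inverseʳ ⟦ m ⟧) (ℚₚ.+-monoˡ-< (ℚ.- ⟦ m ⟧) (subst (ℚ._< q) (ℚₚ.+-identityʳ ⟦ m ⟧) (ℚₚ.+-mono-≤-< (⟦⟧-mono-≤ m≤i) 0<½)))))
  right : ∀ m → suc i ≤ m → HasSign Sign.- (1ℚ ℚ.- a ℚ.* ⟦ m ⟧)
  right m i<m = subst (HasSign Sign.-) (sym (scaled m)) (hasSign-* Sign.+ Sign.- (ℚₚ.positive⁻¹ a)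
    (subst (q ℚ.- ⟦ m ⟧ ℚ.<_) (ℚₚ.+-inverseʳ ⟦ m ⟧) (ℚₚ.+-monoˡ-< (ℚ.- ⟦ m ⟧)
      (ℚₚ.<-≤-trans (subst (q ℚ.<_) (sym (⟦suc⟧ i)) (ℚₚ.+-monoʳ-< ⟦ i ⟧ ½<1)) (⟦⟧-mono-≤ i<m)))))
    where
    ½<1 : ½ ℚ.< 1ℚ
    ½<1 = ℚ.*<* (ℤ.+<+ (s≤s (s≤s z≤n)))

s*opposite[s]≡- : ∀ {s t} → s ≢ t → s Sign.* t ≡ Sign.-
s*opposite[s]≡- {s} s≢t with ≢⇒opposite s≢t
s*opposite[s]≡- {Sign.+} _ | refl = refl
s*opposite[s]≡- {Sign.-} _ | refl = refl

-*[t*u]≡s*u : ∀ {s t} → s ≢ t → ∀ u → Sign.- Sign.* (t Sign.* u) ≡ s Sign.* u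
-*[t*u]≡s*u {s} s≢t u with ≢⇒opposite s≢t
-*[t*u]≡s*u {Sign.+} _ u | refl = Signₚ.opposite-involutive u
-*[t*u]≡s*u {Sign.-} _ u | refl = refl

-- The polynomial is built from the end of the word. What is built so far is positive up to the
-- current node, and a change at `suc i` multiplies it by a factor that flips every sign from there
-- on. Signs are kept relative to the preceding letter `s`, so a flip changes only the reference
-- letter.
realise-from : ∀ {n} i s (w : Vec Sign n) →
  ∃[ x ] (∀ m → m ≤ i → HasSign Sign.+ (eval {length (changesFrom (suc i) s w)} x ⟦ m ⟧)) ×
         (∀ j → HasSign (s Sign.* lookup w j) (eval x ⟦ suc i + toℕ j ⟧))
realise-from i s [] = (λ ()) , (λ m _ → subst (0ℚ ℚ.<_) (sym (trans (eval-def _ ⟦ m ⟧) (trans (cong (1ℚ ℚ.+_) (ℚₚ.*-zeroʳ ⟦ m ⟧)) (ℚₚ.+-identityʳ 1ℚ)))) (ℚₚ.positive⁻¹ 1ℚ)) , λ ()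
realise-from i s (t ∷ w) with s Signₚ.≟ t | realise-from (suc i) t w
... | yes refl | x , below , above = x , (λ m m≤i → below m (ℕₚ.m≤n⇒m≤1+n m≤i)) , λ
  { Fin.zero    → subst₂ (λ u k → HasSign u (eval x ⟦ suc k ⟧)) (sym (Signₚ.s*s≡+ s)) (sym (ℕₚ.+-identityʳ i)) (below (suc i) ℕₚ.≤-refl)
  ; (Fin.suc j) → subst (λ k → HasSign (s Sign.* lookup w j) (eval x ⟦ suc k ⟧)) (sym (ℕₚ.+-suc i (toℕ j))) (above j)
  }
... | no s≢t | x , below , above = let a , left , right = linear-factor i ; y , eq = eval-* a x in y ,
  (λ m m≤i → subst (HasSign Sign.+) (sym (eq ⟦ m ⟧)) (hasSign-* Sign.+ Sign.+ (left m m≤i) (below m (ℕₚ.m≤n⇒m≤1+n m≤i)))) , λ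
  { Fin.zero    → subst₂ (λ u k → HasSign u (eval y ⟦ suc k ⟧)) (sym (s*opposite[s]≡- s≢t)) (sym (ℕₚ.+-identityʳ i))
    (subst (HasSign Sign.-) (sym (eq ⟦ suc i ⟧)) (hasSign-* Sign.- Sign.+ (right (suc i) ℕₚ.≤-refl) (below (suc i) ℕₚ.≤-refl)))
  ; (Fin.suc j) → subst₂ (λ u k → HasSign u (eval y ⟦ suc k ⟧)) (-*[t*u]≡s*u s≢t (lookup w j)) (sym (ℕₚ.+-suc i (toℕ j)))
    (subst (HasSign (Sign.- Sign.* (t Sign.* lookup w j))) (sym (eq ⟦ suc (suc i) + toℕ j ⟧))
      (hasSign-* Sign.- (t Sign.* lookup w j) (right _ (ℕₚ.m≤n⇒m≤1+n (s≤s (ℕₚ.m≤m+n i (toℕ j))))) (above j)))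
  }

realise : ∀ {n d} (w : Vec Sign n) → length (changes w) ≤ d →
          ∃[ x ] ∀ j → HasSign (lookup w j) (eval {d} x ⟦ node j ⟧)
realise {d = d} w ≤d =
  let x , _ , above = realise-from 0 Sign.+ w
      y , eq = eval-pad (subst (λ cs → length cs ≤ d) (changes≡changesFrom w) ≤d) x
  in y , λ j → subst (HasSign (lookup w j)) (sym (eq ⟦ node j ⟧)) (above j)

-- Evaluation is pointwise in the representing sequences

seq-foldr : ∀ {d} (v : Vector ℝ d) m → seq (foldr _+ᵣ_ 0ᵣ v) m ≡ foldr ℚ._+_ 0ℚ (λ k → seq (v k) m)
seq-foldr {zero}  v m = refl
seq-foldr {suc d} v m = cong (seq (v Fin.zero) m ℚ.+_) (seq-foldr (v ∘ Fin.suc) m)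

seq-^ : ∀ t k m → seq (t ^ᵣ k) m ≡ seq t m ^ k
seq-^ t zero    m = refl
seq-^ t (suc k) m = cong (seq t m ℚ.*_) (seq-^ t k m)

foldr-cong : ∀ {d} {v w : Vector ℚ d} → (∀ k → v k ≡ w k) → foldr ℚ._+_ 0ℚ v ≡ foldr ℚ._+_ 0ℚ w
foldr-cong {zero}  eq = refl
foldr-cong {suc d} eq = cong₂ ℚ._+_ (eq Fin.zero) (foldr-cong (eq ∘ Fin.suc))

seq-P : ∀ {d} (x : Point d) t m → seq (P x t) m ≡ eval (λ k → seq (x k) m) (seq t m)
seq-P x t m = begin
  1ℚ ℚ.+ seq (foldr _+ᵣ_ 0ᵣ (λ k → x k *ᵣ (t ^ᵣ suc (toℕ k)))) m
    ≡⟨ cong (1ℚ ℚ.+_) (seq-foldr (λ k → x k *ᵣ (t ^ᵣ suc (toℕ k))) m) ⟩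
  1ℚ ℚ.+ foldr ℚ._+_ 0ℚ (λ k → seq (x k) m ℚ.* seq (t ^ᵣ suc (toℕ k)) m)
    ≡⟨ cong (1ℚ ℚ.+_) (foldr-cong (λ k → cong (seq (x k) m ℚ.*_) (seq-^ t (suc (toℕ k)) m))) ⟩
  1ℚ ℚ.+ foldr ℚ._+_ 0ℚ (λ k → seq (x k) m ℚ.* (seq t m ^ suc (toℕ k)))
    ≡⟨ cong (1ℚ ℚ.+_) (foldr-horner (λ k → seq (x k) m) (seq t m)) ⟩
  1ℚ ℚ.+ seq t m ℚ.* horner (λ k → seq (x k) m) (seq t m)
    ≡⟨ sym (eval-def (λ k → seq (x k) m) (seq t m)) ⟩
  eval (λ k → seq (x k) m) (seq t m) ∎
  where open ≡-Reasoning

-- Rational inequalities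

∣∣≤ : ∀ {p q} → p ℚ.≤ q → ℚ.- p ℚ.≤ q → ∣ p ∣ ℚ.≤ q
∣∣≤ {p} {q} p≤q -p≤q with ℚₚ.∣p∣≡p∨∣p∣≡-p p
... | inj₁ eq = subst (ℚ._≤ q) (sym eq) p≤q
... | inj₂ eq = subst (ℚ._≤ q) (sym eq) -p≤q

≤∣∣ : ∀ p → p ℚ.≤ ∣ p ∣
≤∣∣ p with ℚₚ.≤-total 0ℚ p
... | inj₁ 0≤p = ℚₚ.≤-reflexive (sym (ℚₚ.0≤p⇒∣p∣≡p 0≤p))
... | inj₂ p≤0 = ℚₚ.≤-trans p≤0 (ℚₚ.0≤∣p∣ p)

p-q≤r⇒p≤r+q : ∀ {p q r} → p ℚ.- q ℚ.≤ r → p ℚ.≤ r ℚ.+ q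
p-q≤r⇒p≤r+q {p} {q} {r} le = subst (ℚ._≤ r ℚ.+ q) (cancel p q) (ℚₚ.+-monoˡ-≤ q le)
  where
  cancel : ∀ p q → p ℚ.- q ℚ.+ q ≡ p
  cancel = solve 2 (λ p q → p :- q :+ q := p) refl
    where open ℚSolver.+-*-Solver

p≤r+q⇒p-q≤r : ∀ {p q r} → p ℚ.≤ r ℚ.+ q → p ℚ.- q ℚ.≤ r
p≤r+q⇒p-q≤r {p} {q} {r} le = subst (p ℚ.- q ℚ.≤_) (cancel r q) (ℚₚ.+-monoˡ-≤ (ℚ.- q) le)
  where
  cancel : ∀ r q → r ℚ.+ q ℚ.- q ≡ r
  cancel = solve 2 (λ r q → r :+ q :- q := r) refl
    where open ℚSolver.+-*-Solver

neg-difference : ∀ p q → ℚ.- (p ℚ.- q) ≡ q ℚ.- p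
neg-difference = solve 2 (λ p q → :- (p :- q) := q :- p) refl
  where open ℚSolver.+-*-Solver

+-cancelˡ-≤ : ∀ p {q r} → p ℚ.+ q ℚ.≤ p ℚ.+ r → q ℚ.≤ r
+-cancelˡ-≤ p {q} {r} le = subst₂ ℚ._≤_ (cancel p q) (cancel p r) (ℚₚ.+-monoʳ-≤ (ℚ.- p) le)
  where
  cancel : ∀ p q → ℚ.- p ℚ.+ (p ℚ.+ q) ≡ q
  cancel = solve 2 (λ p q → :- p :+ (p :+ q) := q) refl
    where open ℚSolver.+-*-Solver

*-monoˡ-≤ : ∀ {p q} r → 0ℚ ℚ.≤ r → p ℚ.≤ q → p ℚ.* r ℚ.≤ q ℚ.* r
*-monoˡ-≤ r 0≤r = ℚₚ.*-monoʳ-≤-nonNeg r {{ℚ.nonNegative 0≤r}}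

*-monoʳ-≤ : ∀ {p q} r → 0ℚ ℚ.≤ r → p ℚ.≤ q → r ℚ.* p ℚ.≤ r ℚ.* q
*-monoʳ-≤ r 0≤r = ℚₚ.*-monoˡ-≤-nonNeg r {{ℚ.nonNegative 0≤r}}

0<½ : 0ℚ ℚ.< ½
0<½ = ℚₚ.positive⁻¹ ½

½*-pos : ∀ {ε} → 0ℚ ℚ.< ε → 0ℚ ℚ.< ½ ℚ.* ε
½*-pos = hasSign-* Sign.+ Sign.+ 0<½

½+½ : ∀ ε → ½ ℚ.* ε ℚ.+ ½ ℚ.* ε ≡ ε
½+½ ε = trans (sym (ℚₚ.*-distribʳ-+ ε ½ ½)) (ℚₚ.*-identityˡ ε)

ratio : ∀ B ε → 0ℚ ℚ.< B → 0ℚ ℚ.< ε → ∃[ δ ] 0ℚ ℚ.< δ × B ℚ.* δ ≡ ε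
ratio B ε 0<B 0<ε = (1/ B) ℚ.* ε , hasSign-* Sign.+ Sign.+ (ℚₚ.positive⁻¹ (1/ B) {{ℚₚ.1/pos⇒pos B}}) 0<ε ,
  trans (sym (ℚₚ.*-assoc B (1/ B) ε)) (trans (cong (ℚ._* ε) (ℚₚ.*-inverseʳ B)) (ℚₚ.*-identityˡ ε))
  where instance
    B-pos : ℚ.Positive B
    B-pos = ℚ.positive 0<B
    B-nonZero : ℚ.NonZero B
    B-nonZero = ℚₚ.pos⇒nonZero B

½^-pos : ∀ n → 0ℚ ℚ.< ½ ^ n
½^-pos zero    = ℚₚ.positive⁻¹ 1ℚ
½^-pos (suc n) = ½*-pos (½^-pos n)

½^n*[1+n]≤1 : ∀ n → (½ ^ n) ℚ.* ⟦ suc n ⟧ ℚ.≤ 1ℚ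
½^n*[1+n]≤1 zero    = ℚₚ.≤-reflexive (trans (ℚₚ.*-identityˡ ⟦ 1 ⟧) ⟦1⟧)
½^n*[1+n]≤1 (suc n) = begin
  (½ ^ suc n) ℚ.* ⟦ suc (suc n) ⟧
    ≡⟨ cong ((½ ^ suc n) ℚ.*_) (⟦suc⟧ (suc n)) ⟩
  ½ ℚ.* (½ ^ n) ℚ.* (⟦ suc n ⟧ ℚ.+ 1ℚ)
    ≡⟨ expand ½ (½ ^ n) ⟦ suc n ⟧ ⟩
  ½ ℚ.* ((½ ^ n) ℚ.* ⟦ suc n ⟧) ℚ.+ ½ ℚ.* ((½ ^ n) ℚ.* 1ℚ)
    ≤⟨ ℚₚ.+-mono-≤ (*-monoʳ-≤ ½ (ℚₚ.<⇒≤ 0<½) (½^n*[1+n]≤1 n))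
         (*-monoʳ-≤ ½ (ℚₚ.<⇒≤ 0<½) (ℚₚ.≤-trans (*-monoʳ-≤ (½ ^ n) (ℚₚ.<⇒≤ (½^-pos n)) (subst (ℚ._≤ ⟦ suc n ⟧) ⟦1⟧ (⟦⟧-mono-≤ (s≤s z≤n)))) (½^n*[1+n]≤1 n))) ⟩
  ½ ℚ.* 1ℚ ℚ.+ ½ ℚ.* 1ℚ
    ≡⟨ refl ⟩
  1ℚ ∎
  where
  open ℚₚ.≤-Reasoning
  expand : ∀ h a k → h ℚ.* a ℚ.* (k ℚ.+ 1ℚ) ≡ h ℚ.* (a ℚ.* k) ℚ.+ h ℚ.* (a ℚ.* 1ℚ)
  expand = solve 3 (λ h a k → h :* a :* (k :+ con 1ℚ) := h :* (a :* k) :+ h :* (a :* con 1ℚ)) refl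
    where open ℚSolver.+-*-Solver

1≤ε*denominator : ∀ ε → 0ℚ ℚ.< ε → 1ℚ ℚ.≤ ε ℚ.* ⟦ suc (ℚ.denominator-1 ε) ⟧
1≤ε*denominator ε@(ℚ.mkℚ (ℤ.+ suc p) q-1 _) _ = subst (λ k → 1ℚ ℚ.≤ ε ℚ.* k) (sym (⟦⟧-/1 (suc q-1))) (ℚₚ.toℚᵘ-cancel-≤ (begin
  ℚᵘ.1ℚᵘ
    ≤⟨ ℚᵘ.*≤* (ℤ.+≤+ (ℕₚ.≤-trans (ℕₚ.≤-reflexive (ℕₚ.*-identityˡ (suc q-1 * 1)))
         (ℕₚ.*-monoˡ-≤ 1 (ℕₚ.m≤m+n (suc q-1) (p * suc q-1))))) ⟩
  ℚᵘ.mkℚᵘ (ℤ.+ suc p) q-1 ℚᵘ.* ℚᵘ.mkℚᵘ (ℤ.+ suc q-1) 0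
    ≃⟨ ℚᵘₚ.*-congˡ (ℚᵘₚ.≃-sym (ℚₚ.toℚᵘ-fromℚᵘ (ℚᵘ.mkℚᵘ (ℤ.+ suc q-1) 0))) ⟩
  ℚ.toℚᵘ ε ℚᵘ.* ℚ.toℚᵘ (ℤ.+ suc q-1 ℚ./ 1)
    ≃⟨ ℚᵘₚ.≃-sym (ℚₚ.toℚᵘ-homo-* ε (ℤ.+ suc q-1 ℚ./ 1)) ⟩
  ℚ.toℚᵘ (ε ℚ.* (ℤ.+ suc q-1 ℚ./ 1)) ∎))
  where open ℚᵘₚ.≤-Reasoning
1≤ε*denominator (ℚ.mkℚ (ℤ.+ zero) q-1 _) (ℚ.*<* (ℤ.+<+ ()))
1≤ε*denominator (ℚ.mkℚ (ℤ.-[1+ p ]) q-1 _) (ℚ.*<* ())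

-- With `n + 1` the denominator of `ε`, the reciprocal of `n + 1` is at most `ε`, and `½ ^ n` is at
-- most that reciprocal because 2 to the power n is at least n + 1.
½^-small : ∀ ε → 0ℚ ℚ.< ε → ∃[ n ] ½ ^ n ℚ.≤ ε
½^-small ε 0<ε = n , ℚₚ.*-cancelʳ-≤-pos ⟦ suc n ⟧ {{ℚ.positive (subst (ℚ._< ⟦ suc n ⟧) ⟦0⟧ (⟦⟧-mono-< (s≤s z≤n)))}}
  (ℚₚ.≤-trans (½^n*[1+n]≤1 n) (1≤ε*denominator ε 0<ε))
  where n = ℚ.denominator-1 ε

-- Signs of real numbers

IsSign : Sign → ℝ → Set
IsSign Sign.+ r = 0ᵣ <ᵣ r
IsSign Sign.- r = r <ᵣ 0ᵣ

signed : Sign → ℚ → ℚ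
signed Sign.+ q = q
signed Sign.- q = ℚ.- q

-- Brings the two directions of `IsSign` to one inequality, so that openness and convexity are
-- proved for both signs at once.
Margin : Sign → ℝ → Set
Margin s r = ∃[ ε ] 0ℚ ℚ.< ε × ∃[ N ] ∀ n → N ≤ n → ε ℚ.≤ signed s (seq r n)

isSign⇒margin : ∀ s {r} → IsSign s r → Margin s r
isSign⇒margin Sign.+ {r} (ε , 0<ε , N , h) = ε , 0<ε , N , λ n N≤n → subst (ℚ._≤ seq r n) (ℚₚ.+-identityˡ ε) (h n N≤n)
isSign⇒margin Sign.- {r} (ε , 0<ε , N , h) = ε , 0<ε , N , λ n N≤n →
  subst₂ ℚ._≤_ (cancel (seq r n) ε) (ℚₚ.+-identityʳ (ℚ.- seq r n)) (ℚₚ.+-monoʳ-≤ (ℚ.- seq r n) (h n N≤n))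
  where
  cancel : ∀ p ε → ℚ.- p ℚ.+ (p ℚ.+ ε) ≡ ε
  cancel = solve 2 (λ p ε → :- p :+ (p :+ ε) := ε) refl
    where open ℚSolver.+-*-Solver

margin⇒isSign : ∀ s {r} → Margin s r → IsSign s r
margin⇒isSign Sign.+ {r} (ε , 0<ε , N , h) = ε , 0<ε , N , λ n N≤n → subst (ℚ._≤ seq r n) (sym (ℚₚ.+-identityˡ ε)) (h n N≤n)
margin⇒isSign Sign.- {r} (ε , 0<ε , N , h) = ε , 0<ε , N , λ n N≤n →
  subst (seq r n ℚ.+ ε ℚ.≤_) (ℚₚ.+-inverseʳ (seq r n)) (ℚₚ.+-monoʳ-≤ (seq r n) (h n N≤n))

Eventually : (ℕ → Set) → Set
Eventually Q = ∃[ N ] ∀ n → N ≤ n → Q n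

eventually-all : ∀ {d} {Q : Fin d → ℕ → Set} → (∀ k → Eventually (Q k)) → Eventually (λ n → ∀ k → Q k n)
eventually-all {zero}  ev = 0 , λ _ _ ()
eventually-all {suc d} {Q} ev with ev Fin.zero | eventually-all {Q = Q ∘ Fin.suc} (ev ∘ Fin.suc)
... | N , h | M , g = N ⊔ M , λ n le → λ where
  Fin.zero    → h n (ℕₚ.m⊔n≤o⇒m≤o N M le)
  (Fin.suc k) → g n (ℕₚ.m⊔n≤o⇒n≤o N M le) k

isSign⇒hasSign : ∀ s {r} → IsSign s r → Eventually (λ n → HasSign s (seq r n))
isSign⇒hasSign Sign.+ {r} (ε , 0<ε , N , h) = N , λ n N≤n →
  ℚₚ.<-≤-trans 0<ε (subst (ℚ._≤ seq r n) (ℚₚ.+-identityˡ ε) (h n N≤n))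
isSign⇒hasSign Sign.- {r} (ε , 0<ε , N , h) = N , λ n N≤n →
  ℚₚ.<-≤-trans (subst (ℚ._< seq r n ℚ.+ ε) (ℚₚ.+-identityʳ _) (ℚₚ.+-monoʳ-< (seq r n) 0<ε)) (h n N≤n)

hasSign-unique : ∀ {s t q} → HasSign s q → HasSign t q → s ≡ t
hasSign-unique {Sign.+} {Sign.+} _   _   = refl
hasSign-unique {Sign.+} {Sign.-} 0<q q<0 = contradiction q<0 (ℚₚ.<-asym 0<q)
hasSign-unique {Sign.-} {Sign.+} q<0 0<q = contradiction 0<q (ℚₚ.<-asym q<0)
hasSign-unique {Sign.-} {Sign.-} _   _   = refl

isSign-unique : ∀ {s t r} → IsSign s r → IsSign t r → s ≡ t
isSign-unique {s} {t} {r} hs ht with isSign⇒hasSign s {r} hs | isSign⇒hasSign t {r} ht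
... | N , h | M , g = hasSign-unique {q = seq r (N ⊔ M)} (h _ (ℕₚ.m≤m⊔n N M)) (g _ (ℕₚ.m≤n⊔m N M))

sgn-isSign : ∀ r (r#0 : r # 0ᵣ) → IsSign (sgn r r#0) r
sgn-isSign r (inj₁ r<0) = r<0
sgn-isSign r (inj₂ 0<r) = 0<r

-- Cells and their openness

opaque

  Side : ∀ {d} → Sign → ℕ → Pred (Point d) 0ℓ
  Side s i x = IsSign s (P x (fromℕ i))

  side⇒isSign : ∀ {d} s i (x : Point d) → Side s i x → IsSign s (P x (fromℕ i))
  side⇒isSign s i x h = h

  isSign⇒side : ∀ {d} s i (x : Point d) → IsSign s (P x (fromℕ i)) → Side s i x
  isSign⇒side s i x h = h

side-unique : ∀ {d s t} i (x : Point d) → Side s i x → Side t i x → s ≡ t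
side-unique {s = s} {t} i x hs ht = isSign-unique {s} {t} {P x (fromℕ i)} (side⇒isSign s i x hs) (side⇒isSign t i x ht)

side⇒apart : ∀ {d} s i (x : Point d) → Side s i x → P x (fromℕ i) # 0ᵣ
side⇒apart Sign.+ i x h = inj₂ (side⇒isSign Sign.+ i x h)
side⇒apart Sign.- i x h = inj₁ (side⇒isSign Sign.- i x h)

apart⇒side : ∀ {d} s i (x : Point d) → P x (fromℕ i) # 0ᵣ → Side s i x ⊎ Side (opposite s) i x
apart⇒side Sign.+ i x (inj₁ P<0) = inj₂ (isSign⇒side Sign.- i x P<0)
apart⇒side Sign.+ i x (inj₂ 0<P) = inj₁ (isSign⇒side Sign.+ i x 0<P)
apart⇒side Sign.- i x (inj₁ P<0) = inj₁ (isSign⇒side Sign.- i x P<0)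
apart⇒side Sign.- i x (inj₂ 0<P) = inj₂ (isSign⇒side Sign.+ i x 0<P)

Cell : ∀ {d n} → Vec Sign n → Pred (Point d) 0ℓ
Cell w x = ∀ j → Side (lookup w j) (node j) x

value : ∀ {d} → Point d → ℕ → ℕ → ℚ
value x i m = eval (λ k → seq (x k) m) ⟦ i ⟧

seq-P-value : ∀ {d} (x : Point d) i m → seq (P x (fromℕ i)) m ≡ value x i m
seq-P-value x i m = trans (seq-P x (fromℕ i) m) (cong (eval _) (sym (⟦⟧-/1 i)))

-- This is 1 + t + ⋯ + t^(d-1), a Lipschitz constant of `horner` at `t ≥ 0` with respect to the sup
-- norm of the coefficients.
sensitivity : ℕ → ℚ → ℚ
sensitivity zero    t = 0ℚ
sensitivity (suc d) t = 1ℚ ℚ.+ t ℚ.* sensitivity d t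

0≤sensitivity : ∀ d {t} → 0ℚ ℚ.≤ t → 0ℚ ℚ.≤ sensitivity d t
0≤sensitivity zero    0≤t = ℚₚ.≤-refl
0≤sensitivity (suc d) {t} 0≤t = ℚₚ.+-mono-≤ {0ℚ} {1ℚ} {0ℚ} (ℚₚ.<⇒≤ (ℚₚ.positive⁻¹ 1ℚ))
  (subst (ℚ._≤ t ℚ.* sensitivity d t) (ℚₚ.*-zeroʳ t) (*-monoʳ-≤ t 0≤t (0≤sensitivity d 0≤t)))

horner-sensitivity : ∀ {d} (x y : Vector ℚ d) {t δ} → 0ℚ ℚ.≤ t → (∀ k → ∣ x k ℚ.- y k ∣ ℚ.≤ δ) →
                     ∣ horner x t ℚ.- horner y t ∣ ℚ.≤ δ ℚ.* sensitivity d t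
horner-sensitivity {zero}  x y {δ = δ} 0≤t close = ℚₚ.≤-reflexive (sym (ℚₚ.*-zeroʳ δ))
horner-sensitivity {suc d} x y {t} {δ} 0≤t close = begin
  ∣ (x₀ ℚ.+ t ℚ.* h) ℚ.- (y₀ ℚ.+ t ℚ.* k) ∣          ≡⟨ cong ∣_∣ (regroup x₀ t h y₀ k) ⟩
  ∣ (x₀ ℚ.- y₀) ℚ.+ t ℚ.* (h ℚ.- k) ∣                ≤⟨ ℚₚ.∣p+q∣≤∣p∣+∣q∣ (x₀ ℚ.- y₀) (t ℚ.* (h ℚ.- k)) ⟩
  ∣ x₀ ℚ.- y₀ ∣ ℚ.+ ∣ t ℚ.* (h ℚ.- k) ∣              ≡⟨ cong (∣ x₀ ℚ.- y₀ ∣ ℚ.+_) (trans (ℚₚ.∣p*q∣≡∣p∣*∣q∣ t (h ℚ.- k)) (cong (ℚ._* ∣ h ℚ.- k ∣) (ℚₚ.0≤p⇒∣p∣≡p 0≤t))) ⟩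
  ∣ x₀ ℚ.- y₀ ∣ ℚ.+ t ℚ.* ∣ h ℚ.- k ∣                ≤⟨ ℚₚ.+-mono-≤ (close Fin.zero) (*-monoʳ-≤ t 0≤t (horner-sensitivity (x ∘ Fin.suc) (y ∘ Fin.suc) 0≤t (close ∘ Fin.suc))) ⟩
  δ ℚ.+ t ℚ.* (δ ℚ.* sensitivity d t)                ≡⟨ factor δ t (sensitivity d t) ⟩
  δ ℚ.* (1ℚ ℚ.+ t ℚ.* sensitivity d t)               ∎
  where
  open ℚₚ.≤-Reasoning
  x₀ = x Fin.zero
  y₀ = y Fin.zero
  h = horner (x ∘ Fin.suc) t
  k = horner (y ∘ Fin.suc) t
  regroup : ∀ a t h b k → (a ℚ.+ t ℚ.* h) ℚ.- (b ℚ.+ t ℚ.* k) ≡ (a ℚ.- b) ℚ.+ t ℚ.* (h ℚ.- k)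
  regroup = solve 5 (λ a t h b k → (a :+ t :* h) :- (b :+ t :* k) := (a :- b) :+ t :* (h :- k)) refl
    where open ℚSolver.+-*-Solver
  factor : ∀ δ t s → δ ℚ.+ t ℚ.* (δ ℚ.* s) ≡ δ ℚ.* (1ℚ ℚ.+ t ℚ.* s)
  factor = solve 3 (λ δ t s → δ :+ t :* (δ :* s) := δ :* (con 1ℚ :+ t :* s)) refl
    where open ℚSolver.+-*-Solver

eval-sensitivity : ∀ {d} (x y : Vector ℚ d) {t δ} → 0ℚ ℚ.≤ t → (∀ k → ∣ x k ℚ.- y k ∣ ℚ.≤ δ) →
                   ∣ eval x t ℚ.- eval y t ∣ ℚ.≤ t ℚ.* (δ ℚ.* sensitivity d t)
eval-sensitivity {d} x y {t} {δ} 0≤t close = begin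
  ∣ eval x t ℚ.- eval y t ∣                                        ≡⟨ cong₂ (λ p q → ∣ p ℚ.- q ∣) (eval-def x t) (eval-def y t) ⟩
  ∣ (1ℚ ℚ.+ t ℚ.* horner x t) ℚ.- (1ℚ ℚ.+ t ℚ.* horner y t) ∣      ≡⟨ cong ∣_∣ (regroup t (horner x t) (horner y t)) ⟩
  ∣ t ℚ.* (horner x t ℚ.- horner y t) ∣                            ≡⟨ trans (ℚₚ.∣p*q∣≡∣p∣*∣q∣ t _) (cong (ℚ._* ∣ horner x t ℚ.- horner y t ∣) (ℚₚ.0≤p⇒∣p∣≡p 0≤t)) ⟩
  t ℚ.* ∣ horner x t ℚ.- horner y t ∣                              ≤⟨ *-monoʳ-≤ t 0≤t (horner-sensitivity x y 0≤t close) ⟩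
  t ℚ.* (δ ℚ.* sensitivity d t)                                    ∎
  where
  open ℚₚ.≤-Reasoning
  regroup : ∀ t h k → (1ℚ ℚ.+ t ℚ.* h) ℚ.- (1ℚ ℚ.+ t ℚ.* k) ≡ t ℚ.* (h ℚ.- k)
  regroup = solve 3 (λ t h k → (con 1ℚ :+ t :* h) :- (con 1ℚ :+ t :* k) := t :* (h :- k)) refl
    where open ℚSolver.+-*-Solver

signed-difference : ∀ s p q → signed s p ℚ.- signed s q ℚ.≤ ∣ p ℚ.- q ∣
signed-difference Sign.+ p q = ≤∣∣ (p ℚ.- q)
signed-difference Sign.- p q = subst₂ ℚ._≤_ (flip p q) (ℚₚ.∣-p∣≡∣p∣ (p ℚ.- q)) (≤∣∣ (ℚ.- (p ℚ.- q)))
  where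
  flip : ∀ p q → ℚ.- (p ℚ.- q) ≡ ℚ.- p ℚ.- ℚ.- q
  flip = solve 2 (λ p q → :- (p :- q) := :- p :- :- q) refl
    where open ℚSolver.+-*-Solver

near⇒close : ∀ {d δ} {x y : Point d} → Near δ x y → Eventually (λ n → ∀ k → ∣ seq (x k) n ℚ.- seq (y k) n ∣ ℚ.≤ δ)
near⇒close {δ = δ} {x} {y} near = eventually-all λ k → close k (near k)
  where
  below : ∀ p q {ε} → 0ℚ ℚ.< ε → p ℚ.+ ε ℚ.≤ q ℚ.+ δ → p ℚ.- q ℚ.≤ δ
  below p q {ε} 0<ε le = p≤r+q⇒p-q≤r (ℚₚ.≤-trans
    (subst (ℚ._≤ p ℚ.+ ε) (ℚₚ.+-identityʳ p) (ℚₚ.+-monoʳ-≤ p (ℚₚ.<⇒≤ 0<ε)))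
    (ℚₚ.≤-trans le (ℚₚ.≤-reflexive (ℚₚ.+-comm q δ))))
  close : ∀ k → _ → Eventually (λ n → ∣ seq (x k) n ℚ.- seq (y k) n ∣ ℚ.≤ δ)
  close k ((ε , 0<ε , N , h) , (η , 0<η , M , g)) = N ⊔ M , λ n le → ∣∣≤
    (below (seq (x k) n) (seq (y k) n) 0<ε (h n (ℕₚ.m⊔n≤o⇒m≤o N M le)))
    (subst (ℚ._≤ δ) (sym (neg-difference (seq (x k) n) (seq (y k) n))) (below (seq (y k) n) (seq (x k) n) 0<η (g n (ℕₚ.m⊔n≤o⇒n≤o N M le))))

-- Half of the margin at `x` pays for the move to `y`; the other half remains.
margin-stays : ∀ {d} s i {ε δ} (x y : Point d) → ⟦ i ⟧ ℚ.* (δ ℚ.* sensitivity d ⟦ i ⟧) ℚ.≤ ½ ℚ.* ε →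
  Eventually (λ n → ∀ k → ∣ seq (x k) n ℚ.- seq (y k) n ∣ ℚ.≤ δ) →
  Eventually (λ n → ε ℚ.≤ signed s (seq (P x (fromℕ i)) n)) →
  Eventually (λ n → ½ ℚ.* ε ℚ.≤ signed s (seq (P y (fromℕ i)) n))
margin-stays {d} s i {ε} {δ} x y tiny (M , close) (N , wide) = N ⊔ M , λ n le →
  stays n (wide n (ℕₚ.m⊔n≤o⇒m≤o N M le)) (close n (ℕₚ.m⊔n≤o⇒n≤o N M le))
  where
  open ℚₚ.≤-Reasoning
  difference : ∀ n → (∀ k → ∣ seq (x k) n ℚ.- seq (y k) n ∣ ℚ.≤ δ) →
               ∣ seq (P x (fromℕ i)) n ℚ.- seq (P y (fromℕ i)) n ∣ ℚ.≤ ½ ℚ.* ε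
  difference n close = begin
    ∣ seq (P x (fromℕ i)) n ℚ.- seq (P y (fromℕ i)) n ∣   ≡⟨ cong₂ (λ p q → ∣ p ℚ.- q ∣) (seq-P-value x i n) (seq-P-value y i n) ⟩
    ∣ value x i n ℚ.- value y i n ∣                       ≤⟨ eval-sensitivity (λ k → seq (x k) n) (λ k → seq (y k) n) (0≤⟦⟧ i) close ⟩
    ⟦ i ⟧ ℚ.* (δ ℚ.* sensitivity d ⟦ i ⟧)                 ≤⟨ tiny ⟩
    ½ ℚ.* ε                                               ∎
  stays : ∀ n → ε ℚ.≤ signed s (seq (P x (fromℕ i)) n) → (∀ k → ∣ seq (x k) n ℚ.- seq (y k) n ∣ ℚ.≤ δ) →
          ½ ℚ.* ε ℚ.≤ signed s (seq (P y (fromℕ i)) n)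
  stays n wide close = +-cancelˡ-≤ (½ ℚ.* ε) (begin
    ½ ℚ.* ε ℚ.+ ½ ℚ.* ε                                  ≡⟨ ½+½ ε ⟩
    ε                                                    ≤⟨ wide ⟩
    signed s (seq (P x (fromℕ i)) n)                     ≤⟨ p-q≤r⇒p≤r+q (ℚₚ.≤-trans (signed-difference s _ _) (difference n close)) ⟩
    ½ ℚ.* ε ℚ.+ signed s (seq (P y (fromℕ i)) n)         ∎)

radius : ∀ C {ε} → 0ℚ ℚ.≤ C → 0ℚ ℚ.< ε → ∃[ δ ] 0ℚ ℚ.< δ × C ℚ.* δ ℚ.≤ ε
-- The divisor is `C + 1` because `C` may be zero.
radius C {ε} 0≤C 0<ε = shrink (ratio (C ℚ.+ 1ℚ) ε (ℚₚ.+-mono-≤-< 0≤C (ℚₚ.positive⁻¹ 1ℚ)) 0<ε)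
  where
  shrink : (∃[ δ ] 0ℚ ℚ.< δ × (C ℚ.+ 1ℚ) ℚ.* δ ≡ ε) → ∃[ δ ] 0ℚ ℚ.< δ × C ℚ.* δ ℚ.≤ ε
  shrink (δ , 0<δ , eq) = δ , 0<δ , ℚₚ.≤-trans
    (*-monoˡ-≤ δ (ℚₚ.<⇒≤ 0<δ) (subst (ℚ._≤ C ℚ.+ 1ℚ) (ℚₚ.+-identityʳ C) (ℚₚ.+-monoʳ-≤ C (ℚₚ.<⇒≤ (ℚₚ.positive⁻¹ 1ℚ)))))
    (ℚₚ.≤-reflexive eq)

side-open : ∀ {d} s i → Open (Side {d} s i)
side-open {d} s i x x∈ = around (isSign⇒margin s {P x (fromℕ i)} (side⇒isSign s i x x∈))
  where
  C = ⟦ i ⟧ ℚ.* sensitivity d ⟦ i ⟧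
  0≤C : 0ℚ ℚ.≤ C
  0≤C = subst (ℚ._≤ C) (ℚₚ.*-zeroʳ ⟦ i ⟧) (*-monoʳ-≤ ⟦ i ⟧ (0≤⟦⟧ i) (0≤sensitivity d (0≤⟦⟧ i)))
  regroup : ∀ i δ s → i ℚ.* (δ ℚ.* s) ≡ i ℚ.* s ℚ.* δ
  regroup = solve 3 (λ i δ s → i :* (δ :* s) := i :* s :* δ) refl
    where open ℚSolver.+-*-Solver
  ball : ∀ {ε} → 0ℚ ℚ.< ε → Eventually (λ n → ε ℚ.≤ signed s (seq (P x (fromℕ i)) n)) →
         (∃[ δ ] 0ℚ ℚ.< δ × C ℚ.* δ ℚ.≤ ½ ℚ.* ε) → ∃[ δ ] 0ℚ ℚ.< δ × (∀ y → Near δ x y → y ∈ Side s i)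
  ball {ε} 0<ε wide (δ , 0<δ , Cδ≤) = δ , 0<δ , λ y near → isSign⇒side s i y (margin⇒isSign s
    (½ ℚ.* ε , ½*-pos 0<ε , margin-stays s i {ε} {δ} x y
      (subst (ℚ._≤ ½ ℚ.* ε) (sym (regroup ⟦ i ⟧ δ (sensitivity d ⟦ i ⟧))) Cδ≤) (near⇒close {x = x} {y} near) wide))
  around : Margin s (P x (fromℕ i)) → ∃[ δ ] 0ℚ ℚ.< δ × (∀ y → Near δ x y → y ∈ Side s i)
  around (ε , 0<ε , wide) = ball 0<ε wide (radius C 0≤C (½*-pos 0<ε))

-- Segments

opaque

  affine : ∀ {d} → Point d → Point d → ℝ → Point d
  affine x y t k = x k +ᵣ t *ᵣ (y k +ᵣ fromℚ (ℚ.- 1ℚ) *ᵣ x k)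

  seq-affine : ∀ {d} (x y : Point d) t k m →
    seq (affine x y t k) m ≡ seq (x k) m ℚ.+ seq t m ℚ.* (seq (y k) m ℚ.+ ℚ.- 1ℚ ℚ.* seq (x k) m)
  seq-affine x y t k m = refl

value-affine : ∀ {d} (x y : Point d) t i m →
  value (affine x y t) i m ≡ (1ℚ ℚ.- seq t m) ℚ.* value x i m ℚ.+ seq t m ℚ.* value y i m
value-affine x y t i m = begin
  value (affine x y t) i m
    ≡⟨ eval-def (λ k → seq (affine x y t k) m) ⟦ i ⟧ ⟩
  1ℚ ℚ.+ ⟦ i ⟧ ℚ.* horner (λ k → seq (affine x y t k) m) ⟦ i ⟧
    ≡⟨ cong (λ h → 1ℚ ℚ.+ ⟦ i ⟧ ℚ.* h) (horner-cong ⟦ i ⟧ (λ k → seq-affine x y t k m)) ⟩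
  1ℚ ℚ.+ ⟦ i ⟧ ℚ.* horner (λ k → xs k ℚ.+ seq t m ℚ.* (ys k ℚ.+ ℚ.- 1ℚ ℚ.* xs k)) ⟦ i ⟧
    ≡⟨ cong (λ h → 1ℚ ℚ.+ ⟦ i ⟧ ℚ.* h) (trans (horner-linear (seq t m) xs (λ k → ys k ℚ.+ ℚ.- 1ℚ ℚ.* xs k) ⟦ i ⟧)
         (cong (λ h → horner xs ⟦ i ⟧ ℚ.+ seq t m ℚ.* h) (horner-linear (ℚ.- 1ℚ) ys xs ⟦ i ⟧))) ⟩
  1ℚ ℚ.+ ⟦ i ⟧ ℚ.* (horner xs ⟦ i ⟧ ℚ.+ seq t m ℚ.* (horner ys ⟦ i ⟧ ℚ.+ ℚ.- 1ℚ ℚ.* horner xs ⟦ i ⟧))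
    ≡⟨ combine ⟦ i ⟧ (seq t m) (horner xs ⟦ i ⟧) (horner ys ⟦ i ⟧) ⟩
  (1ℚ ℚ.- seq t m) ℚ.* (1ℚ ℚ.+ ⟦ i ⟧ ℚ.* horner xs ⟦ i ⟧) ℚ.+ seq t m ℚ.* (1ℚ ℚ.+ ⟦ i ⟧ ℚ.* horner ys ⟦ i ⟧)
    ≡⟨ sym (cong₂ (λ p q → (1ℚ ℚ.- seq t m) ℚ.* p ℚ.+ seq t m ℚ.* q) (eval-def xs ⟦ i ⟧) (eval-def ys ⟦ i ⟧)) ⟩
  (1ℚ ℚ.- seq t m) ℚ.* value x i m ℚ.+ seq t m ℚ.* value y i m ∎
  where
  open ≡-Reasoning
  xs = λ k → seq (x k) m
  ys = λ k → seq (y k) m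
  combine : ∀ i t h k → 1ℚ ℚ.+ i ℚ.* (h ℚ.+ t ℚ.* (k ℚ.+ ℚ.- 1ℚ ℚ.* h)) ≡
                        (1ℚ ℚ.- t) ℚ.* (1ℚ ℚ.+ i ℚ.* h) ℚ.+ t ℚ.* (1ℚ ℚ.+ i ℚ.* k)
  combine = solve 4 (λ i t h k → con 1ℚ :+ i :* (h :+ t :* (k :+ :- con 1ℚ :* h)) :=
                        (con 1ℚ :- t) :* (con 1ℚ :+ i :* h) :+ t :* (con 1ℚ :+ i :* k)) refl
    where open ℚSolver.+-*-Solver

signed-combination : ∀ s t p q → signed s ((1ℚ ℚ.- t) ℚ.* p ℚ.+ t ℚ.* q) ≡ (1ℚ ℚ.- t) ℚ.* signed s p ℚ.+ t ℚ.* signed s q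
signed-combination Sign.+ t p q = refl
signed-combination Sign.- = solve 3 (λ t p q → :- ((con 1ℚ :- t) :* p :+ t :* q) := (con 1ℚ :- t) :* :- p :+ t :* :- q) refl
  where open ℚSolver.+-*-Solver

≤-combination : ∀ {ε t p q} → 0ℚ ℚ.≤ t → t ℚ.≤ 1ℚ → ε ℚ.≤ p → ε ℚ.≤ q → ε ℚ.≤ (1ℚ ℚ.- t) ℚ.* p ℚ.+ t ℚ.* q
≤-combination {ε} {t} {p} {q} 0≤t t≤1 ε≤p ε≤q = begin
  ε                                  ≡⟨ split-ε ε t ⟩
  (1ℚ ℚ.- t) ℚ.* ε ℚ.+ t ℚ.* ε       ≤⟨ ℚₚ.+-mono-≤ (*-monoʳ-≤ (1ℚ ℚ.- t) 0≤1-t ε≤p) (*-monoʳ-≤ t 0≤t ε≤q) ⟩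
  (1ℚ ℚ.- t) ℚ.* p ℚ.+ t ℚ.* q       ∎
  where
  open ℚₚ.≤-Reasoning
  0≤1-t : 0ℚ ℚ.≤ 1ℚ ℚ.- t
  0≤1-t = subst (ℚ._≤ 1ℚ ℚ.- t) (ℚₚ.+-inverseʳ t) (ℚₚ.+-monoˡ-≤ (ℚ.- t) t≤1)
  split-ε : ∀ ε t → ε ≡ (1ℚ ℚ.- t) ℚ.* ε ℚ.+ t ℚ.* ε
  split-ε = solve 2 (λ ε t → ε := (con 1ℚ :- t) :* ε :+ t :* ε) refl
    where open ℚSolver.+-*-Solver

⊓-pos : ∀ ε η → 0ℚ ℚ.< ε → 0ℚ ℚ.< η → 0ℚ ℚ.< ε ℚ.⊓ η
⊓-pos ε η 0<ε 0<η with ℚₚ.⊓-sel ε η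
... | inj₁ eq = subst (0ℚ ℚ.<_) (sym eq) 0<ε
... | inj₂ eq = subst (0ℚ ℚ.<_) (sym eq) 0<η

-- The parameter is a real number whose representing sequence lies in [0,1] term by term. Rational
-- midpoints and the limit of the bisection are of this kind, and the inequality for a combination
-- can then be checked at each index.
Convex : ∀ {d} → Pred (Point d) 0ℓ → Set
Convex S = ∀ x y t → (∀ m → 0ℚ ℚ.≤ seq t m) → (∀ m → seq t m ℚ.≤ 1ℚ) → x ∈ S → y ∈ S → affine x y t ∈ S

side-convex : ∀ {d} s i → Convex (Side {d} s i)
side-convex s i x y t 0≤t t≤1 x∈ y∈ = isSign⇒side s i (affine x y t) (margin⇒isSign s (between
  (isSign⇒margin s {P x (fromℕ i)} (side⇒isSign s i x x∈))
  (isSign⇒margin s {P y (fromℕ i)} (side⇒isSign s i y y∈))))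
  where
  open ℚₚ.≤-Reasoning
  combination : ∀ m → signed s (seq (P (affine x y t) (fromℕ i)) m) ≡
    (1ℚ ℚ.- seq t m) ℚ.* signed s (seq (P x (fromℕ i)) m) ℚ.+ seq t m ℚ.* signed s (seq (P y (fromℕ i)) m)
  combination m = begin-equality
    signed s (seq (P (affine x y t) (fromℕ i)) m)
      ≡⟨ cong (signed s) (trans (seq-P-value (affine x y t) i m) (value-affine x y t i m)) ⟩
    signed s ((1ℚ ℚ.- seq t m) ℚ.* value x i m ℚ.+ seq t m ℚ.* value y i m)
      ≡⟨ signed-combination s (seq t m) (value x i m) (value y i m) ⟩
    (1ℚ ℚ.- seq t m) ℚ.* signed s (value x i m) ℚ.+ seq t m ℚ.* signed s (value y i m)
      ≡⟨ sym (cong₂ (λ p q → (1ℚ ℚ.- seq t m) ℚ.* signed s p ℚ.+ seq t m ℚ.* signed s q) (seq-P-value x i m) (seq-P-value y i m)) ⟩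
    (1ℚ ℚ.- seq t m) ℚ.* signed s (seq (P x (fromℕ i)) m) ℚ.+ seq t m ℚ.* signed s (seq (P y (fromℕ i)) m) ∎
  between : Margin s (P x (fromℕ i)) → Margin s (P y (fromℕ i)) → Margin s (P (affine x y t) (fromℕ i))
  between (ε , 0<ε , N , h) (η , 0<η , M , g) = ε ℚ.⊓ η , ⊓-pos ε η 0<ε 0<η , N ⊔ M , λ m le →
    subst (ε ℚ.⊓ η ℚ.≤_) (sym (combination m)) (≤-combination (0≤t m) (t≤1 m)
      (ℚₚ.≤-trans (ℚₚ.p⊓q≤p ε η) (h m (ℕₚ.m⊔n≤o⇒m≤o N M le)))
      (ℚₚ.≤-trans (ℚₚ.p⊓q≤q ε η) (g m (ℕₚ.m⊔n≤o⇒n≤o N M le))))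

cell-convex : ∀ {d n} (w : Vec Sign n) → Convex (Cell {d} w)
cell-convex w x y t 0≤t t≤1 x∈ y∈ j = side-convex (lookup w j) (node j) x y t 0≤t t≤1 (x∈ j) (y∈ j)

-- Convex sets are connected, by bisection

-- A point with the same sequences lies in every ball around the original. This is used for the ends
-- of a segment, where `affine` at 0 and 1 yields `x` and `y` only after rational arithmetic.
open-resp : ∀ {d} {U : Pred (Point d) 0ℓ} → Open U → ∀ {x z} → (∀ k m → seq (z k) m ≡ seq (x k) m) → x ∈ U → z ∈ U
open-resp U-open {x} {z} eq x∈U = let ε , 0<ε , ball = U-open x x∈U in ball z λ k →
    (ε , 0<ε , 0 , λ n _ → ℚₚ.≤-reflexive (cong (ℚ._+ ε) (sym (eq k n))))
  , (ε , 0<ε , 0 , λ n _ → ℚₚ.≤-reflexive (cong (ℚ._+ ε) (eq k n)))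

bounded : ∀ r → ∃[ B ] 0ℚ ℚ.≤ B × Eventually (λ n → ∣ seq r n ∣ ℚ.≤ B)
bounded r = from (cauchy r 1ℚ (ℚₚ.positive⁻¹ 1ℚ))
  where
  from : (∃[ N ] ∀ m n → N ≤ m → N ≤ n → ∣ seq r m ℚ.- seq r n ∣ ℚ.< 1ℚ) → ∃[ B ] 0ℚ ℚ.≤ B × Eventually (λ n → ∣ seq r n ∣ ℚ.≤ B)
  from (N , near) = 1ℚ ℚ.+ ∣ seq r N ∣ , ℚₚ.+-mono-≤ {0ℚ} {1ℚ} {0ℚ} (ℚₚ.<⇒≤ (ℚₚ.positive⁻¹ 1ℚ)) (ℚₚ.0≤∣p∣ (seq r N)) , N , λ n N≤n →
    (begin
      ∣ seq r n ∣                                      ≡⟨ cong ∣_∣ (insert (seq r n) (seq r N)) ⟩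
      ∣ (seq r n ℚ.- seq r N) ℚ.+ seq r N ∣            ≤⟨ ℚₚ.∣p+q∣≤∣p∣+∣q∣ (seq r n ℚ.- seq r N) (seq r N) ⟩
      ∣ seq r n ℚ.- seq r N ∣ ℚ.+ ∣ seq r N ∣          ≤⟨ ℚₚ.+-monoˡ-≤ ∣ seq r N ∣ (ℚₚ.<⇒≤ (near n N N≤n ℕₚ.≤-refl)) ⟩
      1ℚ ℚ.+ ∣ seq r N ∣                               ∎)
    where
    open ℚₚ.≤-Reasoning
    insert : ∀ p q → p ≡ (p ℚ.- q) ℚ.+ q
    insert = solve 2 (λ p q → p := (p :- q) :+ q) refl
      where open ℚSolver.+-*-Solver

jointly-bounded : ∀ {d} (v : Vector ℝ d) → ∃[ B ] 0ℚ ℚ.≤ B × (∀ k → Eventually (λ n → ∣ seq (v k) n ∣ ℚ.≤ B))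
jointly-bounded {zero}  v = 0ℚ , ℚₚ.≤-refl , λ ()
jointly-bounded {suc d} v = join (bounded (v Fin.zero)) (jointly-bounded (v ∘ Fin.suc))
  where
  join : _ → _ → ∃[ B ] 0ℚ ℚ.≤ B × (∀ k → Eventually (λ n → ∣ seq (v k) n ∣ ℚ.≤ B))
  join (B , 0≤B , N , h) (C , 0≤C , g) = B ℚ.+ C , ℚₚ.+-mono-≤ {0ℚ} {B} {0ℚ} 0≤B 0≤C , λ where
    Fin.zero    → N , λ n N≤n → ℚₚ.≤-trans (h n N≤n) (subst (ℚ._≤ B ℚ.+ C) (ℚₚ.+-identityʳ B) (ℚₚ.+-monoʳ-≤ B 0≤C))
    (Fin.suc k) → let M , gk = g k in
      M , λ n M≤n → ℚₚ.≤-trans (gk n M≤n) (subst (ℚ._≤ B ℚ.+ C) (ℚₚ.+-identityˡ C) (ℚₚ.+-monoˡ-≤ C 0≤B))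

p≤p+q : ∀ p {q} → 0ℚ ℚ.≤ q → p ℚ.≤ p ℚ.+ q
p≤p+q p {q} 0≤q = subst (ℚ._≤ p ℚ.+ q) (ℚₚ.+-identityʳ p) (ℚₚ.+-monoʳ-≤ p 0≤q)

interval-∣∣ : ∀ {l h u p q} → l ℚ.+ h ≡ u → l ℚ.≤ p → p ℚ.≤ u → l ℚ.≤ q → q ℚ.≤ u → ∣ p ℚ.- q ∣ ℚ.≤ h
interval-∣∣ {l} {h} {p = p} {q} refl l≤p p≤ l≤q q≤ = ∣∣≤ (half p q p≤ l≤q) (subst (ℚ._≤ h) (sym (neg-difference p q)) (half q p q≤ l≤p))
  where
  half : ∀ p q → p ℚ.≤ l ℚ.+ h → l ℚ.≤ q → p ℚ.- q ℚ.≤ h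
  half p q p≤ l≤q = p≤r+q⇒p-q≤r (ℚₚ.≤-trans p≤ (subst (l ℚ.+ h ℚ.≤_) (ℚₚ.+-comm q h) (ℚₚ.+-monoˡ-≤ h l≤q)))

∣∣-sym : ∀ p q → ∣ p ℚ.- q ∣ ≡ ∣ q ℚ.- p ∣
∣∣-sym p q = trans (sym (ℚₚ.∣-p∣≡∣p∣ (p ℚ.- q))) (cong ∣_∣ (neg-difference p q))

-- The relation `<ᵣ` demands a positive gap: one half of `ε` covers the distance, the other half is
-- the gap.
close⇒≤ : ∀ {ε p q} → ∣ p ℚ.- q ∣ ℚ.≤ ½ ℚ.* ε → p ℚ.+ ½ ℚ.* ε ℚ.≤ q ℚ.+ ε
close⇒≤ {ε} {p} {q} close = begin
  p ℚ.+ ½ ℚ.* ε                        ≤⟨ ℚₚ.+-monoˡ-≤ (½ ℚ.* ε) (p-q≤r⇒p≤r+q {p} {q} (ℚₚ.≤-trans (≤∣∣ (p ℚ.- q)) close)) ⟩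
  ½ ℚ.* ε ℚ.+ q ℚ.+ ½ ℚ.* ε            ≡⟨ regroup (½ ℚ.* ε) q ⟩
  q ℚ.+ (½ ℚ.* ε ℚ.+ ½ ℚ.* ε)          ≡⟨ cong (q ℚ.+_) (½+½ ε) ⟩
  q ℚ.+ ε                              ∎
  where
  open ℚₚ.≤-Reasoning
  regroup : ∀ e q → e ℚ.+ q ℚ.+ e ≡ q ℚ.+ (e ℚ.+ e)
  regroup = solve 2 (λ e q → e :+ q :+ e := q :+ (e :+ e)) refl
    where open ℚSolver.+-*-Solver

opaque

  width : ℕ → ℚ
  width n = ½ ^ n

  width-0 : width 0 ≡ 1ℚ
  width-0 = refl

  width-pos : ∀ n → 0ℚ ℚ.< width n
  width-pos = ½^-pos

  width-half : ∀ n → width (suc n) ℚ.+ width (suc n) ≡ width n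
  width-half n = ½+½ (½ ^ n)

  width-small : ∀ ε → 0ℚ ℚ.< ε → ∃[ n ] width n ℚ.≤ ε
  width-small = ½^-small

-- Each bracket has its low end in `U` and its high end in `V`; `cover` says which end a midpoint
-- replaces. The limit point lies in `S`, hence in `U` or in `V`, and by openness that set also
-- contains the opposite end of a sufficiently narrow bracket. This end lies in both sets.
module Bisection {d} {S U V : Pred (Point d) 0ℓ} (convex : Convex S) (U-open : Open U) (V-open : Open V)
  (cover : S ⊆ U ∪ V) (x y : Point d) (x∈S : x ∈ S) (y∈S : y ∈ S) (x∈U : x ∈ U) (y∈V : y ∈ V) where

  at : ℚ → Point d
  at a = affine x y (fromℚ a)

  at∈S : ∀ a → 0ℚ ℚ.≤ a → a ℚ.≤ 1ℚ → at a ∈ S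
  at∈S a 0≤a a≤1 = convex x y (fromℚ a) (λ _ → 0≤a) (λ _ → a≤1) x∈S y∈S

  record Bracket (n : ℕ) : Set where
    field
      low high : ℚ
      width-≡  : low ℚ.+ width n ≡ high
      0≤low    : 0ℚ ℚ.≤ low
      high≤1   : high ℚ.≤ 1ℚ
      low∈U    : at low ∈ U
      high∈V   : at high ∈ V
  open Bracket

  start : Bracket 0
  start = record
    { low     = 0ℚ
    ; high    = 1ℚ
    ; width-≡ = trans (ℚₚ.+-identityˡ (width 0)) width-0
    ; 0≤low   = ℚₚ.≤-refl
    ; high≤1  = ℚₚ.≤-refl
    ; low∈U   = open-resp U-open (λ k m → trans (seq-affine x y (fromℚ 0ℚ) k m) (at-0 (seq (x k) m) (seq (y k) m))) x∈U
    ; high∈V  = open-resp V-open (λ k m → trans (seq-affine x y (fromℚ 1ℚ) k m) (at-1 (seq (x k) m) (seq (y k) m))) y∈V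
    }
    where
    at-0 : ∀ p q → p ℚ.+ 0ℚ ℚ.* (q ℚ.+ ℚ.- 1ℚ ℚ.* p) ≡ p
    at-0 = solve 2 (λ p q → p :+ con 0ℚ :* (q :+ :- con 1ℚ :* p) := p) refl
      where open ℚSolver.+-*-Solver
    at-1 : ∀ p q → p ℚ.+ 1ℚ ℚ.* (q ℚ.+ ℚ.- 1ℚ ℚ.* p) ≡ q
    at-1 = solve 2 (λ p q → p :+ con 1ℚ :* (q :+ :- con 1ℚ :* p) := q) refl
      where open ℚSolver.+-*-Solver

  record Refinement {n} (β : Bracket n) : Set where
    field
      next      : Bracket (suc n)
      low-≤     : low β ℚ.≤ low next
      high-≤    : high next ℚ.≤ high β

  refine-at : ∀ {n} (β : Bracket n) mid → low β ℚ.+ width (suc n) ≡ mid → mid ℚ.+ width (suc n) ≡ high β →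
              low β ℚ.≤ mid → mid ℚ.≤ high β → at mid ∈ U ⊎ at mid ∈ V → Refinement β
  refine-at β mid left right low≤mid mid≤high (inj₁ mid∈U) = record
    { next   = record
      { low     = mid
      ; high    = high β
      ; width-≡ = right
      ; 0≤low   = ℚₚ.≤-trans (0≤low β) low≤mid
      ; high≤1  = high≤1 β
      ; low∈U   = mid∈U
      ; high∈V  = high∈V β
      }
    ; low-≤  = low≤mid
    ; high-≤ = ℚₚ.≤-refl
    }
  refine-at β mid left right low≤mid mid≤high (inj₂ mid∈V) = record
    { next   = record
      { low     = low β
      ; high    = mid
      ; width-≡ = left
      ; 0≤low   = 0≤low β
      ; high≤1  = ℚₚ.≤-trans mid≤high (high≤1 β)
      ; low∈U   = low∈U β
      ; high∈V  = mid∈V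
      }
    ; low-≤  = ℚₚ.≤-refl
    ; high-≤ = mid≤high
    }

  refine : ∀ {n} (β : Bracket n) → Refinement β
  refine {n} β = halve (low β ℚ.+ width (suc n)) refl
    where
    halve : ∀ mid → low β ℚ.+ width (suc n) ≡ mid → Refinement β
    halve mid left = refine-at β mid left right low≤mid mid≤high
      (cover (at∈S mid (ℚₚ.≤-trans (0≤low β) low≤mid) (ℚₚ.≤-trans mid≤high (high≤1 β))))
      where
      0≤width = ℚₚ.<⇒≤ (width-pos (suc n))
      right : mid ℚ.+ width (suc n) ≡ high β
      right = trans (cong (ℚ._+ width (suc n)) (sym left))
        (trans (ℚₚ.+-assoc (low β) (width (suc n)) (width (suc n)))
          (trans (cong (low β ℚ.+_) (width-half n)) (width-≡ β)))
      low≤mid : low β ℚ.≤ mid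
      low≤mid = subst (low β ℚ.≤_) left (p≤p+q (low β) 0≤width)
      mid≤high : mid ℚ.≤ high β
      mid≤high = subst (mid ℚ.≤_) right (p≤p+q mid 0≤width)

  bracket : ∀ n → Bracket n
  bracket zero    = start
  bracket (suc n) = Refinement.next (refine (bracket n))

  lows highs : ℕ → ℚ
  lows n  = low (bracket n)
  highs n = high (bracket n)

  lows-mono : ∀ {n m} → n ≤ m → lows n ℚ.≤ lows m
  lows-mono {n} n≤m = go (ℕₚ.≤⇒≤′ n≤m)
    where
    go : ∀ {m} → n ≤′ m → lows n ℚ.≤ lows m
    go (≤′-reflexive refl) = ℚₚ.≤-refl
    go {suc m} (≤′-step n≤m) = ℚₚ.≤-trans (go n≤m) (Refinement.low-≤ (refine (bracket m)))

  highs-anti : ∀ {n m} → n ≤ m → highs m ℚ.≤ highs n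
  highs-anti {n} n≤m = go (ℕₚ.≤⇒≤′ n≤m)
    where
    go : ∀ {m} → n ≤′ m → highs m ℚ.≤ highs n
    go (≤′-reflexive refl) = ℚₚ.≤-refl
    go {suc m} (≤′-step n≤m) = ℚₚ.≤-trans (Refinement.high-≤ (refine (bracket m))) (go n≤m)

  lows≤highs : ∀ n → lows n ℚ.≤ highs n
  lows≤highs n = subst (lows n ℚ.≤_) (width-≡ (bracket n)) (p≤p+q (lows n) (ℚₚ.<⇒≤ (width-pos n)))

  lows≤highs′ : ∀ {n m} → n ≤ m → lows m ℚ.≤ highs n
  lows≤highs′ {n} {m} n≤m = ℚₚ.≤-trans (lows≤highs m) (highs-anti n≤m)

  limit : ℝ
  limit = mkℝ lows converges
    where
    converges : ∀ ε → 0ℚ ℚ.< ε → ∃[ N ] ∀ m n → N ≤ m → N ≤ n → ∣ lows m ℚ.- lows n ∣ ℚ.< ε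
    converges ε 0<ε = from (width-small (½ ℚ.* ε) (½*-pos 0<ε))
      where
      ½ε<ε : ½ ℚ.* ε ℚ.< ε
      ½ε<ε = subst₂ ℚ._<_ (ℚₚ.+-identityʳ (½ ℚ.* ε)) (½+½ ε) (ℚₚ.+-monoʳ-< (½ ℚ.* ε) (½*-pos 0<ε))
      from : (∃[ N ] width N ℚ.≤ ½ ℚ.* ε) → ∃[ N ] ∀ m n → N ≤ m → N ≤ n → ∣ lows m ℚ.- lows n ∣ ℚ.< ε
      from (N , le) = N , λ m n N≤m N≤n → ℚₚ.≤-<-trans
        (interval-∣∣ {lows N} (width-≡ (bracket N)) (lows-mono N≤m) (lows≤highs′ N≤m) (lows-mono N≤n) (lows≤highs′ N≤n))
        (ℚₚ.≤-<-trans le ½ε<ε)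

  limit∈S : affine x y limit ∈ S
  limit∈S = convex x y limit (λ m → 0≤low (bracket m)) (λ m → ℚₚ.≤-trans (lows≤highs m) (high≤1 (bracket m))) x∈S y∈S

  -- From index `n` on, the sequence of `limit` stays in the `n`-th bracket, hence within `width n`
  -- of `b`. Coordinates move by at most that times a common bound for the coordinates of `y - x`.
  near-limit : ∀ ε → 0ℚ ℚ.< ε → ∃[ n ] ∀ b → lows n ℚ.≤ b → b ℚ.≤ highs n → Near ε (affine x y limit) (at b)
  near-limit ε 0<ε = from-bound (jointly-bounded (λ k → y k +ᵣ fromℚ (ℚ.- 1ℚ) *ᵣ x k))
    where
    open ℚₚ.≤-Reasoning
    Goal = ∃[ n ] ∀ b → lows n ℚ.≤ b → b ℚ.≤ highs n → Near ε (affine x y limit) (at b)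
    gap : Fin d → ℕ → ℚ
    gap k m = seq (y k) m ℚ.+ ℚ.- 1ℚ ℚ.* seq (x k) m
    difference : ∀ p c b D → (p ℚ.+ c ℚ.* D) ℚ.- (p ℚ.+ b ℚ.* D) ≡ D ℚ.* (c ℚ.- b)
    difference = solve 4 (λ p c b D → (p :+ c :* D) :- (p :+ b :* D) := D :* (c :- b)) refl
      where open ℚSolver.+-*-Solver
    module _ {B δ : ℚ} {n : ℕ} (0≤B : 0ℚ ℚ.≤ B) (Bδ≤ : B ℚ.* δ ℚ.≤ ½ ℚ.* ε) (small-step : width n ℚ.≤ δ)
             (b : ℚ) (low≤b : lows n ℚ.≤ b) (b≤high : b ℚ.≤ highs n) where
      close : ∀ k m → ∣ gap k m ∣ ℚ.≤ B → n ≤ m →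
              ∣ seq (affine x y limit k) m ℚ.- seq (at b k) m ∣ ℚ.≤ ½ ℚ.* ε
      close k m bound n≤m = begin
        ∣ seq (affine x y limit k) m ℚ.- seq (at b k) m ∣   ≡⟨ cong ∣_∣ (trans (cong₂ ℚ._-_ (seq-affine x y limit k m) (seq-affine x y (fromℚ b) k m)) (difference (seq (x k) m) (lows m) b (gap k m))) ⟩
        ∣ gap k m ℚ.* (lows m ℚ.- b) ∣                      ≡⟨ ℚₚ.∣p*q∣≡∣p∣*∣q∣ (gap k m) (lows m ℚ.- b) ⟩
        ∣ gap k m ∣ ℚ.* ∣ lows m ℚ.- b ∣                    ≤⟨ *-monoˡ-≤ ∣ lows m ℚ.- b ∣ (ℚₚ.0≤∣p∣ (lows m ℚ.- b)) bound ⟩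
        B ℚ.* ∣ lows m ℚ.- b ∣                              ≤⟨ *-monoʳ-≤ B 0≤B (interval-∣∣ {lows n} (width-≡ (bracket n)) (lows-mono n≤m) (lows≤highs′ n≤m) low≤b b≤high) ⟩
        B ℚ.* width n                                         ≤⟨ *-monoʳ-≤ B 0≤B small-step ⟩
        B ℚ.* δ                                             ≤⟨ Bδ≤ ⟩
        ½ ℚ.* ε                                             ∎
      near : (∀ k → Eventually (λ m → ∣ gap k m ∣ ℚ.≤ B)) → Near ε (affine x y limit) (at b)
      near bound k = let M , bounded-k = bound k in
          (½ ℚ.* ε , ½*-pos 0<ε , M ⊔ n , λ m le →
            close⇒≤ {ε} {seq (affine x y limit k) m} {seq (at b k) m}
              (close k m (bounded-k m (ℕₚ.m⊔n≤o⇒m≤o M n le)) (ℕₚ.m⊔n≤o⇒n≤o M n le)))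
        , (½ ℚ.* ε , ½*-pos 0<ε , M ⊔ n , λ m le →
            close⇒≤ {ε} {seq (at b k) m} {seq (affine x y limit k) m}
              (subst (ℚ._≤ ½ ℚ.* ε) (∣∣-sym (seq (affine x y limit k) m) (seq (at b k) m))
                (close k m (bounded-k m (ℕₚ.m⊔n≤o⇒m≤o M n le)) (ℕₚ.m⊔n≤o⇒n≤o M n le))))
    from-bound : (∃[ B ] 0ℚ ℚ.≤ B × (∀ k → Eventually (λ m → ∣ gap k m ∣ ℚ.≤ B))) → Goal
    from-bound (B , 0≤B , bound) = from-radius (radius B 0≤B (½*-pos 0<ε))
      where
      from-step : ∀ {δ} → B ℚ.* δ ℚ.≤ ½ ℚ.* ε → (∃[ n ] width n ℚ.≤ δ) → Goal
      from-step Bδ≤ (n , small-step) = n , λ b low≤b b≤high → near 0≤B Bδ≤ small-step b low≤b b≤high bound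
      from-radius : (∃[ δ ] 0ℚ ℚ.< δ × B ℚ.* δ ℚ.≤ ½ ℚ.* ε) → Goal
      from-radius (δ , 0<δ , Bδ≤) = from-step Bδ≤ (width-small δ 0<δ)

  intersect : ∃[ z ] z ∈ S ∩ (U ∩ V)
  intersect = meet (cover limit∈S)
    where
    Close : ℚ → Set
    Close ε = ∃[ n ] ∀ b → lows n ℚ.≤ b → b ℚ.≤ highs n → Near ε (affine x y limit) (at b)
    high-meets : ∀ {ε} → (∀ z → Near ε (affine x y limit) z → z ∈ U) → Close ε → ∃[ z ] z ∈ S ∩ (U ∩ V)
    high-meets ball (n , near) = at (highs n) ,
      at∈S (highs n) (ℚₚ.≤-trans (0≤low (bracket n)) (lows≤highs n)) (high≤1 (bracket n)) ,
      ball (at (highs n)) (near (highs n) (lows≤highs n) ℚₚ.≤-refl) , high∈V (bracket n)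
    low-meets : ∀ {ε} → (∀ z → Near ε (affine x y limit) z → z ∈ V) → Close ε → ∃[ z ] z ∈ S ∩ (U ∩ V)
    low-meets ball (n , near) = at (lows n) ,
      at∈S (lows n) (0≤low (bracket n)) (ℚₚ.≤-trans (lows≤highs n) (high≤1 (bracket n))) ,
      low∈U (bracket n) , ball (at (lows n)) (near (lows n) ℚₚ.≤-refl (lows≤highs n))
    meet : affine x y limit ∈ U ⊎ affine x y limit ∈ V → ∃[ z ] z ∈ S ∩ (U ∩ V)
    meet (inj₁ lim∈U) = let ε , 0<ε , ball = U-open (affine x y limit) lim∈U in high-meets ball (near-limit ε 0<ε)
    meet (inj₂ lim∈V) = let ε , 0<ε , ball = V-open (affine x y limit) lim∈V in low-meets ball (near-limit ε 0<ε)

convex⇒connected : ∀ {d} {S : Pred (Point d) 0ℓ} → Convex S → Connected S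
convex⇒connected convex U V U-open V-open cover (x , x∈S , x∈U) (y , y∈S , y∈V) empty =
  let z , z∈ = Bisection.intersect convex U-open V-open cover x y x∈S y∈S x∈U y∈V in empty z z∈

-- Chambers are the nonempty cells

cell⊆complement : ∀ {d n} (w : Vec Sign n) → Cell {d} w ⊆ Complement d n
cell⊆complement w {x} x∈ j = side⇒apart (lookup w j) (node j) x (x∈ j)

cell-unique : ∀ {d n} (v w : Vec Sign n) {x : Point d} → x ∈ Cell v → x ∈ Cell w → v ≡ w
cell-unique v w {x} x∈v x∈w = begin
  v                     ≡⟨ sym (Vecₚ.tabulate∘lookup v) ⟩
  tabulate (lookup v)   ≡⟨ Vecₚ.tabulate-cong (λ j → side-unique (node j) x (x∈v j) (x∈w j)) ⟩
  tabulate (lookup w)   ≡⟨ Vecₚ.tabulate∘lookup w ⟩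
  w                     ∎
  where open ≡-Reasoning

connected-sign : ∀ {d n} {D : Pred (Point d) 0ℓ} → D ⊆ Complement d n → Connected D →
                 ∀ {x y} → x ∈ D → y ∈ D → ∀ s j → x ∈ Side s (node {n} j) → y ∈ Side s (node j)
connected-sign {D = D} D⊆ connected {x} {y} x∈D y∈D s j x-side = decide (opposite-side y∈D)
  where
  opposite-side : ∀ {z} → z ∈ D → z ∈ Side s (node j) ⊎ z ∈ Side (opposite s) (node j)
  opposite-side {z} z∈D = apart⇒side s (node j) z (D⊆ {z} z∈D j)
  -- Apartness already names the side of `y`; connectedness has only to refute the opposite one, for
  -- which its negative conclusion suffices.
  decide : y ∈ Side s (node j) ⊎ y ∈ Side (opposite s) (node j) → y ∈ Side s (node j)
  decide (inj₁ same-side)  = same-side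
  decide (inj₂ other-side) = contradiction
    (λ z (_ , z∈s , z∈-s) → Signₚ.s≢opposite[s] s (side-unique (node j) z z∈s z∈-s))
    (connected (Side s (node j)) (Side (opposite s) (node j)) (side-open s (node j)) (side-open (opposite s) (node j))
      opposite-side (x , x∈D , x-side) (y , y∈D , other-side))

connected⊆cell : ∀ {d n} {D : Pred (Point d) 0ℓ} (w : Vec Sign n) → D ⊆ Complement d n → Connected D →
                 ∀ {x} → x ∈ D → x ∈ Cell w → D ⊆ Cell w
connected⊆cell w D⊆ connected x∈D x∈w y∈D j = connected-sign D⊆ connected x∈D y∈D (lookup w j) j (x∈w j)

cell-connected : ∀ {d n} (w : Vec Sign n) → Connected (Cell {d} w)
cell-connected w = convex⇒connected (cell-convex w)

module _ {d n : ℕ} (C : Chamber d n) where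

  open Chamber C

  nonempty∈cell : proj₁ nonempty ∈ Cell (σ C)
  nonempty∈cell j = subst (λ s → Side s (node j) (proj₁ nonempty)) (sym (Vecₚ.lookup∘tabulate _ j))
    (isSign⇒side _ (node j) (proj₁ nonempty) (sgn-isSign (P (proj₁ nonempty) (fromℕ (node j))) (avoids (proj₂ nonempty) j)))

  region⊆cell : region ⊆ Cell (σ C)
  region⊆cell = connected⊆cell (σ C) avoids connected (proj₂ nonempty) nonempty∈cell

  cell⊆region : Cell (σ C) ⊆ region
  cell⊆region = maximal (Cell (σ C)) (cell⊆complement (σ C)) (cell-connected (σ C)) region⊆cell

  length-changes : length (changes (σ C)) ≤ d
  length-changes = bound (eventually-all λ j → isSign⇒hasSign (lookup (σ C) j) {P x (fromℕ (node j))} (side⇒isSign (lookup (σ C) j) (node j) x (nonempty∈cell j)))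
    where
    x = proj₁ nonempty
    bound : Eventually (λ m → ∀ j → HasSign (lookup (σ C) j) (seq (P x (fromℕ (node j))) m)) → length (changes (σ C)) ≤ d
    -- The coefficients are cut off at an index `N` from which all `n` signs hold simultaneously.
    bound (N , signs) = changes-≤-degree (σ C) (λ k → seq (x k) N)
      (λ j → subst (HasSign (lookup (σ C) j)) (seq-P-value x (node j) N) (signs N ℕₚ.≤-refl j))

-- The sign word is read at the witness of `nonempty`, which may differ for equal chambers. The
-- witness of `C` lies in both cells, and distinct cells are disjoint.
σ-cong : ∀ {d n} (C D : Chamber d n) → C ≈ᶜ D → σ C ≡ σ D
σ-cong C D (C⊆D , _) = cell-unique (σ C) (σ D) {x} (nonempty∈cell C) (region⊆cell D (C⊆D x∈C))
  where
  x = proj₁ (Chamber.nonempty C)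
  x∈C = proj₂ (Chamber.nonempty C)

σ-injective : ∀ {d n} (C D : Chamber d n) → σ C ≡ σ D → C ≈ᶜ D
σ-injective C D eq =
    (λ {x} x∈C → cell⊆region D (subst (λ w → x ∈ Cell w) eq (region⊆cell C x∈C)))
  , (λ {x} x∈D → cell⊆region C (subst (λ w → x ∈ Cell w) (sym eq) (region⊆cell D x∈D)))

cellChamber : ∀ {d n} (w : Vec Sign n) → Satisfiable (Cell {d} w) → Chamber d n
cellChamber w (x , x∈) = record
  { region    = Cell w
  ; avoids    = cell⊆complement w
  ; nonempty  = x , x∈
  ; connected = cell-connected w
  ; maximal   = λ D D⊆ connected cell⊆D → connected⊆cell w D⊆ connected (cell⊆D x∈) x∈
  }

σ-cellChamber : ∀ {d n} (w : Vec Sign n) (x : Satisfiable (Cell {d} w)) → σ (cellChamber w x) ≡ w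
σ-cellChamber w (x , x∈) = cell-unique (σ (cellChamber w (x , x∈))) w {x} (nonempty∈cell (cellChamber w (x , x∈))) x∈

cell-satisfiable : ∀ {d n} (w : Vec Sign n) → length (changes w) ≤ d → Satisfiable (Cell {d} w)
cell-satisfiable w ≤d = rational (realise w ≤d)
  where
  rational : (∃[ q ] ∀ j → HasSign (lookup w j) (eval q ⟦ node j ⟧)) → Satisfiable (Cell w)
  rational (q , signs) = x , λ j → isSign⇒side (lookup w j) (node j) x (side j (lookup w j) (signs j))
    where
    x = fromℚ ∘ q
    side : ∀ j s → HasSign s (eval q ⟦ node j ⟧) → IsSign s (P x (fromℕ (node j)))
    side j Sign.+ 0<v = v , 0<v , 0 , λ m _ →
      subst (0ℚ ℚ.+ v ℚ.≤_) (sym (seq-P-value x (node j) m)) (ℚₚ.≤-reflexive (ℚₚ.+-identityˡ v))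
      where v = eval q ⟦ node j ⟧
    side j Sign.- v<0 = ℚ.- v , ℚₚ.neg-antimono-< v<0 , 0 , λ m _ →
      subst (λ p → p ℚ.+ ℚ.- v ℚ.≤ 0ℚ) (sym (seq-P-value x (node j) m)) (ℚₚ.≤-reflexive (ℚₚ.+-inverseʳ v))
      where v = eval q ⟦ node j ⟧

-- The bijection

λ-of-Ψ : ∀ {d n} (C : Chamber d n) → λ-of (toList (Ψ d n C)) ≡ partition n (d ∸ 3) (changes (σ C))
λ-of-Ψ {d} {n} C = begin
  λ-of (toList (cast (length-W fits) (fromList (W n rs))))   ≡⟨ cong λ-of (Vecₚ.toList-cast (length-W fits) (fromList (W n rs))) ⟩
  λ-of (toList (fromList (W n rs)))                          ≡⟨ cong λ-of (Vecₚ.toList∘fromList (W n rs)) ⟩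
  λ-of (W n rs)                                              ≡⟨ λ-of-W fits ⟩
  rs                                                         ∎
  where
  open ≡-Reasoning
  rs = partition n (d ∸ 3) (changes (σ C))
  fits = fits-partition (d ∸ 3) (σ C)

theorem2 : (n d : ℕ) → 1 ≤ n → 3 ≤ d →
    IsBijection (_≈ᶜ_ {d} {n}) (λ (u w : Word n) → u ≈[ d ∸ 3 ] w) (Ψ d n)
theorem2 n d _ 3≤d = record
  { isInjection = record
    { isCongruent = record
      { cong           = λ {C} {D} → Ψ-cong C D
      ; isEquivalence₁ = record
        { refl  = id , id
        ; sym   = λ (C⊆D , D⊆C) → D⊆C , C⊆D
        ; trans = λ (C⊆D , D⊆C) (D⊆E , E⊆D) → D⊆E ∘ C⊆D , D⊆C ∘ E⊆D
        }
      ; isEquivalence₂ = record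
        { refl  = (refl , refl) , refl
        ; sym   = λ ((p , q) , r) → (sym p , sym q) , sym r
        ; trans = λ ((p , q) , r) ((p′ , q′) , r′) → (trans p p′ , trans q q′) , trans r r′
        }
      }
    ; injective = λ {C} {D} → Ψ-injective C D
    }
  ; surjective = λ w → Ψ-surjective w (partition-surjective s (λ-of (toList w))
      (subst (λ m → Fits m (λ-of (toList w))) (Vecₚ.length-toList w) (λ-of-fits (toList w))))
  }
  where
  s = d ∸ 3
  3+s≡d : 3 + s ≡ d
  3+s≡d = ℕₚ.m+[n∸m]≡n 3≤d

  Ψ-cong : ∀ C D → C ≈ᶜ D → Ψ d n C ≈[ s ] Ψ d n D
  Ψ-cong C D C≈D = ∼⇒≈ (Ψ d n C) (Ψ d n D) (subst₂ _∼[ s ]_ (sym (λ-of-Ψ C))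
    (trans (cong (partition n s ∘ changes) (σ-cong C D C≈D)) (sym (λ-of-Ψ D))) (same refl refl refl))

  Ψ-injective : ∀ C D → Ψ d n C ≈[ s ] Ψ d n D → C ≈ᶜ D
  Ψ-injective C D eqv = σ-injective C D (changes-injective (partition-injective _ _
    (changes-increasing (σ C)) (changes-increasing (σ D))
    (subst (length (changes (σ C)) ≤_) (sym 3+s≡d) (length-changes C))
    (subst (length (changes (σ D)) ≤_) (sym 3+s≡d) (length-changes D))
    (subst₂ _∼[ s ]_ (λ-of-Ψ C) (λ-of-Ψ D) (≈⇒∼ (Ψ d n C) (Ψ d n D) eqv))))

  Ψ-surjective : ∀ w → Preimage n s (λ-of (toList w)) → ∃[ C ] ∀ {D} → D ≈ᶜ C → Ψ d n D ≈[ s ] w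
  Ψ-surjective w (cs , increasing , short , eqv) = chamber (changes-surjective cs increasing)
    where
    -- Surjectivity between setoids concerns every `D` equal to the chosen chamber; `σ-cong` gives
    -- all of them the same sign word.
    hits : ∀ {v} → changes v ≡ cs → (C : Chamber d n) → σ C ≡ v → ∀ {D} → D ≈ᶜ C → Ψ d n D ≈[ s ] w
    hits changes-v C σ-C {D} D≈C = ∼⇒≈ (Ψ d n D) w (subst (_∼[ s ] λ-of (toList w))
      (sym (trans (λ-of-Ψ D) (cong (partition n s) (trans (cong changes (trans (σ-cong D C D≈C) σ-C)) changes-v)))) eqv)
    satisfiable : ∀ v → changes v ≡ cs → Satisfiable (Cell {d} v)
    satisfiable v changes-v = cell-satisfiable v (subst₂ _≤_ (cong length (sym changes-v)) 3+s≡d short)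
    chamber : (∃[ v ] changes v ≡ cs) → ∃[ C ] ∀ {D} → D ≈ᶜ C → Ψ d n D ≈[ s ] w
    chamber (v , changes-v) = cellChamber v (satisfiable v changes-v) ,
      λ {D} → hits changes-v (cellChamber v (satisfiable v changes-v)) (σ-cellChamber v (satisfiable v changes-v)) {D}
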